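{- Let $G=(X,Y,E)$ be a chain graph without isolated vertices, given along with a chain ordering of its vertices, and suppose that the number $k$ of open-twin classes of $X$ satisfies $k\ge 2$. Then the chain graph algorithm described in the context, applied to $G$, outputs a Grundy dominating sequence $S$ of $G$ (that is, a dominating sequence of $G$ of maximum length), and it runs in linear time, i.e. in time $O(|V(G)|+|E|)$.
   Context: Graphs are finite and simple; $N(x)$ is the set of neighbors of $x$ and $N[x]=N(x)\cup\{x\}$. A dominating sequence of $G$ is a sequence $(v_1,\dots,v_p)$ of vertices such that $N[v_i]\setminus\bigcup_{j<i}N[v_j]\ne\emptyset$ for every $i\in\{2,\dots,p\}$ and $\bigcup_i N[v_i]=V(G)$; its length is $p$. A Grundy dominating sequence (GD-sequence) is a dominating sequence of maximum length. A bipartite graph $G=(X,Y,E)$ with $|X|=n_1$, $|Y|=n_2$ is a chain graph if its vertices admit a chain ordering $(x_1,\dots,x_{n_1},y_1,\dots,y_{n_2})$, i.e. an ordering with $X=\{x_1,\dots,x_{n_1}\}$, $Y=\{y_1,\dots,y_{n_2}\}$, $N(x_1)\subseteq\cdots\subseteq N(x_{n_1})$ and $N(y_1)\supseteq\cdots\supseteq N(y_{n_2})$. Two vertices $u,v$ are open twins if $N(u)=N(v)$. Let $X_1,\dots,X_k$ be the equivalence classes of $X$ under the open twin relation, indexed so that $N(X_1)\subsetneq N(X_2)\subsetneq\cdots\subsetneq N(X_k)$, where $N(X_i)$ denotes the common neighborhood of the vertices of $X_i$. Let $Y_1=N(X_1)$ and $Y_i=N(X_i)\setminus\bigcup_{j<i}N(X_j)$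 for $2\le i\le k$. For a set $A$ contained in one of $X$, $Y$, $(A)$ denotes the sequence of the vertices of $A$ listed in the order of the chain ordering, and $\oplus$ denotes concatenation of sequences. The algorithm. Input: a chain graph $G$ without isolated vertices, with a chain ordering. Compute $X_1,\dots,X_k,Y_1,\dots,Y_k$. Set $\mathrm{sum}[0]=n_2+|X_1|$ if $|Y_1|=1$ and $\mathrm{sum}[0]=n_2$ otherwise; for $1\le i\le k-1$ set $\mathrm{sum}[i]=\sum_{j=1}^i|X_j|+n_2-\sum_{j=1}^i|Y_j|+1$; set $\mathrm{sum}[k]=n_1+|Y_k|$ if $|X_k|=1$ and $\mathrm{sum}[k]=n_1$ otherwise. Find an index $i^*\in\{0,1,\dots,k\}$ for which $\mathrm{sum}[i^*]$ is maximum. Then return $S$, where: (i) if $i^*=0$ and $|Y_1|>1$: $S=(Y_k)\oplus(Y_{k-1})\oplus\cdots\oplus(Y_1)$; (ii) if $i^*=0$ and $|Y_1|=1$: $S=(X_1)\oplus(Y_k)\oplus(Y_{k-1})\oplus\cdots\oplus(Y_3)\oplus(Y_1)\oplus(Y_2)$ when $k\ge3$, and $S=(X_1)\oplus(Y_1)\oplus(Y_2)$ when $k=2$; (iii) if $i^*=k$ and $|X_k|>1$: $S=(X_1)\oplus(X_2)\oplus\cdots\oplus(X_k)$; (iv) if $i^*=k$ and $|X_k|=1$: $S=(X_1)\oplus\cdots\oplus(X_{k-2})\oplus(Y_k)\oplus(X_k)\oplus(X_{k-1})$ when $k\ge3$, and $S=(Y_2)\oplus(X_2)\oplus(X_1)$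 when $k=2$; (v) if $1\le i^*\le k-1$: choose a vertex $x\in X_{i^*+1}$; $S=(X_1)\oplus\cdots\oplus(X_{i^*-1})\oplus(Y_k)\oplus(Y_{k-1})\oplus\cdots\oplus(Y_{i^*+1})\oplus(x)\oplus(X_{i^*})$ when $i^*>1$, and $S=(Y_k)\oplus\cdots\oplus(Y_2)\oplus(x)\oplus(X_1)$ when $i^*=1$. -}

module Defs where

open import Data.Bool using (if_then_else_)
import Data.Bool.Properties as Bool
open import Data.Fin using (Fin; toℕ)
open import Data.Fin.Subset using (Subset; _∈_; _⊆_; _⊂_; _∪_; _∩_; _─_; ⋃; ⊤; ⊥; ⁅_⁆; ∣_∣; Nonempty)
open import Data.Fin.Subset.Properties using (_∈?_)
open import Data.List as List using (List; []; _∷_; _++_; map; foldl; foldr; length; lookup; take; filter; concatMap; upTo; allFin; cartesianProduct)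
import Data.List.Membership.Propositional as List
open import Data.List.Relation.Unary.AllPairs using (AllPairs)
open import Data.List.Relation.Unary.Unique.Propositional using (Unique)
open import Data.Nat using (ℕ; zero; suc; _+_; _∸_; _≤_; _<_; _>_; _≥_; _≡ᵇ_; _≤ᵇ_)
open import Data.Nat.ListAction using (sum)
open import Data.Nat.GeneralisedArithmetic using (fold)
open import Data.Product using (_×_; _,_; proj₁; proj₂; ∃-syntax)
open import Data.Sum using (_⊎_)
open import Data.Vec using (tabulate)
import Data.Vec.Properties as Vec
open import Function using (_⇔_; _∘_)
open import Relation.Binary.PropositionalEquality using (_≡_)
open import Relation.Nullary using (¬_; does)
open import Relation.Nullary.Decidable using (_×-dec_)

record Graph : Set where
  field
    n      : ℕ
    N      : Fin n → Subset n
    sym    : ∀ {u v} → v ∈ N u → u ∈ N v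
    irrefl : ∀ {v} → ¬ (v ∈ N v)

  Vertex : Set
  Vertex = Fin n

  N[_] : Vertex → Subset n
  N[ v ] = N v ∪ ⁅ v ⁆

  NoIsolated : Set
  NoIsolated = ∀ v → Nonempty (N v)

  -- Positions are counted from 0, so the first vertex is the one exempted.
  record IsDominatingSequence (S : List Vertex) : Set where
    field
      footprints : ∀ (i : Fin (length S)) → 0 < toℕ i →
                   Nonempty (N[ lookup S i ] ─ ⋃ (map N[_] (take (toℕ i) S)))
      dominates  : ⋃ (map N[_] S) ≡ ⊤

  record IsGrundyDominatingSequence (S : List Vertex) : Set where
    field
      isDominatingSequence : IsDominatingSequence S
      maximum : ∀ T → IsDominatingSequence T → length T ≤ length S

_Enumerates_ : ∀ {n} → List (Fin n) → Subset n → Set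
l Enumerates A = Unique l × (∀ v → (v List.∈ l) ⇔ (v ∈ A))

record BipartiteGraph : Set where
  field
    graph : Graph
  open Graph graph public
  field
    X Y       : Subset n
    cover     : X ∪ Y ≡ ⊤
    disjoint  : X ∩ Y ≡ ⊥
    bipartite : ∀ {u v} → v ∈ N u → (u ∈ X × v ∈ Y) ⊎ (u ∈ Y × v ∈ X)

  n₁ n₂ : ℕ
  n₁ = ∣ X ∣
  n₂ = ∣ Y ∣

  E : List (Vertex × Vertex)
  E = filter (λ e → (proj₁ e ∈? X) ×-dec (proj₂ e ∈? N (proj₁ e)))
             (cartesianProduct (allFin n) (allFin n))

  ∣E∣ : ℕ
  ∣E∣ = length E

record ChainOrdering (B : BipartiteGraph) : Set where
  open BipartiteGraph B
  field
    xs ys : List Vertex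
    enumX : xs Enumerates X
    enumY : ys Enumerates Y
    incr  : AllPairs (λ u v → N u ⊆ N v) xs
    decr  : AllPairs (λ u v → N v ⊆ N u) ys

  -- (A), for A contained in one of X, Y.
  listed : Subset n → List Vertex
  listed A = filter (_∈? A) (xs ++ ys)

-- [ a , a + 1 , … , b ], empty when b < a.
range : ℕ → ℕ → List ℕ
range a b = map (a +_) (upTo (suc b ∸ a))

-- The open twin classes X_1, …, X_k are presented by representatives: only
-- rep 1, …, rep k are meaningful, and N(X_i) is N (rep i).
record TwinClasses (B : BipartiteGraph) : Set where
  open BipartiteGraph B
  field
    k        : ℕ
    rep      : ℕ → Vertex
    rep∈X    : ∀ i → 1 ≤ i → i ≤ k → rep i ∈ X
    complete : ∀ v → v ∈ X → ∃[ i ] (1 ≤ i × i ≤ k × N v ≡ N (rep i))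
    strict   : ∀ i j → 1 ≤ i → i < j → j ≤ k → N (rep i) ⊂ N (rep j)

  NX : ℕ → Subset n
  NX i = N (rep i)

  Xᶜ : ℕ → Subset n
  Xᶜ i = tabulate λ v → does ((v ∈? X) ×-dec Vec.≡-dec Bool._≟_ (N v) (NX i))

  Yᶜ : ℕ → Subset n
  Yᶜ i = NX i ─ ⋃ (map NX (range 1 (i ∸ 1)))

-- The choices of i* (among the maximisers) and of x are left open, so the
-- algorithm is a relation to its possible outputs.
module Algorithm (B : BipartiteGraph) (O : ChainOrdering B) (T : TwinClasses B) where
  open BipartiteGraph B
  open ChainOrdering O
  open TwinClasses T

  total : ℕ → ℕ
  total zero    = if ∣ Yᶜ 1 ∣ ≡ᵇ 1 then n₂ + ∣ Xᶜ 1 ∣ else n₂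
  total (suc i) =
    if suc i ≡ᵇ k
    then (if ∣ Xᶜ k ∣ ≡ᵇ 1 then n₁ + ∣ Yᶜ k ∣ else n₁)
    else sum (map (λ j → ∣ Xᶜ j ∣) (range 1 (suc i))) + n₂
         ∸ sum (map (λ j → ∣ Yᶜ j ∣) (range 1 (suc i))) + 1

  IsBest : ℕ → Set
  IsBest i = i ≤ k × (∀ j → j ≤ k → total j ≤ total i)

  -- (X_a) ⊕ (X_{a+1}) ⊕ ⋯ ⊕ (X_b)
  upX : ℕ → ℕ → List Vertex
  upX a b = concatMap (listed ∘ Xᶜ) (range a b)

  -- (Y_b) ⊕ (Y_{b-1}) ⊕ ⋯ ⊕ (Y_a)
  downY : ℕ → ℕ → List Vertex
  downY b a = concatMap (listed ∘ Yᶜ) (List.reverse (range a b))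

  data Returns : ℕ → List Vertex → Set where
    i-    : ∣ Yᶜ 1 ∣ > 1 →
            Returns 0 (downY k 1)
    ii-≥3 : ∣ Yᶜ 1 ∣ ≡ 1 → k ≥ 3 →
            Returns 0 (listed (Xᶜ 1) ++ downY k 3 ++ listed (Yᶜ 1) ++ listed (Yᶜ 2))
    ii-2  : ∣ Yᶜ 1 ∣ ≡ 1 → k ≡ 2 →
            Returns 0 (listed (Xᶜ 1) ++ listed (Yᶜ 1) ++ listed (Yᶜ 2))
    iii-  : ∣ Xᶜ k ∣ > 1 →
            Returns k (upX 1 k)
    iv-≥3 : ∣ Xᶜ k ∣ ≡ 1 → k ≥ 3 →
            Returns k (upX 1 (k ∸ 2) ++ listed (Yᶜ k) ++ listed (Xᶜ k) ++ listed (Xᶜ (k ∸ 1)))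
    iv-2  : ∣ Xᶜ k ∣ ≡ 1 → k ≡ 2 →
            Returns k (listed (Yᶜ 2) ++ listed (Xᶜ 2) ++ listed (Xᶜ 1))
    v->1  : ∀ {i x} → 1 < i → i ≤ k ∸ 1 → x ∈ Xᶜ (suc i) →
            Returns i (upX 1 (i ∸ 1) ++ downY k (suc i) ++ (x ∷ []) ++ listed (Xᶜ i))
    v-1   : ∀ {x} → 1 ≤ k ∸ 1 → x ∈ Xᶜ 2 →
            Returns 1 (downY k 2 ++ (x ∷ []) ++ listed (Xᶜ 1))

  Output : List Vertex → Set
  Output S = ∃[ i ] (IsBest i × Returns i S)

-- Running time is measured by a unit-cost semantics of a first-order language.
-- Values are numbers, opaque vertices, pairs and immutable linked lists.
-- Each construct is executable in constant time on a unit-cost RAM, apart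
-- from the evaluation of its subterms, and is charged accordingly.  Terms
-- are in parametric higher-order syntax; there are no function values, so
-- iteration is only by the three loops.

data Ty : Set where
  nat vert : Ty
  list     : Ty → Ty
  _⊗_      : Ty → Ty → Ty

infixr 7 _⊗_
infixl 6 _+ᵗ_ _∸ᵗ_
infixr 5 _∷ᵗ_
infixr 4 _,ᵗ_

data Tm (V : Ty → Set) : Ty → Set where
  var     : ∀ {A} → V A → Tm V A
  letᵗ    : ∀ {A B} → Tm V A → (V A → Tm V B) → Tm V B
  lit     : ℕ → Tm V nat
  _+ᵗ_    : Tm V nat → Tm V nat → Tm V nat
  _∸ᵗ_    : Tm V nat → Tm V nat → Tm V nat
  if-eq   : ∀ {A} → Tm V nat → Tm V nat → Tm V A → Tm V A → Tm V A
  if-le   : ∀ {A} → Tm V nat → Tm V nat → Tm V A → Tm V A → Tm V A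
  _,ᵗ_    : ∀ {A B} → Tm V A → Tm V B → Tm V (A ⊗ B)
  fst     : ∀ {A B} → Tm V (A ⊗ B) → Tm V A
  snd     : ∀ {A B} → Tm V (A ⊗ B) → Tm V B
  []ᵗ     : ∀ {A} → Tm V (list A)
  _∷ᵗ_    : ∀ {A} → Tm V A → Tm V (list A) → Tm V (list A)
  caseᵗ   : ∀ {A B} → Tm V (list A) → Tm V B → (V A → V (list A) → Tm V B) → Tm V B
  foldˡ   : ∀ {A B} → Tm V (list A) → Tm V B → (V A → V B → Tm V B) → Tm V B
  foldʳ   : ∀ {A B} → Tm V (list A) → Tm V B → (V A → V B → Tm V B) → Tm V B
  repeatᵗ : ∀ {B} → Tm V nat → Tm V B → (V B → Tm V B) → Tm V B

-- Total cost of the iterations of a loop, given the step function and the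
-- cost of one step; each iteration is charged one further unit.

foldlCost : {A B : Set} → (B → A → B) → (B → A → ℕ) → B → List A → ℕ
foldlCost step cost b []       = 0
foldlCost step cost b (a ∷ as) = suc (cost b a) + foldlCost step cost (step b a) as

foldrCost : {A B : Set} → (A → B → B) → (A → B → ℕ) → B → List A → ℕ
foldrCost step cost b []       = 0
foldrCost step cost b (a ∷ as) = suc (cost a (foldr step b as)) + foldrCost step cost b as

repeatCost : {B : Set} → (B → B) → (B → ℕ) → B → ℕ → ℕ
repeatCost step cost b zero    = 0
repeatCost step cost b (suc m) = suc (cost (fold b step m)) + repeatCost step cost b m

module Semantics (Vtx : Set) where

  Val : Ty → Set
  Val nat      = ℕ
  Val vert     = Vtx
  Val (list A) = List (Val A)
  Val (A ⊗ B)  = Val A × Val B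

  ⟦_⟧ : ∀ {A} → Tm Val A → Val A
  ⟦ var a ⟧         = a
  ⟦ letᵗ e f ⟧      = ⟦ f ⟦ e ⟧ ⟧
  ⟦ lit m ⟧         = m
  ⟦ d +ᵗ e ⟧        = ⟦ d ⟧ + ⟦ e ⟧
  ⟦ d ∸ᵗ e ⟧        = ⟦ d ⟧ ∸ ⟦ e ⟧
  ⟦ if-eq d e s t ⟧ = if ⟦ d ⟧ ≡ᵇ ⟦ e ⟧ then ⟦ s ⟧ else ⟦ t ⟧
  ⟦ if-le d e s t ⟧ = if ⟦ d ⟧ ≤ᵇ ⟦ e ⟧ then ⟦ s ⟧ else ⟦ t ⟧
  ⟦ d ,ᵗ e ⟧        = ⟦ d ⟧ , ⟦ e ⟧
  ⟦ fst e ⟧         = proj₁ ⟦ e ⟧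
  ⟦ snd e ⟧         = proj₂ ⟦ e ⟧
  ⟦ []ᵗ ⟧           = []
  ⟦ d ∷ᵗ e ⟧        = ⟦ d ⟧ ∷ ⟦ e ⟧
  ⟦ caseᵗ e s f ⟧ with ⟦ e ⟧
  ... | []     = ⟦ s ⟧
  ... | a ∷ as = ⟦ f a as ⟧
  ⟦ foldˡ e b f ⟧   = foldl (λ acc a → ⟦ f a acc ⟧) ⟦ b ⟧ ⟦ e ⟧
  ⟦ foldʳ e b f ⟧   = foldr (λ a acc → ⟦ f a acc ⟧) ⟦ b ⟧ ⟦ e ⟧
  ⟦ repeatᵗ e b f ⟧ = fold ⟦ b ⟧ (λ acc → ⟦ f acc ⟧) ⟦ e ⟧

  time : ∀ {A} → Tm Val A → ℕ
  time (var a)         = 1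
  time (letᵗ e f)      = 1 + time e + time (f ⟦ e ⟧)
  time (lit m)         = 1
  time (d +ᵗ e)        = 1 + time d + time e
  time (d ∸ᵗ e)        = 1 + time d + time e
  time (if-eq d e s t) = 1 + time d + time e + (if ⟦ d ⟧ ≡ᵇ ⟦ e ⟧ then time s else time t)
  time (if-le d e s t) = 1 + time d + time e + (if ⟦ d ⟧ ≤ᵇ ⟦ e ⟧ then time s else time t)
  time (d ,ᵗ e)        = 1 + time d + time e
  time (fst e)         = 1 + time e
  time (snd e)         = 1 + time e
  time []ᵗ             = 1
  time (d ∷ᵗ e)        = 1 + time d + time e
  time (caseᵗ e s f) with ⟦ e ⟧
  ... | []     = 1 + time e + time s
  ... | a ∷ as = 1 + time e + time (f a as)
  time (foldˡ e b f)   = 1 + time e + time b +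
    foldlCost (λ acc a → ⟦ f a acc ⟧) (λ acc a → time (f a acc)) ⟦ b ⟧ ⟦ e ⟧
  time (foldʳ e b f)   = 1 + time e + time b +
    foldrCost (λ a acc → ⟦ f a acc ⟧) (λ a acc → time (f a acc)) ⟦ b ⟧ ⟦ e ⟧
  time (repeatᵗ e b f) = 1 + time e + time b +
    repeatCost (λ acc → ⟦ f acc ⟧) (λ acc → time (f acc)) ⟦ b ⟧ ⟦ e ⟧

-- An implementation of the algorithm, making particular choices of i* and x.
module Program {V : Ty → Set} where

  lengthᵗ : ∀ {A} → Tm V (list A) → Tm V nat
  lengthᵗ l = foldʳ l (lit 0) λ _ m → var m +ᵗ lit 1

  append : ∀ {A} → Tm V (list A) → Tm V (list A) → Tm V (list A)
  append l l′ = foldʳ l l′ λ a r → var a ∷ᵗ var r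

  reverseᵗ : ∀ {A} → Tm V (list A) → Tm V (list A)
  reverseᵗ l = foldˡ l []ᵗ λ a r → var a ∷ᵗ var r

  -- [ l₁ , … , l_m ] and acc give l_m ++ ⋯ ++ l₁ ++ acc.
  prepend : ∀ {A} → Tm V (list (list A)) → Tm V (list A) → Tm V (list A)
  prepend ls acc = foldˡ ls acc λ l r → append (var l) (var r)

  -- The first m elements in reverse order, and the remaining elements.
  split : ∀ {A} → Tm V nat → Tm V (list A) → Tm V (list A ⊗ list A)
  split m l = repeatᵗ m ([]ᵗ ,ᵗ l) λ s →
    caseᵗ (snd (var s)) (var s) λ a r → (var a ∷ᵗ fst (var s)) ,ᵗ var r

  -- Along one side of a chain ordering open twins are consecutive, and they
  -- are exactly the vertices of equal degree.  Each block is stored with its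
  -- degree.
  group : Tm V (list (vert ⊗ list vert)) → Tm V (list (nat ⊗ list vert))
  group l = foldʳ l []ᵗ λ v cs →
    letᵗ (lengthᵗ (snd (var v))) λ d →
    caseᵗ (var cs) ((var d ,ᵗ (fst (var v) ∷ᵗ []ᵗ)) ∷ᵗ []ᵗ) λ c cs′ →
    if-eq (var d) (fst (var c))
      ((var d ,ᵗ (fst (var v) ∷ᵗ snd (var c))) ∷ᵗ var cs′)
      ((var d ,ᵗ (fst (var v) ∷ᵗ []ᵗ)) ∷ᵗ var cs)

  -- Applied to the Y-side this yields Y₁, …, Y_k, since without isolated
  -- vertices these are the open twin classes of Y.
  classes : Tm V (list (vert ⊗ list vert)) → Tm V (list (list vert))
  classes l = foldʳ (group l) []ᵗ λ c r → snd (var c) ∷ᵗ var r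

  sum₀ : Tm V nat → V (list (list vert)) → V (list (list vert)) → Tm V nat
  sum₀ n₂ Xs Ys =
    caseᵗ (var Ys) (lit 0) λ Y₁ _ →
    caseᵗ (var Xs) (lit 0) λ X₁ _ →
    if-eq (lengthᵗ (var Y₁)) (lit 1) (n₂ +ᵗ lengthᵗ (var X₁)) n₂

  -- [ sum[k] , … , sum[0] ].  The state before class i consists of Y_i, …, Y_k,
  -- of |X_1| + ⋯ + |X_{i-1}|, of n₂ - (|Y_1| + ⋯ + |Y_{i-1}|), and of the sums
  -- found so far.
  sums : V nat → V (list (list vert)) → V (list (list vert)) → Tm V (list nat)
  sums n₂ Xs Ys = snd (snd (snd
    (foldˡ (var Xs) (var Ys ,ᵗ lit 0 ,ᵗ var n₂ ,ᵗ (sum₀ (var n₂) Xs Ys ∷ᵗ []ᵗ)) λ Xᵢ s →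
      caseᵗ (fst (var s)) (var s) λ Yᵢ rest →
      letᵗ (fst (snd (var s)) +ᵗ lengthᵗ (var Xᵢ)) λ a →
      letᵗ (fst (snd (snd (var s))) ∸ᵗ lengthᵗ (var Yᵢ)) λ b →
      letᵗ (caseᵗ (var rest)
             (if-eq (lengthᵗ (var Xᵢ)) (lit 1) (var a +ᵗ lengthᵗ (var Yᵢ)) (var a))
             (λ _ _ → var a +ᵗ var b +ᵗ lit 1)) λ t →
      var rest ,ᵗ var a ,ᵗ var b ,ᵗ (var t ∷ᵗ snd (snd (snd (var s)))))))

  -- The right fold meets sum[0] first; the state consists of the index of the
  -- next sum, of the best index so far, and of its sum.
  argmax : Tm V (list nat) → Tm V nat
  argmax l = fst (snd (foldʳ l (lit 0 ,ᵗ lit 0 ,ᵗ lit 0) λ t s →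
    (fst (var s) +ᵗ lit 1) ,ᵗ
    if-le (var t) (snd (snd (var s))) (snd (var s)) (fst (var s) ,ᵗ var t)))

  -- The sequence S for a given i*.  The []ᵗ results are unreachable when k ≥ 2.
  build : V nat → V nat → V (list (list vert)) → V (list (list vert)) → Tm V (list vert)
  build i k Xs Ys =
    if-eq (var i) (lit 0)
      (caseᵗ (var Ys) []ᵗ λ Y₁ Ys′ →
       if-eq (lengthᵗ (var Y₁)) (lit 1)
         (caseᵗ (var Xs) []ᵗ λ X₁ _ →
          caseᵗ (var Ys′) []ᵗ λ Y₂ Ys″ →
          append (var X₁) (prepend (var Ys″) (append (var Y₁) (var Y₂))))
         (prepend (var Ys) []ᵗ))
    (if-eq (var i) (var k)
      (letᵗ (reverseᵗ (var Xs)) λ Xr →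
       caseᵗ (var Xr) []ᵗ λ Xₖ Xr′ →
       if-eq (lengthᵗ (var Xₖ)) (lit 1)
         (caseᵗ (var Xr′) []ᵗ λ Xₖ₋₁ Xr″ →
          caseᵗ (reverseᵗ (var Ys)) []ᵗ λ Yₖ _ →
          prepend (var Xr″) (append (var Yₖ) (append (var Xₖ) (var Xₖ₋₁))))
         (prepend (var Xr) []ᵗ))
      (letᵗ (split (var i ∸ᵗ lit 1) (var Xs)) λ s →
       caseᵗ (snd (var s)) []ᵗ λ Xᵢ r →
       caseᵗ (var r) []ᵗ λ Xᵢ₊₁ _ →
       caseᵗ (var Xᵢ₊₁) []ᵗ λ x _ →
       prepend (fst (var s)) (prepend (snd (split (var i) (var Ys))) (var x ∷ᵗ var Xᵢ))))

  -- Input: the two sides in chain order, each vertex with its adjacency list.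
  chainGraphAlgorithm : V (list (vert ⊗ list vert) ⊗ list (vert ⊗ list vert)) → Tm V (list vert)
  chainGraphAlgorithm inp =
    letᵗ (classes (fst (var inp))) λ Xs →
    letᵗ (classes (snd (var inp))) λ Ys →
    letᵗ (lengthᵗ (snd (var inp))) λ n₂ →
    letᵗ (lengthᵗ (var Xs)) λ k →
    letᵗ (argmax (sums n₂ Xs Ys)) λ i →
    build i k Xs Ys

-- Adjacency lists may list neighbours in any order.
record AdjacencyLists (B : BipartiteGraph) : Set where
  open BipartiteGraph B
  field
    adj     : Vertex → List Vertex
    enumAdj : ∀ v → adj v Enumerates N v

module Run (B : BipartiteGraph) (O : ChainOrdering B) (A : AdjacencyLists B) where
  open BipartiteGraph B
  open ChainOrdering O
  open AdjacencyLists A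
  open Semantics Vertex

  input : Val (list (vert ⊗ list vert) ⊗ list (vert ⊗ list vert))
  input = map (λ v → v , adj v) xs , map (λ v → v , adj v) ys

  result : List Vertex
  result = ⟦ Program.chainGraphAlgorithm input ⟧

  runningTime : ℕ
  runningTime = time (Program.chainGraphAlgorithm input)

{-# OPTIONS --safe #-}
module Submission where

-- Upper bound.  Let v be the first vertex of a dominating sequence that is
-- already dominated when it is played, say v ∈ X, and among the vertices of Y
-- played before v let y, in the class Y_b, have the largest neighbourhood; it
-- contains v.  The vertices played before v are independent, so each footprints
-- itself, and later footprints are adjacent neither to y nor to v.  Because
-- neighbourhoods are nested, all footprints other than that of v lie in
-- X_1 ∪ ⋯ ∪ X_{b-1} ∪ Y_b ∪ ⋯ ∪ Y_k.  Footprints are distinct, so the length is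
-- at most sum[b-1]; if b = 1, then all X is dominated by y, all footprints are
-- in Y and the length is at most n₂.  The case v ∈ Y is symmetric.
-- If there is no such v, the whole sequence is independent and the same cut works.
--
-- The returned sequences are independent sets with at most one further vertex
-- inserted, the only one not to footprint itself; (iv) is (v) with i* = k - 1.
--
-- Running time.  Every loop does work bounded by the size of the element it
-- visits, and the lists visited have total size O(|V| + |E|).  Only the loop
-- computing the sums needs a potential, the total size of the classes Y_i not
-- yet consumed.

-- The end values of `total` contribute nothing new beyond n₂ and n₁: if |Y_1| = 1 then `total 0`
-- equals `total 1`, and if |X_k| = 1 then `total k` equals `total (k ∸ 1)`. The upper bound
-- therefore rests on `n₂ ≤ total 0`, `n₁ ≤ total k` and the inner totals, each of which is one more
-- than the size of an independent cut. That unit is the place of the footprint of the first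
-- dominated vertex, the only one that may lie outside the cut. Dominating sequences are defined by
-- positions, whereas the bound splits a sequence at its first dominated vertex. Hence the passage
-- to `Legal`, whose index collects the vertices already played and grows along the induction. For
-- the running time the constant has to precede the graph: the input enters only through a size `s`,
-- constants are composed along the syntax of the program, and the larger pieces pack them in
-- existentials outside the quantifiers over inputs.

open import Defs
open import Data.Bool using (Bool; true; false; if_then_else_)
import Data.Bool.Properties as Bool
open import Data.Fin using (Fin; zero; suc; toℕ)
open import Data.Fin.Subset using (Subset; inside; outside; _∈_; _∉_; _⊆_; _─_; ⋃; ⁅_⁆; ∣_∣)
open import Data.Fin.Subset.Properties using (_∈?_; x∈p∪q⁻; x∈p∪q⁺; x∈p∩q⁺; ∉⊥; ∈⊤; ⊆⊤; ⊆-antisym; ⊆-refl; x∈⁅x⁆; x∈⁅y⁆⇒x≡y; p─q⊆p; x∈p∧x∉q⇒x∈p─q; p⊂q⇒∣p∣<∣q∣)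
open import Data.List using (List; []; _∷_; _++_; _ʳ++_; map; length; lookup; take; reverse; filter; concat; concatMap; foldr; foldl; upTo; applyUpTo; downFrom; allFin)
open import Data.List.Membership.Propositional using (find; lose) renaming (_∈_ to _∈ₗ_)
open import Data.List.Membership.Propositional.Properties
open import Data.List.Properties hiding (sum-++)
open import Data.List.Relation.Binary.Permutation.Propositional using (↭-sym; ↭⇒↭ₛ)
open import Data.List.Relation.Binary.Permutation.Propositional.Properties using (↭-reverse) renaming (map⁺ to ↭-map⁺)
import Data.List.Relation.Binary.Permutation.Setoid.Properties as ↭ₛ
open import Data.List.Relation.Unary.All as All using (All; []; _∷_)
import Data.List.Relation.Unary.All.Properties as All
open import Data.List.Relation.Unary.AllPairs as AllPairs using (AllPairs; []; _∷_)
open import Data.List.Relation.Unary.Any as Any using (here; there)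
import Data.List.Relation.Unary.Any.Properties as Any
open import Data.List.Relation.Unary.Unique.Propositional using (Unique)
import Data.List.Relation.Unary.Unique.Propositional.Properties as Unique
open import Data.Nat using (ℕ; zero; suc; _+_; _*_; _∸_; _≤_; _<_; z≤n; s≤s; s≤s⁻¹; _≤?_; _≟_; _≡ᵇ_; _≤ᵇ_)
open import Data.Nat.ListAction using (sum)
open import Data.Nat.ListAction.Properties using (sum-↭; sum-++)
open import Data.Nat.Properties hiding (_≟_; _≤?_)
open import Data.Nat.Tactic.RingSolver using (solve-∀)
open import Data.Product using (_×_; _,_; proj₁; proj₂; ∃-syntax)
open import Data.Sum using (_⊎_; inj₁; inj₂; [_,_]′)
open import Data.Unit using () renaming (⊤ to Unit)
open import Data.Vec using ([]; _∷_; here; there)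
import Data.Vec.Properties as Vec
open import Function using (_∘_; id; case_of_; mk⇔; Equivalence)
open import Relation.Binary.Definitions using (tri<; tri≈; tri>)
open import Relation.Binary.PropositionalEquality
open import Relation.Nullary using (¬_; Dec; does; yes; no; contradiction)
open import Relation.Nullary.Decidable using (_×-dec_; dec-true; dec-false)
open import Relation.Unary using (Decidable)

-- Lists, enumerations and ranges

-- Pigeonhole by deletion: one occurrence of `a` is cut out of `bs`, and uniqueness keeps the rest
-- of `as` inside what remains.
unique-⊆⇒length≤ : ∀ {A : Set} {as bs : List A} → Unique as →
                   (∀ {x} → x ∈ₗ as → x ∈ₗ bs) → length as ≤ length bs
unique-⊆⇒length≤ {as = []}     _        _   = z≤n
unique-⊆⇒length≤ {as = a ∷ as} (a≢ ∷ u) sub with ∈-∃++ (sub (here refl))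
... | ys , zs , refl = begin
    suc (length as)         ≤⟨ s≤s (unique-⊆⇒length≤ u avoid) ⟩
    suc (length (ys ++ zs)) ≡⟨ length-++-sucʳ ys a zs ⟨
    length (ys ++ a ∷ zs)   ∎
  where
  open ≤-Reasoning
  avoid : ∀ {x} → x ∈ₗ as → x ∈ₗ ys ++ zs
  avoid x∈ with ∈-++⁻ ys (sub (there x∈))
  ... | inj₁ x∈ys         = ∈-++⁺ˡ x∈ys
  ... | inj₂ (here x≡a)   = contradiction (sym x≡a) (All.lookup a≢ x∈)
  ... | inj₂ (there x∈zs) = ∈-++⁺ʳ ys x∈zs

elements : ∀ {n} → Subset n → List (Fin n)
elements []            = []
elements (outside ∷ A) = map suc (elements A)
elements (inside  ∷ A) = zero ∷ map suc (elements A)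

length-elements : ∀ {n} (A : Subset n) → length (elements A) ≡ ∣ A ∣
length-elements []            = refl
length-elements (outside ∷ A) = trans (length-map suc (elements A)) (length-elements A)
length-elements (inside  ∷ A) = cong suc (trans (length-map suc (elements A)) (length-elements A))

∈-elements⁺ : ∀ {n} {A : Subset n} {v} → v ∈ A → v ∈ₗ elements A
∈-elements⁺                    here       = here refl
∈-elements⁺ {A = outside ∷ A} (there v∈) = ∈-map⁺ suc (∈-elements⁺ v∈)
∈-elements⁺ {A = inside ∷ A}  (there v∈) = there (∈-map⁺ suc (∈-elements⁺ v∈))

∈-elements⁻ : ∀ {n} (A : Subset n) {v} → v ∈ₗ elements A → v ∈ A
∈-elements⁻ (outside ∷ A) v∈ with ∈-map⁻ suc v∈
... | _ , u∈ , refl = there (∈-elements⁻ A u∈)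
∈-elements⁻ (inside ∷ A) (here refl) = here
∈-elements⁻ (inside ∷ A) (there v∈) with ∈-map⁻ suc v∈
... | _ , u∈ , refl = there (∈-elements⁻ A u∈)

elements-unique : ∀ {n} (A : Subset n) → Unique (elements A)
elements-unique []            = []
elements-unique (outside ∷ A) = Unique.map⁺ (λ { refl → refl }) (elements-unique A)
elements-unique (inside  ∷ A) =
  All.map⁺ (All.universal (λ _ ()) _) ∷ Unique.map⁺ (λ { refl → refl }) (elements-unique A)

module _ {n} {A : Subset n} {l : List (Fin n)} (e : l Enumerates A) where

  enumerates⁺ : ∀ {v} → v ∈ A → v ∈ₗ l
  enumerates⁺ = Equivalence.from (proj₂ e _)

  enumerates⁻ : ∀ {v} → v ∈ₗ l → v ∈ A
  enumerates⁻ = Equivalence.to (proj₂ e _)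

  -- Pigeonhole in both directions against the reference list `elements A`, whose length follows
  -- `∣_∣` by recursion.
  enumerates-length : length l ≡ ∣ A ∣
  enumerates-length = trans
    (≤-antisym (unique-⊆⇒length≤ (proj₁ e) (∈-elements⁺ ∘ enumerates⁻))
               (unique-⊆⇒length≤ (elements-unique A) (enumerates⁺ ∘ ∈-elements⁻ A)))
    (length-elements A)

∈-⋃⁺ : ∀ {n} {A : Set} (f : A → Subset n) {u v} {l : List A} → u ∈ₗ l → v ∈ f u → v ∈ ⋃ (map f l)
∈-⋃⁺ f (here refl) v∈ = x∈p∪q⁺ (inj₁ v∈)
∈-⋃⁺ f (there u∈)  v∈ = x∈p∪q⁺ (inj₂ (∈-⋃⁺ f u∈ v∈))

∈-⋃⁻ : ∀ {n} {A : Set} (f : A → Subset n) {v} (l : List A) → v ∈ ⋃ (map f l) → ∃[ u ] (u ∈ₗ l × v ∈ f u)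
∈-⋃⁻ f []      v∈ = contradiction v∈ ∉⊥
∈-⋃⁻ f (u ∷ l) v∈ with x∈p∪q⁻ (f u) _ v∈
... | inj₁ v∈fu = u , here refl , v∈fu
... | inj₂ v∈⋃ with ∈-⋃⁻ f l v∈⋃
...   | w , w∈ , v∈fw = w , there w∈ , v∈fw

∈-concatMap⁺′ : ∀ {A B : Set} (f : A → List B) {i v} {l : List A} → i ∈ₗ l → v ∈ₗ f i → v ∈ₗ concatMap f l
∈-concatMap⁺′ f {l = l} i∈ v∈ = ∈-concatMap⁺ f (lose i∈ v∈)

∈-concatMap⁻′ : ∀ {A B : Set} (f : A → List B) {v} (l : List A) → v ∈ₗ concatMap f l →
                ∃[ i ] (i ∈ₗ l × v ∈ₗ f i)
∈-concatMap⁻′ f l v∈ = find (∈-concatMap⁻ f {xs = l} v∈)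

unique-concatMap : ∀ {A B : Set} (f : A → List B) (l : List A) → Unique l → (∀ i → Unique (f i)) →
  (∀ {i j v} → i ∈ₗ l → j ∈ₗ l → v ∈ₗ f i → v ∈ₗ f j → i ≡ j) → Unique (concatMap f l)
unique-concatMap f []      _          _  _    = []
unique-concatMap f (i ∷ l) (i≢ ∷ u) uf disj = Unique.++⁺ (uf i)
  (unique-concatMap f l u uf (λ i∈ j∈ → disj (there i∈) (there j∈)))
  λ (v∈fi , v∈) → let j , j∈ , v∈fj = ∈-concatMap⁻′ f l v∈ in
    All.lookup i≢ j∈ (disj (here refl) (there j∈) v∈fi v∈fj)

-- A structural form of `range`: it recurses on the number of entries, while `range` goes through
-- `upTo` and a truncated subtraction.
seg : ℕ → ℕ → List ℕ
seg a zero    = []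
seg a (suc m) = a ∷ seg (suc a) m

seg-++ : ∀ a m m′ → seg a (m + m′) ≡ seg a m ++ seg (a + m) m′
seg-++ a zero    m′ = cong (λ b → seg b m′) (sym (+-identityʳ a))
seg-++ a (suc m) m′ = cong (a ∷_)
  (trans (seg-++ (suc a) m m′) (cong (λ b → seg (suc a) m ++ seg b m′) (sym (+-suc a m))))

applyUpTo-seg : ∀ {f} a m → (∀ i → f i ≡ a + i) → applyUpTo f m ≡ seg a m
applyUpTo-seg a zero    eq = refl
applyUpTo-seg a (suc m) eq = cong₂ _∷_ (trans (eq 0) (+-identityʳ a))
  (applyUpTo-seg (suc a) m (λ i → trans (eq (suc i)) (+-suc a i)))

range≡seg : ∀ a b → range a b ≡ seg a (suc b ∸ a)
range≡seg a b = trans (map-upTo (a +_) (suc b ∸ a)) (applyUpTo-seg a _ (λ _ → refl))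

range-empty : ∀ {a b} → b < a → range a b ≡ []
range-empty {a} {b} b<a = cong (map (a +_) ∘ upTo) (m≤n⇒m∸n≡0 b<a)

range-∷ : ∀ {a b} → a ≤ b → range a b ≡ a ∷ range (suc a) b
range-∷ {a} {b} a≤b = begin
  range a b                  ≡⟨ range≡seg a b ⟩
  seg a (suc b ∸ a)          ≡⟨ cong (seg a) (+-∸-assoc 1 a≤b) ⟩
  a ∷ seg (suc a) (b ∸ a)    ≡⟨ cong (a ∷_) (range≡seg (suc a) b) ⟨
  a ∷ range (suc a) b        ∎
  where open ≡-Reasoning

-- The bound `a ≤ suc b` admits an empty left part such as `range 1 0`, which occurs for i* = 1.
range-++ : ∀ {a b c} → a ≤ suc b → b ≤ c → range a c ≡ range a b ++ range (suc b) c
range-++ {a} {b} {c} a≤ b≤c = begin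
  range a c                                           ≡⟨ range≡seg a c ⟩
  seg a (suc c ∸ a)                                   ≡⟨ cong (seg a) eq ⟩
  seg a ((suc b ∸ a) + (c ∸ b))                       ≡⟨ seg-++ a (suc b ∸ a) (c ∸ b) ⟩
  seg a (suc b ∸ a) ++ seg (a + (suc b ∸ a)) (c ∸ b)
    ≡⟨ cong₂ _++_ (sym (range≡seg a b)) (trans (cong (λ d → seg d (c ∸ b)) (m+[n∸m]≡n a≤)) (sym (range≡seg (suc b) c))) ⟩
  range a b ++ range (suc b) c                        ∎
  where
  open ≡-Reasoning
  eq : suc c ∸ a ≡ (suc b ∸ a) + (c ∸ b)
  eq = begin
    suc c ∸ a                  ≡⟨ cong (λ d → suc d ∸ a) (m+[n∸m]≡n b≤c) ⟨
    suc b + (c ∸ b) ∸ a        ≡⟨ +-∸-comm (c ∸ b) a≤ ⟩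
    (suc b ∸ a) + (c ∸ b)      ∎

range-single : ∀ a → range a a ≡ a ∷ []
range-single a = trans (range-∷ ≤-refl) (cong (a ∷_) (range-empty ≤-refl))

range-∷ʳ : ∀ {a b} → a ≤ suc b → range a (suc b) ≡ range a b ++ suc b ∷ []
range-∷ʳ {a} {b} a≤ = trans (range-++ a≤ (n≤1+n b)) (cong (range a b ++_) (range-single (suc b)))

∈-range⁺ : ∀ {a b i} → a ≤ i → i ≤ b → i ∈ₗ range a b
∈-range⁺ {a} {b} {i} a≤i i≤b = subst (_∈ₗ range a b) (m+[n∸m]≡n a≤i)
  (∈-map⁺ (a +_) (∈-upTo⁺ (≤-trans (s≤s (∸-monoˡ-≤ a i≤b)) (≤-reflexive (sym (+-∸-assoc 1 (≤-trans a≤i i≤b)))))))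

∈-range⁻ : ∀ {a b i} → i ∈ₗ range a b → a ≤ i × i ≤ b
∈-range⁻ {a} {b} i∈ with ∈-map⁻ (a +_) i∈
... | j , j∈ , refl = m≤m+n a j , s≤s⁻¹ (begin
    suc (a + j)       ≡⟨ +-suc a j ⟨
    a + suc j         ≤⟨ +-monoʳ-≤ a (∈-upTo⁻ j∈) ⟩
    -- Since `j` lies below `suc b ∸ a`, this difference is nonzero, so the truncated subtraction is
    -- exact.
    a + (suc b ∸ a)   ≡⟨ m+[n∸m]≡n (<⇒≤ (m∸n≢0⇒n<m {suc b} {a} (λ eq → case subst (j <_) eq (∈-upTo⁻ j∈) of λ ()))) ⟩
    suc b             ∎)
  where
  open ≤-Reasoning

range-unique : ∀ a b → Unique (range a b)
range-unique a b = Unique.map⁺ (+-cancelˡ-≡ a _ _) (Unique.upTo⁺ _)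

-- Level blocks of a sorted list

module _ {A : Set} {D : ℕ → A → Set} (D? : ∀ i → Decidable (D i)) where

  private
    blocks : List A → List ℕ → List A
    blocks l = concatMap (λ i → filter (D? i) l)

  blocks-reject : ∀ {v l} is → (∀ {i} → i ∈ₗ is → ¬ D i v) → blocks (v ∷ l) is ≡ blocks l is
  blocks-reject []       _   = refl
  blocks-reject (i ∷ is) out = cong₂ _++_ (filter-reject (D? i) (out (here refl)))
                                          (blocks-reject is (out ∘ there))

  -- `v` enters block `a` only, at its front. It comes first in the whole concatenation because
  -- `low` empties all earlier blocks.
  blocks-∷ : ∀ {v l a} is → AllPairs _<_ is → a ∈ₗ is → D a v →
    (∀ {i} → i ∈ₗ is → D i v → i ≡ a) → (∀ {i u} → i ∈ₗ is → u ∈ₗ l → D i u → a ≤ i) →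
    blocks (v ∷ l) is ≡ v ∷ blocks l is
  blocks-∷ {v} {l} (i ∷ is) (i< ∷ _) (here refl) Dv uniq low = trans
    (cong (_++ blocks (v ∷ l) is) (filter-accept (D? i) Dv))
    (cong (λ r → v ∷ filter (D? i) l ++ r)
      (blocks-reject is (λ j∈ Dj → <-irrefl (sym (uniq (there j∈) Dj)) (All.lookup i< j∈))))
  blocks-∷ {v} {l} (i ∷ is) (i< ∷ inc) (there a∈) Dv uniq low = trans
    (cong₂ _++_ (trans (filter-reject (D? i) λ Di → <-irrefl (uniq (here refl) Di) i<a) none)
                (blocks-∷ is inc a∈ Dv (uniq ∘ there) (low ∘ there)))
    (sym (cong (λ r → v ∷ r ++ blocks l is) none))
    where
    i<a = All.lookup i< a∈
    none : filter (D? i) l ≡ []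
    none = filter-none (D? i) (All.tabulate λ u∈ Du → <⇒≱ i<a (low (here refl) u∈ Du))

  -- Collecting the entries level by level is a stable sort by level, so a list already sorted by
  -- level comes back unchanged. This identifies the concatenated classes of a side with the chain
  -- ordering.
  sorted⇒concat-blocks : ∀ is → AllPairs _<_ is → (l : List A) →
    All (λ v → ∃[ i ] (i ∈ₗ is × D i v)) l →
    (∀ {v i j} → i ∈ₗ is → j ∈ₗ is → D i v → D j v → i ≡ j) →
    AllPairs (λ u v → ∀ i j → i ∈ₗ is → j ∈ₗ is → D i u → D j v → i ≤ j) l →
    concatMap (λ i → filter (D? i) l) is ≡ l
  sorted⇒concat-blocks is inc []      _                     uniq _              = concat-[] is
    where
    concat-[] : ∀ is → blocks [] is ≡ []
    concat-[] []       = refl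
    concat-[] (_ ∷ is) = concat-[] is
  sorted⇒concat-blocks is inc (v ∷ l) ((a , a∈ , Da) ∷ ex) uniq (v≤ ∷ sorted) = trans
    (blocks-∷ is inc a∈ Da (λ i∈ Di → uniq i∈ a∈ Di Da) (λ i∈ u∈ Du → All.lookup v≤ u∈ _ _ a∈ i∈ Da Du))
    (cong (v ∷_) (sorted⇒concat-blocks is inc l ex uniq sorted))

seg-≥ : ∀ a m → All (a ≤_) (seg a m)
seg-≥ a zero    = []
seg-≥ a (suc m) = ≤-refl ∷ All.map <⇒≤ (seg-≥ (suc a) m)

seg-increasing : ∀ a m → AllPairs _<_ (seg a m)
seg-increasing a zero    = []
seg-increasing a (suc m) = seg-≥ (suc a) m ∷ seg-increasing (suc a) m

range-increasing : ∀ a b → AllPairs _<_ (range a b)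
range-increasing a b = subst (AllPairs _<_) (sym (range≡seg a b)) (seg-increasing a _)

-- Legal sequences and the upper bound

x∈p─q⇒x∉q : ∀ {n} {p q : Subset n} {x} → x ∈ p ─ q → x ∉ q
x∈p─q⇒x∉q {p = _ ∷ _} {inside ∷ _} () here
x∈p─q⇒x∉q {p = _ ∷ p} {_ ∷ q} (there x∈) (there x∈q) = x∈p─q⇒x∉q {p = p} {q} x∈ x∈q

module LegalSequences (G : Graph) where
  open Graph G renaming (sym to N-sym)

  v∈N[v] : ∀ {v} → v ∈ N[ v ]
  v∈N[v] {v} = x∈p∪q⁺ (inj₂ (x∈⁅x⁆ v))

  N⊆N[] : ∀ {u v} → u ∈ N v → u ∈ N[ v ]
  N⊆N[] u∈ = x∈p∪q⁺ (inj₁ u∈)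

  ∈N[]⁻ : ∀ {u v} → u ∈ N[ v ] → u ∈ N v ⊎ u ≡ v
  ∈N[]⁻ {u} {v} u∈ with x∈p∪q⁻ (N v) ⁅ v ⁆ u∈
  ... | inj₁ u∈N = inj₁ u∈N
  ... | inj₂ u∈v = inj₂ (x∈⁅y⁆⇒x≡y v u∈v)

  N[]-sym : ∀ {u v} → u ∈ N[ v ] → v ∈ N[ u ]
  N[]-sym u∈ with ∈N[]⁻ u∈
  ... | inj₁ u∈N  = N⊆N[] (N-sym u∈N)
  ... | inj₂ refl = v∈N[v]

  Undominated : List Vertex → Vertex → Set
  Undominated P f = ∀ {u} → u ∈ₗ P → f ∉ N[ u ]

  undominated-∷ : ∀ {P u f} → f ∉ N[ u ] → Undominated P f → Undominated (u ∷ P) f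
  undominated-∷ f∉ _   (here refl) = f∉
  undominated-∷ _  und (there u∈)  = und u∈

  -- `P` holds the vertices already played, the latest in front. The first vertex of a sequence is
  -- not exempted here, at no loss: over an empty `P` it footprints itself.
  data Legal (P : List Vertex) : List Vertex → Set where
    []  : Legal P []
    _∷_ : ∀ {v S} → ∃[ f ] (f ∈ N[ v ] × Undominated P f) → Legal (v ∷ P) S → Legal P (v ∷ S)

  -- Positional form of a legal move, relative to earlier vertices `P`. It mediates between `lookup`
  -- and `take` in the definition of a dominating sequence and the induction on `Legal`.
  HasFootprint : List Vertex → (S : List Vertex) → Fin (length S) → Set
  HasFootprint P S i = ∃[ f ] (f ∈ N[ lookup S i ] × Undominated P f × Undominated (take (toℕ i) S) f)

  legal⇒footprints : ∀ {P S} → Legal P S → ∀ i → HasFootprint P S i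
  legal⇒footprints ((f , f∈ , und) ∷ _) zero = f , f∈ , und , λ ()
  legal⇒footprints (_ ∷ legal) (suc i) with legal⇒footprints legal i
  ... | f , f∈ , und , und′ = f , f∈ , und ∘ there , undominated-∷ (und (here refl)) und′

  footprints⇒legal : ∀ P S → (∀ i → HasFootprint P S i) → Legal P S
  footprints⇒legal P []      _    = []
  footprints⇒legal P (v ∷ S) foot with foot zero
  ... | f , f∈ , und , _ = (f , f∈ , und) ∷ footprints⇒legal (v ∷ P) S λ i →
    let g , g∈ , und , und′ = foot (suc i) in
    g , g∈ , undominated-∷ (und′ (here refl)) und , und′ ∘ there

  dominating⇒legal : ∀ {S} → IsDominatingSequence S → Legal [] S
  dominating⇒legal {S} d = footprints⇒legal [] S foot
    where
    foot : ∀ i → HasFootprint [] S i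
    foot i with toℕ i in eq
    ... | zero  = lookup S i , v∈N[v] , (λ ()) , λ ()
    ... | suc m with IsDominatingSequence.footprints d i (subst (0 <_) (sym eq) (s≤s z≤n))
    ... | f , f∈ rewrite eq = f , p─q⊆p N[ lookup S i ] _ f∈ , (λ ()) ,
      λ u∈ f∈N → x∈p─q⇒x∉q {p = N[ lookup S i ]} f∈ (∈-⋃⁺ N[_] u∈ f∈N)

  legal⇒dominating : ∀ {S} → Legal [] S → (∀ v → ∃[ s ] (s ∈ₗ S × v ∈ N[ s ])) → IsDominatingSequence S
  legal⇒dominating {S} legal dom = record
    { footprints = λ i _ → let f , f∈ , _ , und = legal⇒footprints legal i in
        f , x∈p∧x∉q⇒x∈p─q f∈ λ f∈⋃ → let u , u∈ , f∈N = ∈-⋃⁻ N[_] (take (toℕ i) S) f∈⋃ in und u∈ f∈N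
    ; dominates = ⊆-antisym ⊆⊤ λ {v} _ → let s , s∈ , v∈ = dom v in ∈-⋃⁺ N[_] s∈ v∈
    }

  -- One footprint per move. Later footprints avoid `N[ v ]` and `f` lies in it, so they are
  -- distinct.
  footprintList : ∀ {P S} → Legal P S →
    ∃[ F ] (length F ≡ length S × Unique F × (∀ {f} → f ∈ₗ F → Undominated P f))
  footprintList [] = [] , refl , [] , λ ()
  footprintList {P} (_∷_ {v = v} (f , f∈ , und) legal) with footprintList legal
  ... | F , len , uniq , undF = f ∷ F , cong suc len ,
    All.tabulate (λ g∈ f≡g → undF g∈ (here refl) (subst (_∈ N[ v ]) f≡g f∈)) ∷ uniq ,
    λ { (here refl) → und ; (there g∈) → undF g∈ ∘ there }

  Independent : List Vertex → Set
  Independent L = Unique L × (∀ {u v} → u ∈ₗ L → v ∈ₗ L → v ∉ N u)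

  independent-∷ : ∀ {P v} → Independent P → Undominated P v → Independent (v ∷ P)
  independent-∷ {P} {v} (uniq , ind) und =
      All.tabulate (λ u∈ v≡u → und u∈ (subst (_∈ N[ _ ]) (sym v≡u) v∈N[v])) ∷ uniq
    , λ { (here refl) (here refl) → irrefl
        ; (here refl) (there w∈)  → λ w∈N → und w∈ (N⊆N[] (N-sym w∈N))
        ; (there u∈)  (here refl) → und u∈ ∘ N⊆N[]
        ; (there u∈)  (there w∈)  → ind u∈ w∈ }

  independent⇒legal : ∀ {P S} → Independent S → (∀ {s} → s ∈ₗ S → Undominated P s) → Legal P S
  independent⇒legal {S = []}    _                    _   = []
  independent⇒legal {S = v ∷ S} (v≢ ∷ uniq , ind) und =
    (v , v∈N[v] , und (here refl)) ∷
    independent⇒legal (uniq , λ u∈ w∈ → ind (there u∈) (there w∈))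
      λ s∈ → undominated-∷
        (λ s∈N → [ ind (here refl) (there s∈) , (λ s≡v → All.lookup v≢ s∈ (sym s≡v)) ]′ (∈N[]⁻ s∈N))
        (und (there s∈))

  -- The inserted `v` footprints `w`. Every other vertex still footprints itself: independence takes
  -- care of the rest of `A ++ B`, and the last hypothesis keeps `B` out of `N[ v ]`.
  insert-legal : ∀ {P A v w B} → Independent (A ++ B) → (∀ {s} → s ∈ₗ A ++ B → Undominated P s) →
    w ∈ N[ v ] → Undominated P w → Undominated A w → (∀ {b} → b ∈ₗ B → b ∉ N[ v ]) →
    Legal P (A ++ v ∷ B)
  insert-legal {A = []} {w = w} ind und w∈ undP _ B∉ =
    (w , w∈ , undP) ∷ independent⇒legal ind (λ b∈ → undominated-∷ (B∉ b∈) (und b∈))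
  insert-legal {A = a ∷ A} (a≢ ∷ uniq , ind) und w∈ undP undA B∉ =
    (a , v∈N[v] , und (here refl)) ∷
    insert-legal (uniq , λ u∈ s∈ → ind (there u∈) (there s∈))
      (λ s∈ → undominated-∷
        (λ s∈N → [ ind (here refl) (there s∈) , (λ s≡a → All.lookup a≢ s∈ (sym s≡a)) ]′ (∈N[]⁻ s∈N))
        (und (there s∈)))
      w∈ (undominated-∷ (undA (here refl)) undP) (undA ∘ there) B∉

  -- Instantiated with (A , B) = (X , Y) and with (Y , X).
  record Side (A B : Subset n) (M : ℕ) : Set where
    field
      excl  : ∀ {v} → v ∈ A → v ∉ B
      cov   : ∀ v → v ∈ A ⊎ v ∈ B
      nbr   : ∀ {u v} → u ∈ B → v ∈ N u → v ∈ A
      nbr′  : ∀ {u v} → u ∈ A → v ∈ N u → v ∈ B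
      chain : ∀ {u v} → u ∈ B → v ∈ B → N u ⊆ N v ⊎ N v ⊆ N u

    -- For y ∈ Y_b, the set X_1 ∪ ⋯ ∪ X_{b-1} ∪ Y_b ∪ ⋯ ∪ Y_k.
    Below : Vertex → Vertex → Set
    Below y v = (v ∈ A × v ∉ N y) ⊎ (v ∈ B × N v ⊆ N y)

    field
      side  : ∀ {L} → Unique L → (∀ {v} → v ∈ₗ L → v ∈ B) → length L ≤ M
      -- Strictness leaves room for one footprint that need not be `Below y`. The alternative is the
      -- extreme class, whose vertices dominate all of `A`.
      cut   : ∀ {y} → y ∈ B → (∀ {L} → Unique L → (∀ {v} → v ∈ₗ L → Below y v) → length L < M)
                              ⊎ (∀ {x} → x ∈ A → x ∈ N y)

    Top : List Vertex → Vertex → Set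
    Top P y = y ∈ₗ P × y ∈ B × (∀ {u} → u ∈ₗ P → u ∈ B → N u ⊆ N y)

    top : ∀ P → (∀ {u} → u ∈ₗ P → u ∈ A) ⊎ ∃[ y ] Top P y
    top []      = inj₁ λ ()
    top (v ∷ P) with cov v | top P
    ... | inj₁ v∈A | inj₁ P⊆A = inj₁ λ { (here refl) → v∈A ; (there u∈) → P⊆A u∈ }
    ... | inj₁ v∈A | inj₂ (y , y∈ , y∈B , ≤y) = inj₂ (y , there y∈ , y∈B ,
      λ { (here refl) v∈B → contradiction v∈B (excl v∈A) ; (there u∈) → ≤y u∈ })
    ... | inj₂ v∈B | inj₁ P⊆A = inj₂ (v , here refl , v∈B ,
      λ { (here refl) _ → ⊆-refl ; (there u∈) u∈B → contradiction u∈B (excl (P⊆A u∈)) })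
    ... | inj₂ v∈B | inj₂ (y , y∈ , y∈B , ≤y) with chain v∈B y∈B
    ...   | inj₁ v≤y = inj₂ (y , there y∈ , y∈B , λ { (here refl) _ → v≤y ; (there u∈) → ≤y u∈ })
    ...   | inj₂ y≤v = inj₂ (v , here refl , v∈B ,
      λ { (here refl) _ → ⊆-refl ; (there u∈) u∈B x∈ → y≤v (≤y u∈ u∈B x∈) })

    below-top : ∀ {P y} → Independent P → Top P y → ∀ {u} → u ∈ₗ P → Below y u
    below-top (_ , ind) (y∈ , _ , ≤y) {u} u∈ with cov u
    ... | inj₁ u∈A = inj₁ (u∈A , ind y∈ u∈)
    ... | inj₂ u∈B = inj₂ (u∈B , ≤y u∈ u∈B)

    below⇒B : ∀ {y v} → (∀ {x} → x ∈ A → x ∈ N y) → Below y v → v ∈ B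
    below⇒B all (inj₁ (v∈A , v∉)) = contradiction (all v∈A) v∉
    below⇒B all (inj₂ (v∈B , _))  = v∈B

    independent-bound : ∀ {P y} → Independent P → Top P y → length P ≤ M
    independent-bound {P} {y} ind t@(_ , y∈B , _) with cut y∈B
    ... | inj₁ small = <⇒≤ (small (proj₁ ind) (below-top ind t))
    ... | inj₂ all   = side (proj₁ ind) λ u∈ → below⇒B all (below-top ind t u∈)

    -- The moves are counted by `P` itself, by `f` for `v`, and by `F` for `S`. All but `f` are
    -- below the top vertex `y`; `f` uses the slack in `cut`, or lies in `B` with all the others
    -- when `y` dominates `A`.
    dominated-bound : ∀ {P S u v} → Independent P → u ∈ₗ P → u ∈ B → v ∈ N u → Legal P (v ∷ S) →
                      length P + suc (length S) ≤ M
    dominated-bound {P} {S} {u} {v} ind u∈ u∈B v∈Nu ((f , f∈ , und) ∷ legal) with top P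
    ... | inj₁ P⊆A = contradiction u∈B (excl (P⊆A u∈))
    ... | inj₂ (y , t@(y∈ , y∈B , ≤y)) with footprintList legal
    ... | F , len , uniq , undF = bound (cut y∈B)
      where
      v∈Ny : v ∈ N y
      v∈Ny = ≤y u∈ u∈B v∈Nu

      -- `y` dominates `v`, so `v` cannot footprint itself and `f` is a neighbour of `v`.
      f∈B : f ∈ B
      f∈B with ∈N[]⁻ f∈
      ... | inj₁ f∈N  = nbr′ (nbr u∈B v∈Nu) f∈N
      ... | inj₂ refl = contradiction (N⊆N[] v∈Ny) (und y∈)

      belowF : ∀ {g} → g ∈ₗ F → Below y g
      belowF {g} g∈ with cov g
      ... | inj₁ g∈A = inj₁ (g∈A , λ g∈N → undF g∈ (there y∈) (N⊆N[] g∈N))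
      ... | inj₂ g∈B with chain g∈B y∈B
      ...   | inj₁ g≤y = inj₂ (g∈B , g≤y)
      -- A neighbourhood containing that of `y` contains `v`, so `g` would be dominated by `v`.
      ...   | inj₂ y≤g = contradiction (N⊆N[] (N-sym (y≤g v∈Ny))) (undF g∈ (here refl))

      below : ∀ {g} → g ∈ₗ P ++ F → Below y g
      below g∈ = [ below-top ind t , belowF ]′ (∈-++⁻ P g∈)

      unique : Unique (P ++ F)
      unique = Unique.++⁺ (proj₁ ind) uniq λ (g∈P , g∈F) → undF g∈F (there g∈P) v∈N[v]

      f≢ : All (f ≢_) (P ++ F)
      f≢ = All.tabulate λ g∈ f≡g → [ (λ g∈P → und g∈P (subst (_∈ N[ _ ]) (sym f≡g) v∈N[v]))
                                    , (λ g∈F → undF g∈F (here refl) (subst (_∈ N[ v ]) f≡g f∈)) ]′ (∈-++⁻ P g∈)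

      eq : length P + suc (length S) ≡ suc (length (P ++ F))
      eq = trans (+-suc (length P) (length S))
                 (cong suc (sym (trans (length-++ P) (cong (length P +_) len))))

      bound : _ → length P + suc (length S) ≤ M
      bound (inj₁ small) = subst (_≤ M) (sym eq) (small unique below)
      bound (inj₂ all)   = subst (_≤ M) (sym eq) (side (f≢ ∷ unique)
          λ { (here refl) → f∈B ; (there g∈) → below⇒B all (below g∈) })

  module _ {X Y M} (sX : Side X Y M) (sY : Side Y X M) where
    private
      module SX = Side sX
      module SY = Side sY

    -- An undominated vertex moves into `P`, which stays independent. The first dominated vertex
    -- ends the induction, and the side of its dominator decides which instance of `Side` applies.
    legal-bound : ∀ P S → Independent P → Legal P S → length P + length S ≤ M
    legal-bound P [] ind [] = subst (_≤ M) (sym (+-identityʳ (length P))) bound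
      where
      bound : length P ≤ M
      bound with SX.top P
      ... | inj₁ P⊆X = SY.side (proj₁ ind) P⊆X
      ... | inj₂ (_ , t) = SX.independent-bound ind t
    legal-bound P (v ∷ S) ind legal@(step ∷ rest) with Any.any? (λ u → v ∈? N[ u ]) P
    ... | no undominated = subst (_≤ M) (sym (+-suc (length P) (length S)))
            (legal-bound (v ∷ P) S (independent-∷ ind λ u∈ v∈ → undominated (lose u∈ v∈)) rest)
    ... | yes dominated with find dominated
    ...   | u , u∈ , v∈ with ∈N[]⁻ v∈
    -- A repeated vertex has nothing left to footprint.
    ...     | inj₂ refl = let f , f∈ , und = step in contradiction f∈ (und u∈)
    ...     | inj₁ v∈N with SX.cov u
    ...       | inj₁ u∈X = SY.dominated-bound ind u∈ u∈X v∈N legal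
    ...       | inj₂ u∈Y = SX.dominated-bound ind u∈ u∈Y v∈N legal

-- Levels in a chain graph

length-concatMap : ∀ {A B : Set} (f : A → List B) l → length (concatMap f l) ≡ sum (map (length ∘ f) l)
length-concatMap f []      = refl
length-concatMap f (a ∷ l) = trans (length-++ (f a)) (cong (length (f a) +_) (length-concatMap f l))

concatMap-cong-∈ : ∀ {A B : Set} (f g : A → List B) l → (∀ i → i ∈ₗ l → f i ≡ g i) →
                   concatMap f l ≡ concatMap g l
concatMap-cong-∈ f g l eq = cong concat (map-cong-local (All.tabulate (eq _)))

does-true : ∀ {P : Set} (p? : Dec P) → does p? ≡ true → P
does-true (yes p) _ = p

if-true : ∀ {A : Set} {b : Bool} {x y : A} → b ≡ true → (if b then x else y) ≡ x
if-true refl = refl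

if-false : ∀ {A : Set} {b : Bool} {x y : A} → b ≡ false → (if b then x else y) ≡ y
if-false refl = refl

module ChainGraph (B : BipartiteGraph) (O : ChainOrdering B) (T : TwinClasses B)
                  (noIsolated : BipartiteGraph.NoIsolated B) (2≤k : 2 ≤ TwinClasses.k T) where

  open BipartiteGraph B renaming (sym to N-sym)
  open ChainOrdering O
  open TwinClasses T
  open Algorithm B O T
  open LegalSequences graph

  1≤k : 1 ≤ k
  1≤k = <⇒≤ 2≤k

  X⊎Y : ∀ v → v ∈ X ⊎ v ∈ Y
  X⊎Y v = x∈p∪q⁻ X Y (subst (v ∈_) (sym cover) ∈⊤)

  X∩Y : ∀ {v} → v ∈ X → v ∉ Y
  X∩Y x∈ y∈ = ∉⊥ (subst (_ ∈_) disjoint (x∈p∩q⁺ (x∈ , y∈)))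

  N-X : ∀ {u v} → u ∈ X → v ∈ N u → v ∈ Y
  N-X u∈ v∈ with bipartite v∈
  ... | inj₁ (_ , v∈Y) = v∈Y
  ... | inj₂ (u∈Y , _) = contradiction u∈Y (X∩Y u∈)

  N-Y : ∀ {u v} → u ∈ Y → v ∈ N u → v ∈ X
  N-Y u∈ v∈ with bipartite v∈
  ... | inj₁ (u∈X , _) = contradiction u∈ (X∩Y u∈X)
  ... | inj₂ (_ , v∈X) = v∈X

  Xᶜ⁺ : ∀ {i v} → v ∈ X → N v ≡ NX i → v ∈ Xᶜ i
  Xᶜ⁺ {i} {v} v∈ eq = Vec.lookup⇒[]= v (Xᶜ i) (trans (Vec.lookup∘tabulate _ v)
    (dec-true ((v ∈? X) ×-dec Vec.≡-dec Bool._≟_ (N v) (NX i)) (v∈ , eq)))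

  Xᶜ⁻ : ∀ {i v} → v ∈ Xᶜ i → v ∈ X × N v ≡ NX i
  Xᶜ⁻ {i} {v} v∈ = does-true ((v ∈? X) ×-dec Vec.≡-dec Bool._≟_ (N v) (NX i))
    (trans (sym (Vec.lookup∘tabulate _ v)) (Vec.[]=⇒lookup v∈))

  Yᶜ⁺ : ∀ {i v} → v ∈ NX i → (∀ {j} → 1 ≤ j → j < i → v ∉ NX j) → v ∈ Yᶜ i
  Yᶜ⁺ {i} v∈ new = x∈p∧x∉q⇒x∈p─q v∈ λ v∈⋃ →
    let j , j∈ , v∈NXj = ∈-⋃⁻ NX (range 1 (i ∸ 1)) v∈⋃
        1≤j , j≤i-1    = ∈-range⁻ j∈
    in new 1≤j (≤∸1⇒< 1≤j j≤i-1) v∈NXj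
    where
    ≤∸1⇒< : ∀ {i j} → 1 ≤ j → j ≤ i ∸ 1 → j < i
    ≤∸1⇒< {zero}  (s≤s _) ()
    ≤∸1⇒< {suc i} _ j≤i = s≤s j≤i

  Yᶜ⁻ : ∀ {i v} → v ∈ Yᶜ i → v ∈ NX i × (∀ {j} → 1 ≤ j → j < i → v ∉ NX j)
  Yᶜ⁻ {i} v∈ = p─q⊆p (NX i) _ v∈ , λ 1≤j j<i v∈NXj →
    x∈p─q⇒x∉q {p = NX i} v∈ (∈-⋃⁺ NX (∈-range⁺ 1≤j (∸-monoˡ-≤ 1 j<i)) v∈NXj)

  -- The range is part of a level because `rep`, and with it `Xᶜ` and `Yᶜ`, is unconstrained outside
  -- 1, ..., k.
  XLevel YLevel : ℕ → Vertex → Set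
  XLevel i v = (1 ≤ i × i ≤ k) × v ∈ Xᶜ i
  YLevel i v = (1 ≤ i × i ≤ k) × v ∈ Yᶜ i

  XLevel⇒X : ∀ {i v} → XLevel i v → v ∈ X
  XLevel⇒X (_ , v∈) = proj₁ (Xᶜ⁻ v∈)

  YLevel⇒Y : ∀ {i v} → YLevel i v → v ∈ Y
  YLevel⇒Y ((1≤i , i≤k) , v∈) = N-X (rep∈X _ 1≤i i≤k) (proj₁ (Yᶜ⁻ v∈))

  rep-level : ∀ {i} → 1 ≤ i → i ≤ k → XLevel i (rep i)
  rep-level 1≤i i≤k = (1≤i , i≤k) , Xᶜ⁺ (rep∈X _ 1≤i i≤k) refl

  NX-mono : ∀ {i j} → 1 ≤ i → i ≤ j → j ≤ k → NX i ⊆ NX j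
  NX-mono {i} {j} 1≤i i≤j j≤k with m≤n⇒m<n∨m≡n i≤j
  ... | inj₁ i<j  = proj₁ (strict i j 1≤i i<j j≤k)
  ... | inj₂ refl = ⊆-refl

  NX⊆⇒≤ : ∀ {i j} → 1 ≤ j → i ≤ k → NX i ⊆ NX j → i ≤ j
  NX⊆⇒≤ {i} {j} 1≤j i≤k sub with i ≤? j
  ... | yes i≤j = i≤j
  ... | no i≰j  = let _ , y , y∈ , y∉ = strict j i 1≤j (≰⇒> i≰j) i≤k in contradiction (sub y∈) y∉

  xlevel : ∀ {v} → v ∈ X → ∃[ i ] XLevel i v
  xlevel v∈ = let i , 1≤i , i≤k , eq = complete _ v∈ in i , (1≤i , i≤k) , Xᶜ⁺ v∈ eq

  -- Descend while `y` remains in the previous neighbourhood. At the first failure monotonicity of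
  -- `NX` excludes all smaller indices at once.
  least-level : ∀ {y} j → suc j ≤ k → y ∈ NX (suc j) → ∃[ i ] YLevel i y
  least-level zero j≤k y∈ = 1 , (≤-refl , j≤k) , Yᶜ⁺ y∈ λ 1≤i i<1 → contradiction i<1 (≤⇒≯ 1≤i)
  least-level {y} (suc j) j<k y∈ with y ∈? NX (suc j)
  ... | yes y∈′ = least-level j (<⇒≤ j<k) y∈′
  ... | no y∉   = suc (suc j) , (s≤s z≤n , j<k) , Yᶜ⁺ y∈ λ 1≤i i<j y∈NXi →
    y∉ (NX-mono 1≤i (s≤s⁻¹ i<j) (<⇒≤ j<k) y∈NXi)

  -- A neighbour of `v` exists as no vertex is isolated, and its class gives a start for the
  -- descent.
  ylevel : ∀ {v} → v ∈ Y → ∃[ i ] YLevel i v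
  ylevel {v} v∈ = let x , x∈ = noIsolated v
                      j , 1≤j , j≤k , eq = complete x (N-Y v∈ x∈)
                      v∈NX = subst (v ∈_) eq (N-sym x∈)
                      j≡   = sym (m+[n∸m]≡n 1≤j)
                  in least-level (j ∸ 1) (subst (_≤ k) j≡ j≤k) (subst (λ i → v ∈ NX i) j≡ v∈NX)

  -- Y_i enters the increasing chain of neighbourhoods exactly at index i. Together with `adjacent⁻`
  -- this reduces adjacency between the sides to a comparison of levels.
  adjacent⁺ : ∀ {i j x y} → XLevel j x → YLevel i y → i ≤ j → y ∈ N x
  adjacent⁺ ((_ , j≤k) , x∈) ((1≤i , _) , y∈) i≤j =
    subst (_ ∈_) (sym (proj₂ (Xᶜ⁻ x∈))) (NX-mono 1≤i i≤j j≤k (proj₁ (Yᶜ⁻ y∈)))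

  adjacent⁻ : ∀ {i j x y} → XLevel j x → YLevel i y → y ∈ N x → i ≤ j
  adjacent⁻ {i} {j} ((1≤j , _) , x∈) (_ , y∈) y∈N with i ≤? j
  ... | yes i≤j = i≤j
  ... | no i≰j  = contradiction (subst (_ ∈_) (proj₂ (Xᶜ⁻ x∈)) y∈N) (proj₂ (Yᶜ⁻ y∈) 1≤j (≰⇒> i≰j))

  XLevel-≤ : ∀ {i j u v} → XLevel i u → XLevel j v → N u ⊆ N v → i ≤ j
  XLevel-≤ ((_ , i≤k) , u∈) ((1≤j , _) , v∈) sub =
    NX⊆⇒≤ 1≤j i≤k (subst₂ _⊆_ (proj₂ (Xᶜ⁻ u∈)) (proj₂ (Xᶜ⁻ v∈)) sub)

  -- The witness is `rep j`: it is adjacent to `v`, hence to `u`.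
  YLevel-≤ : ∀ {i j u v} → YLevel i u → YLevel j v → N v ⊆ N u → i ≤ j
  YLevel-≤ Lu Lv@((1≤j , j≤k) , _) sub =
    adjacent⁻ R Lu (N-sym (sub (N-sym (adjacent⁺ R Lv ≤-refl))))
    where R = rep-level 1≤j j≤k

  XLevel-unique : ∀ {i j v} → XLevel i v → XLevel j v → i ≡ j
  XLevel-unique L L′ = ≤-antisym (XLevel-≤ L L′ ⊆-refl) (XLevel-≤ L′ L ⊆-refl)

  YLevel-unique : ∀ {i j v} → YLevel i v → YLevel j v → i ≡ j
  YLevel-unique L L′ = ≤-antisym (YLevel-≤ L L′ ⊆-refl) (YLevel-≤ L′ L ⊆-refl)

  N-mono-X : ∀ {i j u v} → XLevel i u → XLevel j v → i ≤ j → N u ⊆ N v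
  N-mono-X ((1≤i , _) , u∈) ((_ , j≤k) , v∈) i≤j =
    subst₂ _⊆_ (sym (proj₂ (Xᶜ⁻ u∈))) (sym (proj₂ (Xᶜ⁻ v∈))) (NX-mono 1≤i i≤j j≤k)

  N-anti-Y : ∀ {i j u v} → YLevel i u → YLevel j v → i ≤ j → N v ⊆ N u
  N-anti-Y Lu Lv i≤j x∈ = let _ , L = xlevel (N-Y (YLevel⇒Y Lv) x∈) in
    N-sym (adjacent⁺ L Lu (≤-trans i≤j (adjacent⁻ L Lv (N-sym x∈))))

  chain-X : ∀ {u v} → u ∈ X → v ∈ X → N u ⊆ N v ⊎ N v ⊆ N u
  chain-X u∈ v∈ with xlevel u∈ | xlevel v∈
  ... | i , L | j , L′ = [ inj₁ ∘ N-mono-X L L′ , inj₂ ∘ N-mono-X L′ L ]′ (≤-total i j)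

  chain-Y : ∀ {u v} → u ∈ Y → v ∈ Y → N u ⊆ N v ⊎ N v ⊆ N u
  chain-Y u∈ v∈ with ylevel u∈ | ylevel v∈
  ... | i , L | j , L′ = [ inj₂ ∘ N-anti-Y L L′ , inj₁ ∘ N-anti-Y L′ L ]′ (≤-total i j)

  -- For i = 1 any neighbour of `rep 1` serves; for larger i the strictness of the inclusion
  -- supplies a new vertex.
  Yᶜ-nonempty : ∀ {i} → 1 ≤ i → i ≤ k → ∃[ y ] YLevel i y
  Yᶜ-nonempty {suc zero} 1≤i i≤k = let y , y∈ = noIsolated (rep 1) in
    y , (1≤i , i≤k) , Yᶜ⁺ y∈ λ 1≤j j<1 → contradiction j<1 (≤⇒≯ 1≤j)
  Yᶜ-nonempty {suc i@(suc _)} 1≤si si≤k = let _ , y , y∈ , y∉ = strict i (suc i) (s≤s z≤n) ≤-refl si≤k in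
    y , (1≤si , si≤k) , Yᶜ⁺ y∈ λ 1≤j j<si y∈NXj → y∉ (NX-mono 1≤j (s≤s⁻¹ j<si) (<⇒≤ si≤k) y∈NXj)

  ∈-listed⁺ : ∀ {A v} → v ∈ A → v ∈ₗ listed A
  ∈-listed⁺ {A} {v} v∈ = ∈-filter⁺ (_∈? A)
    ([ ∈-++⁺ˡ ∘ enumerates⁺ enumX , ∈-++⁺ʳ xs ∘ enumerates⁺ enumY ]′ (X⊎Y v)) v∈

  ∈-listed⁻ : ∀ {A v} → v ∈ₗ listed A → v ∈ A
  ∈-listed⁻ {A} v∈ = proj₂ (∈-filter⁻ (_∈? A) {xs = xs ++ ys} v∈)

  xs++ys-unique : Unique (xs ++ ys)
  xs++ys-unique = Unique.++⁺ (proj₁ enumX) (proj₁ enumY)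
    λ (x∈ , y∈) → X∩Y (enumerates⁻ enumX x∈) (enumerates⁻ enumY y∈)

  listed-unique : ∀ A → Unique (listed A)
  listed-unique A = Unique.filter⁺ (_∈? A) xs++ys-unique

  length-listed : ∀ A → length (listed A) ≡ ∣ A ∣
  length-listed A = enumerates-length (listed-unique A , λ v → mk⇔ ∈-listed⁻ ∈-listed⁺)

  listed-⊆X : ∀ {A} → A ⊆ X → listed A ≡ filter (_∈? A) xs
  listed-⊆X {A} sub = trans (filter-++ (_∈? A) xs ys) (trans
    (cong (filter (_∈? A) xs ++_) (filter-none (_∈? A) (All.tabulate λ y∈ a∈ → X∩Y (sub a∈) (enumerates⁻ enumY y∈))))
    (++-identityʳ _))

  listed-⊆Y : ∀ {A} → A ⊆ Y → listed A ≡ filter (_∈? A) ys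
  listed-⊆Y {A} sub = trans (filter-++ (_∈? A) xs ys)
    (cong (_++ filter (_∈? A) ys) (filter-none (_∈? A) (All.tabulate λ x∈ a∈ → X∩Y (enumerates⁻ enumX x∈) (sub a∈))))

  bX bY : ℕ → List Vertex
  bX = listed ∘ Xᶜ
  bY = listed ∘ Yᶜ

  -- Inclusion of neighbourhoods implies the order of levels, so `incr` says that `xs` is sorted by
  -- level.
  upX-all : upX 1 k ≡ xs
  upX-all = trans
    (concatMap-cong-∈ bX _ (range 1 k) λ i _ → listed-⊆X {Xᶜ i} (proj₁ ∘ Xᶜ⁻))
    (sorted⇒concat-blocks (λ i v → v ∈? Xᶜ i) (range 1 k) (range-increasing 1 k) xs
      (All.tabulate λ v∈ → let i , (1≤i , i≤k) , v∈Xᶜ = xlevel (enumerates⁻ enumX v∈) in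
                             i , ∈-range⁺ 1≤i i≤k , v∈Xᶜ)
      (λ i∈ j∈ u∈ v∈ → XLevel-unique (∈-range⁻ i∈ , u∈) (∈-range⁻ j∈ , v∈))
      (AllPairs.map {R = λ u v → N u ⊆ N v} (λ sub _ _ i∈ j∈ u∈ v∈ → XLevel-≤ (∈-range⁻ i∈ , u∈) (∈-range⁻ j∈ , v∈) sub) incr))

  upY : ℕ → ℕ → List Vertex
  upY a b = concatMap bY (range a b)

  upY-all : upY 1 k ≡ ys
  upY-all = trans
    (concatMap-cong-∈ bY _ (range 1 k) λ i i∈ → listed-⊆Y {Yᶜ i} λ v∈ → YLevel⇒Y (∈-range⁻ i∈ , v∈))
    (sorted⇒concat-blocks (λ i v → v ∈? Yᶜ i) (range 1 k) (range-increasing 1 k) ys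
      (All.tabulate λ v∈ → let i , (1≤i , i≤k) , v∈Yᶜ = ylevel (enumerates⁻ enumY v∈) in
                             i , ∈-range⁺ 1≤i i≤k , v∈Yᶜ)
      (λ i∈ j∈ u∈ v∈ → YLevel-unique (∈-range⁻ i∈ , u∈) (∈-range⁻ j∈ , v∈))
      (AllPairs.map {R = λ u v → N v ⊆ N u} (λ sub _ _ i∈ j∈ u∈ v∈ → YLevel-≤ (∈-range⁻ i∈ , u∈) (∈-range⁻ j∈ , v∈) sub) decr))

  length-xs : length xs ≡ n₁
  length-xs = enumerates-length enumX

  length-ys : length ys ≡ n₂
  length-ys = enumerates-length enumY

  sizeX sizeY : ℕ → ℕ → ℕ
  sizeX a b = sum (map (λ j → ∣ Xᶜ j ∣) (range a b))
  sizeY a b = sum (map (λ j → ∣ Yᶜ j ∣) (range a b))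

  length-upX : ∀ a b → length (upX a b) ≡ sizeX a b
  length-upX a b = trans (length-concatMap bX (range a b))
    (cong sum (map-cong (length-listed ∘ Xᶜ) (range a b)))

  length-upY : ∀ a b → length (upY a b) ≡ sizeY a b
  length-upY a b = trans (length-concatMap bY (range a b))
    (cong sum (map-cong (length-listed ∘ Yᶜ) (range a b)))

  length-downY : ∀ b a → length (downY b a) ≡ sizeY a b
  length-downY b a = trans (length-concatMap bY (reverse (range a b)))
    (trans (cong sum (map-cong (length-listed ∘ Yᶜ) (reverse (range a b))))
           (sum-↭ (↭-map⁺ (λ j → ∣ Yᶜ j ∣) (↭-reverse (range a b)))))

  sizeX-++ : ∀ {a b c} → a ≤ suc b → b ≤ c → sizeX a c ≡ sizeX a b + sizeX (suc b) c
  sizeX-++ {a} {b} {c} a≤ b≤c = trans (cong (sum ∘ map (λ j → ∣ Xᶜ j ∣)) (range-++ a≤ b≤c))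
    (trans (cong sum (map-++ (λ j → ∣ Xᶜ j ∣) (range a b) (range (suc b) c)))
           (sum-++ (map (λ j → ∣ Xᶜ j ∣) (range a b)) _))

  sizeY-++ : ∀ {a b c} → a ≤ suc b → b ≤ c → sizeY a c ≡ sizeY a b + sizeY (suc b) c
  sizeY-++ {a} {b} {c} a≤ b≤c = trans (cong (sum ∘ map (λ j → ∣ Yᶜ j ∣)) (range-++ a≤ b≤c))
    (trans (cong sum (map-++ (λ j → ∣ Yᶜ j ∣) (range a b) (range (suc b) c)))
           (sum-++ (map (λ j → ∣ Yᶜ j ∣) (range a b)) _))

  sizeX-single : ∀ a → sizeX a a ≡ ∣ Xᶜ a ∣
  sizeX-single a = trans (cong (sum ∘ map (λ j → ∣ Xᶜ j ∣)) (range-single a)) (+-identityʳ _)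

  sizeY-single : ∀ a → sizeY a a ≡ ∣ Yᶜ a ∣
  sizeY-single a = trans (cong (sum ∘ map (λ j → ∣ Yᶜ j ∣)) (range-single a)) (+-identityʳ _)

  sizeX-all : sizeX 1 k ≡ n₁
  sizeX-all = trans (sym (length-upX 1 k)) (trans (cong length upX-all) length-xs)

  sizeY-all : sizeY 1 k ≡ n₂
  sizeY-all = trans (sym (length-upY 1 k)) (trans (cong length upY-all) length-ys)

  sizeX-∷ʳ : ∀ i → sizeX 1 (suc i) ≡ sizeX 1 i + ∣ Xᶜ (suc i) ∣
  sizeX-∷ʳ i = trans (sizeX-++ (s≤s z≤n) (n≤1+n i)) (cong (sizeX 1 i +_) (sizeX-single (suc i)))

  sizeY-∷ʳ : ∀ i → sizeY 1 (suc i) ≡ sizeY 1 i + ∣ Yᶜ (suc i) ∣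
  sizeY-∷ʳ i = trans (sizeY-++ (s≤s z≤n) (n≤1+n i)) (cong (sizeY 1 i +_) (sizeY-single (suc i)))

  total-0-single : ∣ Yᶜ 1 ∣ ≡ 1 → total 0 ≡ n₂ + ∣ Xᶜ 1 ∣
  total-0-single eq = if-true (dec-true (∣ Yᶜ 1 ∣ ≟ 1) eq)

  total-0-other : ∣ Yᶜ 1 ∣ ≢ 1 → total 0 ≡ n₂
  total-0-other neq = if-false (dec-false (∣ Yᶜ 1 ∣ ≟ 1) neq)

  total-k : ∀ {i} → suc i ≡ k → total (suc i) ≡ (if ∣ Xᶜ k ∣ ≡ᵇ 1 then n₁ + ∣ Yᶜ k ∣ else n₁)
  total-k {i} eq = if-true (dec-true (suc i ≟ k) eq)

  total-k-single : ∣ Xᶜ k ∣ ≡ 1 → total k ≡ n₁ + ∣ Yᶜ k ∣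
  total-k-single eq = trans (cong total (sym k≡)) (trans (total-k k≡) (if-true (dec-true (∣ Xᶜ k ∣ ≟ 1) eq)))
    where k≡ = m+[n∸m]≡n 1≤k

  total-k-other : ∣ Xᶜ k ∣ ≢ 1 → total k ≡ n₁
  total-k-other neq = trans (cong total (sym k≡)) (trans (total-k k≡) (if-false (dec-false (∣ Xᶜ k ∣ ≟ 1) neq)))
    where k≡ = m+[n∸m]≡n 1≤k

  -- `total` subtracts from the whole of `sizeX + n₂`. Regrouping a truncated subtraction is sound
  -- here because the first Y-classes have at most n₂ vertices.
  total-inner : ∀ {i} → suc i < k → total (suc i) ≡ sizeX 1 (suc i) + (n₂ ∸ sizeY 1 (suc i)) + 1
  total-inner {i} i<k = trans (if-false (dec-false (suc i ≟ k) (<⇒≢ i<k)))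
    (cong (_+ 1) (+-∸-assoc (sizeX 1 (suc i)) (subst (sizeY 1 (suc i) ≤_) sizeY-all
      (subst (sizeY 1 (suc i) ≤_) (sym (sizeY-++ (s≤s z≤n) (<⇒≤ i<k))) (m≤m+n _ _)))))

  -- Splitting n₂ at level i turns the difference into the size of the upper Y-classes.
  total-cut : ∀ {i} → 1 ≤ i → i < k → total i ≡ suc (sizeX 1 i + sizeY (suc i) k)
  total-cut {suc i} _ i<k = begin
    total (suc i)
      ≡⟨ total-inner i<k ⟩
    sizeX 1 (suc i) + (n₂ ∸ sizeY 1 (suc i)) + 1
      ≡⟨ cong (λ m → sizeX 1 (suc i) + (m ∸ sizeY 1 (suc i)) + 1) (trans (sym sizeY-all) (sizeY-++ (s≤s z≤n) (<⇒≤ i<k))) ⟩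
    sizeX 1 (suc i) + (sizeY 1 (suc i) + sizeY (2 + i) k ∸ sizeY 1 (suc i)) + 1
      ≡⟨ cong (λ m → sizeX 1 (suc i) + m + 1) (m+n∸m≡n (sizeY 1 (suc i)) _) ⟩
    sizeX 1 (suc i) + sizeY (2 + i) k + 1
      ≡⟨ +-comm _ 1 ⟩
    suc (sizeX 1 (suc i) + sizeY (2 + i) k) ∎
    where open ≡-Reasoning

  n₁≤total : n₁ ≤ total k
  n₁≤total with ∣ Xᶜ k ∣ ≟ 1
  ... | yes eq = subst (n₁ ≤_) (sym (total-k-single eq)) (m≤m+n n₁ _)
  ... | no neq = ≤-reflexive (sym (total-k-other neq))

  n₂≤total : n₂ ≤ total 0
  n₂≤total with ∣ Yᶜ 1 ∣ ≟ 1
  ... | yes eq = subst (n₂ ≤_) (sym (total-0-single eq)) (m≤m+n n₂ _)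
  ... | no neq = ≤-reflexive (sym (total-0-other neq))

  ∈-upX⁺ : ∀ {a b i v} → a ≤ i → i ≤ b → v ∈ Xᶜ i → v ∈ₗ upX a b
  ∈-upX⁺ a≤i i≤b v∈ = ∈-concatMap⁺′ bX (∈-range⁺ a≤i i≤b) (∈-listed⁺ v∈)

  ∈-upX⁻ : ∀ {a b v} → v ∈ₗ upX a b → ∃[ i ] ((a ≤ i × i ≤ b) × v ∈ Xᶜ i)
  ∈-upX⁻ {a} {b} v∈ = let i , i∈ , v∈bX = ∈-concatMap⁻′ bX (range a b) v∈ in i , ∈-range⁻ i∈ , ∈-listed⁻ v∈bX

  ∈-downY⁺ : ∀ {a b i v} → a ≤ i → i ≤ b → v ∈ Yᶜ i → v ∈ₗ downY b a
  ∈-downY⁺ {a} {b} a≤i i≤b v∈ =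
    ∈-concatMap⁺′ bY (Any.reverse⁺ (∈-range⁺ a≤i i≤b)) (∈-listed⁺ v∈)

  ∈-downY⁻ : ∀ {a b v} → v ∈ₗ downY b a → ∃[ i ] ((a ≤ i × i ≤ b) × v ∈ Yᶜ i)
  ∈-downY⁻ {a} {b} v∈ = let i , i∈ , v∈bY = ∈-concatMap⁻′ bY (reverse (range a b)) v∈ in
    i , ∈-range⁻ (Any.reverse⁻ i∈) , ∈-listed⁻ v∈bY

  -- No dominating sequence is longer than the best total

  module _ {M} (best : ∀ j → j ≤ k → total j ≤ M) where

    cut-bound : ∀ {i L} → 1 ≤ i → i < k → Unique L →
      (∀ {v} → v ∈ₗ L → v ∈ₗ upX 1 i ++ downY k (suc i)) → length L < M
    cut-bound {i} {L} 1≤i i<k uniq sub = begin-strict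
      length L                              ≤⟨ unique-⊆⇒length≤ uniq sub ⟩
      length (upX 1 i ++ downY k (suc i))   ≡⟨ length-++ (upX 1 i) ⟩
      length (upX 1 i) + length (downY k (suc i))
        ≡⟨ cong₂ _+_ (length-upX 1 i) (length-downY k (suc i)) ⟩
      sizeX 1 i + sizeY (suc i) k           <⟨ ≤-refl ⟩
      suc (sizeX 1 i + sizeY (suc i) k)     ≡⟨ total-cut 1≤i i<k ⟨
      total i                               ≤⟨ best i (<⇒≤ i<k) ⟩
      M                                     ∎
      where open ≤-Reasoning

    side-X : ∀ {L} → Unique L → (∀ {v} → v ∈ₗ L → v ∈ X) → length L ≤ M
    side-X {L} uniq sub = begin
      length L  ≤⟨ unique-⊆⇒length≤ uniq (enumerates⁺ enumX ∘ sub) ⟩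
      length xs ≡⟨ length-xs ⟩
      n₁        ≤⟨ n₁≤total ⟩
      total k   ≤⟨ best k ≤-refl ⟩
      M         ∎
      where open ≤-Reasoning

    side-Y : ∀ {L} → Unique L → (∀ {v} → v ∈ₗ L → v ∈ Y) → length L ≤ M
    side-Y {L} uniq sub = begin
      length L  ≤⟨ unique-⊆⇒length≤ uniq (enumerates⁺ enumY ∘ sub) ⟩
      length ys ≡⟨ length-ys ⟩
      n₂        ≤⟨ n₂≤total ⟩
      total 0   ≤⟨ best 0 z≤n ⟩
      M         ∎
      where open ≤-Reasoning

    sideXY : Side X Y M
    sideXY = record
      { excl = X∩Y ; cov = X⊎Y ; nbr = N-Y ; nbr′ = N-X ; chain = chain-Y ; side = side-Y ; cut = cut }
      where
      cut : ∀ {y} → y ∈ Y →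
        (∀ {L} → Unique L → (∀ {v} → v ∈ₗ L → (v ∈ X × v ∉ N y) ⊎ (v ∈ Y × N v ⊆ N y)) → length L < M)
        ⊎ (∀ {x} → x ∈ X → x ∈ N y)
      cut {y} y∈ with ylevel y∈
      ... | suc zero , Ly = inj₂ λ x∈ → let _ , L@((1≤j , _) , _) = xlevel x∈ in N-sym (adjacent⁺ L Ly 1≤j)
      ... | suc i@(suc _) , Ly@((_ , i<k) , _) = inj₁ λ uniq below → cut-bound (s≤s z≤n) i<k uniq (inCut ∘ below)
        where
        inCut : ∀ {v} → (v ∈ X × v ∉ N y) ⊎ (v ∈ Y × N v ⊆ N y) → v ∈ₗ upX 1 i ++ downY k (suc i)
        inCut (inj₁ (v∈X , v∉)) with xlevel v∈X
        ... | j , L@((1≤j , _) , v∈) with suc i ≤? j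
        ...   | yes i<j = contradiction (N-sym (adjacent⁺ L Ly i<j)) v∉
        ...   | no i≮j  = ∈-++⁺ˡ (∈-upX⁺ 1≤j (s≤s⁻¹ (≰⇒> i≮j)) v∈)
        inCut (inj₂ (v∈Y , sub)) with ylevel v∈Y
        ... | j , L@((_ , j≤k) , v∈) = ∈-++⁺ʳ (upX 1 i) (∈-downY⁺ (YLevel-≤ Ly L sub) j≤k v∈)

    -- Here the cut is at the level of `x` itself, not one below as for a vertex of Y: the
    -- Y-vertices not adjacent to `x` have larger level. The exceptional class is X_k, whose
    -- vertices dominate Y.
    sideYX : Side Y X M
    sideYX = record
      { excl = λ y∈ x∈ → X∩Y x∈ y∈ ; cov = λ v → [ inj₂ , inj₁ ]′ (X⊎Y v) ; nbr = N-X ; nbr′ = N-Y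
      ; chain = chain-X ; side = side-X ; cut = cut }
      where
      cut : ∀ {x} → x ∈ X →
        (∀ {L} → Unique L → (∀ {v} → v ∈ₗ L → (v ∈ Y × v ∉ N x) ⊎ (v ∈ X × N v ⊆ N x)) → length L < M)
        ⊎ (∀ {y} → y ∈ Y → y ∈ N x)
      cut {x} x∈ with xlevel x∈
      ... | i , Lx@((1≤i , i≤k) , _) with m≤n⇒m<n∨m≡n i≤k
      ...   | inj₂ refl = inj₂ λ y∈ → let _ , L@((_ , j≤k) , _) = ylevel y∈ in adjacent⁺ Lx L j≤k
      ...   | inj₁ i<k = inj₁ λ uniq below → cut-bound 1≤i i<k uniq (inCut ∘ below)
        where
        inCut : ∀ {v} → (v ∈ Y × v ∉ N x) ⊎ (v ∈ X × N v ⊆ N x) → v ∈ₗ upX 1 i ++ downY k (suc i)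
        inCut (inj₁ (v∈Y , v∉)) with ylevel v∈Y
        ... | j , L@((_ , j≤k) , v∈) with j ≤? i
        ...   | yes j≤i = contradiction (adjacent⁺ Lx L j≤i) v∉
        ...   | no j≰i  = ∈-++⁺ʳ (upX 1 i) (∈-downY⁺ (≰⇒> j≰i) j≤k v∈)
        inCut (inj₂ (v∈X , sub)) with xlevel v∈X
        ... | j , L@((1≤j , _) , v∈) = ∈-++⁺ˡ (∈-upX⁺ 1≤j (XLevel-≤ L Lx sub) v∈)

    upper-bound : ∀ S → IsDominatingSequence S → length S ≤ M
    upper-bound S dom = legal-bound sideXY sideYX [] S ([] , λ ()) (dominating⇒legal dom)

-- The sequences returned by the algorithm

length≡1 : ∀ {A : Set} (l : List A) → length l ≡ 1 → ∃[ a ] l ≡ a ∷ []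
length≡1 (a ∷ []) _ = a , refl

module Constructions (B : BipartiteGraph) (O : ChainOrdering B) (T : TwinClasses B)
                  (noIsolated : BipartiteGraph.NoIsolated B) (2≤k : 2 ≤ TwinClasses.k T) where

  open BipartiteGraph B renaming (sym to N-sym)
  open ChainOrdering O
  open TwinClasses T
  open Algorithm B O T
  open LegalSequences graph
  open ChainGraph B O T noIsolated 2≤k

  -- The vertices of X_1, …, X_i, Y_{i+1}, …, Y_k.
  InCut : ℕ → Vertex → Set
  InCut i v = (∃[ j ] (j ≤ i × XLevel j v)) ⊎ (∃[ j ] (i < j × YLevel j v))

  inCut-nonadjacent : ∀ {i u v} → InCut i u → InCut i v → v ∉ N u
  inCut-nonadjacent (inj₁ (_ , _ , Lu)) (inj₁ (_ , _ , Lv)) v∈ = X∩Y (XLevel⇒X Lv) (N-X (XLevel⇒X Lu) v∈)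
  inCut-nonadjacent (inj₂ (_ , _ , Lu)) (inj₂ (_ , _ , Lv)) v∈ = X∩Y (N-Y (YLevel⇒Y Lu) v∈) (YLevel⇒Y Lv)
  inCut-nonadjacent (inj₁ (_ , j≤i , Lu)) (inj₂ (_ , i<j , Lv)) v∈ = <⇒≱ i<j (≤-trans (adjacent⁻ Lu Lv v∈) j≤i)
  inCut-nonadjacent (inj₂ (_ , i<j , Lu)) (inj₁ (_ , j≤i , Lv)) v∈ =
    <⇒≱ i<j (≤-trans (adjacent⁻ Lv Lu (N-sym v∈)) j≤i)

  inCut-independent : ∀ {i L} → Unique L → (∀ {v} → v ∈ₗ L → InCut i v) → Independent L
  inCut-independent uniq inCut = uniq , λ u∈ v∈ → inCut-nonadjacent (inCut u∈) (inCut v∈)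

  ∉N[]-X : ∀ {u v} → u ∈ X → v ∈ X → v ≢ u → v ∉ N[ u ]
  ∉N[]-X u∈ v∈ v≢u v∈N = [ X∩Y v∈ ∘ N-X u∈ , v≢u ]′ (∈N[]⁻ v∈N)

  ∉N[]-Y : ∀ {u v} → u ∈ Y → v ∈ Y → v ≢ u → v ∉ N[ u ]
  ∉N[]-Y u∈ v∈ v≢u v∈N = [ (λ v∈N → X∩Y (N-Y u∈ v∈N) v∈) , v≢u ]′ (∈N[]⁻ v∈N)

  YLevel-∉N[] : ∀ {i j x y} → XLevel j x → YLevel i y → j < i → y ∉ N[ x ]
  YLevel-∉N[] Lx Ly j<i y∈ with ∈N[]⁻ y∈
  ... | inj₁ y∈N  = <⇒≱ j<i (adjacent⁻ Lx Ly y∈N)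
  ... | inj₂ refl = X∩Y (XLevel⇒X Lx) (YLevel⇒Y Ly)

  XLevel-∉N[] : ∀ {i j x y} → XLevel j x → YLevel i y → j < i → x ∉ N[ y ]
  XLevel-∉N[] Lx Ly j<i = YLevel-∉N[] Lx Ly j<i ∘ N[]-sym

  ≢-level : ∀ {C : ℕ → Vertex → Set} {i j u v} → (∀ {i j v} → C i v → C j v → i ≡ j) →
            C i u → C j v → i ≢ j → u ≢ v
  ≢-level unique Lu Lv i≢j refl = i≢j (unique Lu Lv)

  upX-level : ∀ {a b v} → 1 ≤ a → b ≤ k → v ∈ₗ upX a b → ∃[ j ] ((a ≤ j × j ≤ b) × XLevel j v)
  upX-level 1≤a b≤k v∈ = let j , (a≤j , j≤b) , v∈Xᶜ = ∈-upX⁻ v∈ in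
    j , (a≤j , j≤b) , (≤-trans 1≤a a≤j , ≤-trans j≤b b≤k) , v∈Xᶜ

  downY-level : ∀ {a b v} → 1 ≤ a → b ≤ k → v ∈ₗ downY b a → ∃[ j ] ((a ≤ j × j ≤ b) × YLevel j v)
  downY-level 1≤a b≤k v∈ = let j , (a≤j , j≤b) , v∈Yᶜ = ∈-downY⁻ v∈ in
    j , (a≤j , j≤b) , (≤-trans 1≤a a≤j , ≤-trans j≤b b≤k) , v∈Yᶜ

  upX-unique : ∀ {a b} → 1 ≤ a → b ≤ k → Unique (upX a b)
  upX-unique {a} {b} 1≤a b≤k = unique-concatMap bX (range a b) (range-unique a b) (listed-unique ∘ Xᶜ)
    λ i∈ j∈ u∈ v∈ → let a≤i , i≤b = ∈-range⁻ i∈ ; a≤j , j≤b = ∈-range⁻ j∈ in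
      XLevel-unique ((≤-trans 1≤a a≤i , ≤-trans i≤b b≤k) , ∈-listed⁻ u∈)
                    ((≤-trans 1≤a a≤j , ≤-trans j≤b b≤k) , ∈-listed⁻ v∈)

  downY-unique : ∀ {a b} → 1 ≤ a → b ≤ k → Unique (downY b a)
  downY-unique {a} {b} 1≤a b≤k =
    unique-concatMap bY (reverse (range a b)) (reverse-unique (range-unique a b)) (listed-unique ∘ Yᶜ)
    λ i∈ j∈ u∈ v∈ → let a≤i , i≤b = ∈-range⁻ (Any.reverse⁻ i∈) ; a≤j , j≤b = ∈-range⁻ (Any.reverse⁻ j∈) in
      YLevel-unique ((≤-trans 1≤a a≤i , ≤-trans i≤b b≤k) , ∈-listed⁻ u∈)
                    ((≤-trans 1≤a a≤j , ≤-trans j≤b b≤k) , ∈-listed⁻ v∈)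
    where
    reverse-unique : ∀ {l : List ℕ} → Unique l → Unique (reverse l)
    reverse-unique = ↭ₛ.Unique-resp-↭ (setoid ℕ) (↭⇒↭ₛ (↭-sym (↭-reverse _)))

  Y-sequence : IsDominatingSequence (downY k 1)
  Y-sequence = legal⇒dominating
    (independent⇒legal (inCut-independent {i = 0} (downY-unique {1} {k} ≤-refl ≤-refl) inCut) λ _ ()) dom
    where
    inCut : ∀ {v} → v ∈ₗ downY k 1 → InCut 0 v
    inCut v∈ = let j , (1≤j , _) , L = downY-level {1} {k} ≤-refl ≤-refl v∈ in inj₂ (j , 1≤j , L)
    dom : ∀ v → ∃[ s ] (s ∈ₗ downY k 1 × v ∈ N[ s ])
    dom v with X⊎Y v
    ... | inj₁ v∈X = let _ , L@((1≤j , _) , _) = xlevel v∈X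
                         y , Ly@((1≤1 , 1≤k) , y∈) = Yᶜ-nonempty ≤-refl 1≤k
                     in y , ∈-downY⁺ 1≤1 1≤k y∈ , N⊆N[] (N-sym (adjacent⁺ L Ly 1≤j))
    ... | inj₂ v∈Y = let _ , (1≤j , j≤k) , v∈Yᶜ = ylevel v∈Y in v , ∈-downY⁺ 1≤j j≤k v∈Yᶜ , v∈N[v]

  X-sequence : IsDominatingSequence (upX 1 k)
  X-sequence = legal⇒dominating
    (independent⇒legal (inCut-independent {i = k} (upX-unique {1} {k} ≤-refl ≤-refl) inCut) λ _ ()) dom
    where
    inCut : ∀ {v} → v ∈ₗ upX 1 k → InCut k v
    inCut v∈ = let j , (_ , j≤k) , L = upX-level {1} {k} ≤-refl ≤-refl v∈ in inj₁ (j , j≤k , L)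
    dom : ∀ v → ∃[ s ] (s ∈ₗ upX 1 k × v ∈ N[ s ])
    dom v with X⊎Y v
    ... | inj₁ v∈X = let _ , (1≤j , j≤k) , v∈Xᶜ = xlevel v∈X in v , ∈-upX⁺ 1≤j j≤k v∈Xᶜ , v∈N[v]
    ... | inj₂ v∈Y = let _ , L@((_ , j≤k) , _) = ylevel v∈Y
                         R@(_ , r∈) = rep-level 1≤k ≤-refl
                     in rep k , ∈-upX⁺ 1≤k ≤-refl r∈ , N⊆N[] (adjacent⁺ R L j≤k)

  -- Case (v) with i* = i + 1: x is the inserted vertex and footprints Y_{i*}.
  module Inner {i x} (i<k : suc i < k) (x∈ : x ∈ Xᶜ (2 + i)) where

    private
      i≤k : suc i ≤ k
      i≤k = <⇒≤ i<k

      A : List Vertex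
      A = upX 1 i ++ downY k (2 + i)

      Lx : XLevel (2 + i) x
      Lx = (s≤s z≤n , i<k) , x∈

      levels-A : ∀ {v} → v ∈ₗ A → (∃[ j ] (j < suc i × XLevel j v)) ⊎ (∃[ j ] (suc i < j × YLevel j v))
      levels-A v∈ with ∈-++⁻ (upX 1 i) v∈
      ... | inj₁ v∈X = let j , (_ , j≤i) , L = upX-level {1} {i} ≤-refl (<⇒≤ i≤k) v∈X in inj₁ (j , s≤s j≤i , L)
      ... | inj₂ v∈Y = let j , (i<j , _) , L = downY-level {2 + i} (s≤s z≤n) ≤-refl v∈Y in inj₂ (j , i<j , L)

      level-B : ∀ {v} → v ∈ₗ bX (suc i) → XLevel (suc i) v
      level-B v∈ = (s≤s z≤n , i≤k) , ∈-listed⁻ v∈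

      inCut : ∀ {v} → v ∈ₗ A ++ bX (suc i) → InCut (suc i) v
      inCut v∈ with ∈-++⁻ A v∈
      ... | inj₂ v∈B = inj₁ (suc i , ≤-refl , level-B v∈B)
      ... | inj₁ v∈A with levels-A v∈A
      ...   | inj₁ (j , j<i , L) = inj₁ (j , <⇒≤ j<i , L)
      ...   | inj₂ (j , i<j , L) = inj₂ (j , i<j , L)

      unique : Unique (A ++ bX (suc i))
      unique = Unique.++⁺
        (Unique.++⁺ (upX-unique {1} {i} ≤-refl (<⇒≤ i≤k)) (downY-unique {2 + i} (s≤s z≤n) ≤-refl)
          λ (u∈ , v∈) → X∩Y (XLevel⇒X (proj₂ (proj₂ (upX-level {1} {i} ≤-refl (<⇒≤ i≤k) u∈))))
                            (YLevel⇒Y (proj₂ (proj₂ (downY-level {2 + i} (s≤s z≤n) ≤-refl v∈)))))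
        (listed-unique (Xᶜ (suc i)))
        λ (u∈ , v∈) → [ (λ (_ , j<i , L) → <-irrefl (XLevel-unique L (level-B v∈)) j<i)
                      , (λ (_ , _ , L) → X∩Y (XLevel⇒X (level-B v∈)) (YLevel⇒Y L)) ]′ (levels-A u∈)

      sequence : List Vertex
      sequence = A ++ x ∷ bX (suc i)

      legal : Legal [] sequence
      legal =
        -- `w` has level i*. It is undominated before `x`, since the X-vertices played so far have
        -- smaller level and its own side can only dominate it by equality.
        let w , Lw = Yᶜ-nonempty (s≤s z≤n) i≤k in
        insert-legal (inCut-independent unique inCut) (λ _ ())
          (N⊆N[] (adjacent⁺ Lx Lw (n≤1+n (suc i)))) (λ ())
          (λ u∈ → [ (λ (_ , j<i , L) → YLevel-∉N[] L Lw j<i)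
                  , (λ (_ , i<j , L) → ∉N[]-Y (YLevel⇒Y L) (YLevel⇒Y Lw)
                      (≢-level YLevel-unique Lw L (<⇒≢ i<j))) ]′ (levels-A u∈))
          λ b∈ → ∉N[]-X (XLevel⇒X Lx) (XLevel⇒X (level-B b∈)) (≢-level XLevel-unique (level-B b∈) Lx (<⇒≢ ≤-refl))

      -- The X-classes above i* are covered through any vertex of Y_{i*+1}, and Y_1, ..., Y_{i*+1}
      -- through `x`; all other vertices are played.
      dom : ∀ v → ∃[ s ] (s ∈ₗ sequence × v ∈ N[ s ])
      dom v with X⊎Y v
      ... | inj₁ v∈X with xlevel v∈X
      ...   | j , L@((1≤j , _) , v∈) with <-cmp j (suc i)
      ...     | tri< j<i _ _ = v , ∈-++⁺ˡ (∈-++⁺ˡ (∈-upX⁺ 1≤j (s≤s⁻¹ j<i) v∈)) , v∈N[v]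
      ...     | tri≈ _ refl _ = v , ∈-++⁺ʳ A (there (∈-listed⁺ v∈)) , v∈N[v]
      ...     | tri> _ _ i<j =
        let y , Ly@(_ , y∈) = Yᶜ-nonempty (s≤s z≤n) i<k in
        y , ∈-++⁺ˡ (∈-++⁺ʳ (upX 1 i) (∈-downY⁺ ≤-refl i<k y∈)) , N⊆N[] (N-sym (adjacent⁺ L Ly i<j))
      dom v | inj₂ v∈Y with ylevel v∈Y
      ... | j , L@((_ , j≤k) , v∈) with j ≤? 2 + i
      ...   | yes j≤i = x , ∈-++⁺ʳ A (here refl) , N⊆N[] (adjacent⁺ Lx L j≤i)
      ...   | no j≰i  = v , ∈-++⁺ˡ (∈-++⁺ʳ (upX 1 i) (∈-downY⁺ (<⇒≤ (≰⇒> j≰i)) j≤k v∈)) , v∈N[v]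

      assoc : sequence ≡ upX 1 i ++ downY k (2 + i) ++ (x ∷ []) ++ listed (Xᶜ (suc i))
      assoc = ++-assoc (upX 1 i) (downY k (2 + i)) _

    dominating : IsDominatingSequence (upX 1 i ++ downY k (2 + i) ++ (x ∷ []) ++ listed (Xᶜ (suc i)))
    dominating = subst IsDominatingSequence assoc (legal⇒dominating legal dom)

    length-total : length (upX 1 i ++ downY k (2 + i) ++ (x ∷ []) ++ listed (Xᶜ (suc i))) ≡ total (suc i)
    length-total = begin
      length (upX 1 i ++ downY k (2 + i) ++ (x ∷ []) ++ listed (Xᶜ (suc i)))
        ≡⟨ length-++ (upX 1 i) ⟩
      length (upX 1 i) + length (downY k (2 + i) ++ (x ∷ []) ++ listed (Xᶜ (suc i)))
        ≡⟨ cong (length (upX 1 i) +_) (length-++ (downY k (2 + i))) ⟩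
      length (upX 1 i) + (length (downY k (2 + i)) + suc (length (listed (Xᶜ (suc i)))))
        ≡⟨ cong₂ _+_ (length-upX 1 i) (cong₂ (λ a b → a + suc b) (length-downY k (2 + i)) (length-listed (Xᶜ (suc i)))) ⟩
      sizeX 1 i + (sizeY (2 + i) k + suc ∣ Xᶜ (suc i) ∣)
        ≡⟨ arith (sizeX 1 i) (sizeY (2 + i) k) (∣ Xᶜ (suc i) ∣) ⟩
      suc (sizeX 1 i + ∣ Xᶜ (suc i) ∣ + sizeY (2 + i) k)
        ≡⟨ cong (λ a → suc (a + sizeY (2 + i) k)) (sizeX-∷ʳ i) ⟨
      suc (sizeX 1 (suc i) + sizeY (2 + i) k)
        ≡⟨ total-cut (s≤s z≤n) i<k ⟨
      total (suc i) ∎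
      where
      open ≡-Reasoning
      arith : ∀ a b c → a + (b + suc c) ≡ suc (a + c + b)
      arith = solve-∀

  -- Case (ii): the vertex of Y_1 is inserted and footprints X_2.
  module First (single : ∣ Yᶜ 1 ∣ ≡ 1) where

    private
      y₁∃ : ∃[ y ] listed (Yᶜ 1) ≡ y ∷ []
      y₁∃ = length≡1 (listed (Yᶜ 1)) (trans (length-listed (Yᶜ 1)) single)

      y₁ : Vertex
      y₁ = proj₁ y₁∃

      Ly₁ : YLevel 1 y₁
      Ly₁ = (≤-refl , 1≤k) , ∈-listed⁻ (subst (y₁ ∈ₗ_) (sym (proj₂ y₁∃)) (here refl))

      A : List Vertex
      A = listed (Xᶜ 1) ++ downY k 3

      levels-A : ∀ {v} → v ∈ₗ A → XLevel 1 v ⊎ (∃[ j ] (2 < j × YLevel j v))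
      levels-A v∈ with ∈-++⁻ (listed (Xᶜ 1)) v∈
      ... | inj₁ v∈X = inj₁ ((≤-refl , 1≤k) , ∈-listed⁻ v∈X)
      ... | inj₂ v∈Y = let j , (2<j , _) , L = downY-level {3} (s≤s z≤n) ≤-refl v∈Y in inj₂ (j , 2<j , L)

      level-B : ∀ {v} → v ∈ₗ bY 2 → YLevel 2 v
      level-B v∈ = (s≤s z≤n , 2≤k) , ∈-listed⁻ v∈

      inCut : ∀ {v} → v ∈ₗ A ++ bY 2 → InCut 1 v
      inCut v∈ with ∈-++⁻ A v∈
      ... | inj₂ v∈B = inj₂ (2 , ≤-refl , level-B v∈B)
      ... | inj₁ v∈A with levels-A v∈A
      ...   | inj₁ L             = inj₁ (1 , ≤-refl , L)
      ...   | inj₂ (j , 2<j , L) = inj₂ (j , <⇒≤ 2<j , L)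

      unique : Unique (A ++ bY 2)
      unique = Unique.++⁺
        (Unique.++⁺ (listed-unique (Xᶜ 1)) (downY-unique {3} (s≤s z≤n) ≤-refl)
          λ (u∈ , v∈) → X∩Y (proj₁ (Xᶜ⁻ (∈-listed⁻ u∈)))
                            (YLevel⇒Y (proj₂ (proj₂ (downY-level {3} (s≤s z≤n) ≤-refl v∈)))))
        (listed-unique (Yᶜ 2))
        λ (u∈ , v∈) → [ (λ L → X∩Y (XLevel⇒X L) (YLevel⇒Y (level-B v∈)))
                      , (λ (_ , 2<j , L) → <-irrefl (YLevel-unique (level-B v∈) L) 2<j) ]′ (levels-A u∈)

      sequence : List Vertex
      sequence = A ++ y₁ ∷ bY 2

      legal : Legal [] sequence
      legal =
        -- `rep 2` is still undominated: X_1 lies on its own side, and Y_3, ..., Y_k are not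
        -- adjacent to level 2.
        let Lw = rep-level (s≤s z≤n) 2≤k in
        insert-legal (inCut-independent unique inCut) (λ _ ())
          (N⊆N[] (N-sym (adjacent⁺ Lw Ly₁ (s≤s z≤n)))) (λ ())
          (λ u∈ → [ (λ L → ∉N[]-X (XLevel⇒X L) (XLevel⇒X Lw) (≢-level XLevel-unique Lw L λ ()))
                  , (λ (_ , 2<j , L) → XLevel-∉N[] Lw L 2<j) ]′ (levels-A u∈))
          λ b∈ → ∉N[]-Y (YLevel⇒Y Ly₁) (YLevel⇒Y (level-B b∈)) (≢-level YLevel-unique (level-B b∈) Ly₁ λ ())

      dom : ∀ v → ∃[ s ] (s ∈ₗ sequence × v ∈ N[ s ])
      dom v with X⊎Y v
      ... | inj₁ v∈X = let _ , L@((1≤j , _) , _) = xlevel v∈X in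
                       y₁ , ∈-++⁺ʳ A (here refl) , N⊆N[] (N-sym (adjacent⁺ L Ly₁ 1≤j))
      ... | inj₂ v∈Y with ylevel v∈Y
      ...   | zero , (() , _) , _
      ...   | 1 , _ , v∈ = y₁ , ∈-++⁺ʳ A (here refl) ,
              subst (_∈ N[ y₁ ]) (sym (singleton (subst (v ∈ₗ_) (proj₂ y₁∃) (∈-listed⁺ v∈)))) v∈N[v]
        where
        singleton : ∀ {u w : Vertex} → u ∈ₗ w ∷ [] → u ≡ w
        singleton (here eq) = eq
      ...   | 2 , _ , v∈ = v , ∈-++⁺ʳ A (there (∈-listed⁺ v∈)) , v∈N[v]
      ...   | suc (suc (suc j)) , (_ , j≤k) , v∈ =
              v , ∈-++⁺ˡ (∈-++⁺ʳ (listed (Xᶜ 1)) (∈-downY⁺ (s≤s (s≤s (s≤s z≤n))) j≤k v∈)) , v∈N[v]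

      assoc : sequence ≡ listed (Xᶜ 1) ++ downY k 3 ++ listed (Yᶜ 1) ++ listed (Yᶜ 2)
      assoc = trans (++-assoc (listed (Xᶜ 1)) (downY k 3) _)
        (cong (λ l → listed (Xᶜ 1) ++ downY k 3 ++ l ++ bY 2) (sym (proj₂ y₁∃)))

    dominating : IsDominatingSequence (listed (Xᶜ 1) ++ downY k 3 ++ listed (Yᶜ 1) ++ listed (Yᶜ 2))
    dominating = subst IsDominatingSequence assoc (legal⇒dominating legal dom)

    length-total : length (listed (Xᶜ 1) ++ downY k 3 ++ listed (Yᶜ 1) ++ listed (Yᶜ 2)) ≡ total 0
    length-total = begin
      length (listed (Xᶜ 1) ++ downY k 3 ++ listed (Yᶜ 1) ++ listed (Yᶜ 2))
        ≡⟨ length-++ (listed (Xᶜ 1)) ⟩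
      length (listed (Xᶜ 1)) + length (downY k 3 ++ listed (Yᶜ 1) ++ listed (Yᶜ 2))
        ≡⟨ cong (length (listed (Xᶜ 1)) +_) (trans (length-++ (downY k 3))
             (cong (length (downY k 3) +_) (length-++ (listed (Yᶜ 1))))) ⟩
      length (listed (Xᶜ 1)) + (length (downY k 3) + (length (listed (Yᶜ 1)) + length (listed (Yᶜ 2))))
        ≡⟨ cong₂ _+_ (length-listed (Xᶜ 1)) (cong₂ _+_ (length-downY k 3)
             (cong₂ _+_ (length-listed (Yᶜ 1)) (length-listed (Yᶜ 2)))) ⟩
      ∣ Xᶜ 1 ∣ + (sizeY 3 k + (∣ Yᶜ 1 ∣ + ∣ Yᶜ 2 ∣))
        ≡⟨ arith (∣ Xᶜ 1 ∣) (sizeY 3 k) (∣ Yᶜ 1 ∣) (∣ Yᶜ 2 ∣) ⟩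
      ∣ Yᶜ 1 ∣ + ∣ Yᶜ 2 ∣ + sizeY 3 k + ∣ Xᶜ 1 ∣
        ≡⟨ cong (λ a → a + ∣ Yᶜ 2 ∣ + sizeY 3 k + ∣ Xᶜ 1 ∣) (sizeY-single 1) ⟨
      sizeY 1 1 + ∣ Yᶜ 2 ∣ + sizeY 3 k + ∣ Xᶜ 1 ∣
        ≡⟨ cong (λ a → a + sizeY 3 k + ∣ Xᶜ 1 ∣) (sizeY-∷ʳ 1) ⟨
      sizeY 1 2 + sizeY 3 k + ∣ Xᶜ 1 ∣
        ≡⟨ cong (_+ ∣ Xᶜ 1 ∣) (trans (sym (sizeY-++ (s≤s z≤n) 2≤k)) sizeY-all) ⟩
      n₂ + ∣ Xᶜ 1 ∣
        ≡⟨ total-0-single single ⟨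
      total 0 ∎
      where
      open ≡-Reasoning
      arith : ∀ a b c d → a + (b + (c + d)) ≡ c + d + b + a
      arith = solve-∀

  -- Case (iv) is case (v) with i* = k - 1, as X_k has only one vertex.
  module Last {m} (k≡ : 2 + m ≡ k) (single : ∣ Xᶜ k ∣ ≡ 1) where

    private
      x∃ : ∃[ x ] listed (Xᶜ k) ≡ x ∷ []
      x∃ = length≡1 (listed (Xᶜ k)) (trans (length-listed (Xᶜ k)) single)

      x : Vertex
      x = proj₁ x∃

      x∈ : x ∈ Xᶜ (2 + m)
      x∈ = subst (λ i → x ∈ Xᶜ i) (sym k≡) (∈-listed⁻ (subst (x ∈ₗ_) (sym (proj₂ x∃)) (here refl)))

      open Inner {m} (≤-reflexive k≡) x∈ renaming (dominating to dominating′; length-total to length-total′)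

      downY-k : downY k (2 + m) ≡ listed (Yᶜ k)
      downY-k = trans (cong (downY k) k≡)
        (trans (cong (concatMap bY ∘ reverse) (range-single k)) (++-identityʳ _))

      eq : upX 1 m ++ downY k (2 + m) ++ (x ∷ []) ++ listed (Xᶜ (suc m)) ≡
           upX 1 m ++ listed (Yᶜ k) ++ listed (Xᶜ k) ++ listed (Xᶜ (suc m))
      eq = cong₂ (λ a b → upX 1 m ++ a ++ b ++ listed (Xᶜ (suc m))) downY-k (sym (proj₂ x∃))

      -- The extra unit of the inner total is the single vertex of X_k, so both sides are n₁ +
      -- |Y_k|.
      total≡ : total (suc m) ≡ total k
      total≡ = begin
        total (suc m)
          ≡⟨ total-cut (s≤s z≤n) (≤-reflexive k≡) ⟩
        suc (sizeX 1 (suc m) + sizeY (2 + m) k)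
          ≡⟨ cong (λ a → suc (sizeX 1 (suc m) + a)) (trans (cong (λ j → sizeY j k) k≡) (sizeY-single k)) ⟩
        suc (sizeX 1 (suc m) + ∣ Yᶜ k ∣)
          ≡⟨ cong (_+ ∣ Yᶜ k ∣) (+-comm 1 (sizeX 1 (suc m))) ⟩
        sizeX 1 (suc m) + 1 + ∣ Yᶜ k ∣
          ≡⟨ cong (λ a → sizeX 1 (suc m) + a + ∣ Yᶜ k ∣) (trans (cong (λ j → ∣ Xᶜ j ∣) k≡) single) ⟨
        sizeX 1 (suc m) + ∣ Xᶜ (2 + m) ∣ + ∣ Yᶜ k ∣
          ≡⟨ cong (_+ ∣ Yᶜ k ∣) (trans (sym (sizeX-∷ʳ (suc m))) (trans (cong (sizeX 1) k≡) sizeX-all)) ⟩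
        n₁ + ∣ Yᶜ k ∣
          ≡⟨ total-k-single single ⟨
        total k ∎
        where open ≡-Reasoning

    dominating : IsDominatingSequence (upX 1 m ++ listed (Yᶜ k) ++ listed (Xᶜ k) ++ listed (Xᶜ (suc m)))
    dominating = subst IsDominatingSequence eq dominating′

    length-total : length (upX 1 m ++ listed (Yᶜ k) ++ listed (Xᶜ k) ++ listed (Xᶜ (suc m))) ≡ total k
    length-total = trans (cong length (sym eq)) (trans length-total′ total≡)

  Good : ℕ → List Vertex → Set
  Good i S = IsDominatingSequence S × length S ≡ total i

  returns⇒good : ∀ {i S} → Returns i S → Good i S
  returns⇒good (i- 1<) = Y-sequence ,
    trans (length-downY k 1) (trans sizeY-all (sym (total-0-other λ eq → <-irrefl (sym eq) 1<)))
  returns⇒good (ii-≥3 single _) = First.dominating single , First.length-total single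
  -- For k = 2 the block Y_k, ..., Y_3 is empty, so the sequence is the one for k ≥ 3.
  returns⇒good (ii-2 single k≡2) = subst (Good 0)
    (cong (λ l → listed (Xᶜ 1) ++ l ++ listed (Yᶜ 1) ++ listed (Yᶜ 2))
      (cong (concatMap bY ∘ reverse) (range-empty (≤-reflexive (cong suc k≡2)))))
    (First.dominating single , First.length-total single)
  returns⇒good (iii- 1<) = X-sequence ,
    trans (length-upX 1 k) (trans sizeX-all (sym (total-k-other λ eq → <-irrefl (sym eq) 1<)))
  returns⇒good (iv-≥3 single _) = subst (Good k)
    (cong (λ j → upX 1 (k ∸ 2) ++ listed (Yᶜ k) ++ listed (Xᶜ k) ++ listed (Xᶜ j)) (sym (+-∸-assoc 1 2≤k)))
    (Last.dominating k≡ single , Last.length-total k≡ single)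
    where k≡ = m+[n∸m]≡n 2≤k
  returns⇒good (iv-2 single k≡2) = subst (Good k)
    (cong₂ (λ i j → listed (Yᶜ i) ++ listed (Xᶜ j) ++ listed (Xᶜ 1)) k≡2 k≡2)
    (Last.dominating {0} (sym k≡2) single , Last.length-total {0} (sym k≡2) single)
  returns⇒good (v->1 {suc i} _ i≤k-1 x∈) = Inner.dominating i<k x∈ , Inner.length-total i<k x∈
    where i<k = ≤-trans (s≤s i≤k-1) (≤-reflexive (m+[n∸m]≡n 1≤k))
  -- The implicit index is 0, and `upX 1 0` reduces to the empty list.
  returns⇒good (v-1 _ x∈) = Inner.dominating 2≤k x∈ , Inner.length-total 2≤k x∈

  output-grundy : ∀ S → Output S → IsGrundyDominatingSequence S
  output-grundy S (i , (i≤k , best) , ret) = let dom , len = returns⇒good ret in record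
    { isDominatingSequence = dom
    ; maximum = λ S′ dom′ → subst (length S′ ≤_) (sym len) (upper-bound best S′ dom′)
    }

-- The value computed by the program

module ProgramValue (V : Set) where
  open Semantics V
  open Program {Val}

  -- The value of `lengthᵗ` up to definitional equality; adding 1 on the right keeps it from being
  -- `length` itself.
  len : ∀ {A : Set} → List A → ℕ
  len = foldr (λ _ m → m + 1) 0

  len≡length : ∀ {A : Set} (l : List A) → len l ≡ length l
  len≡length []      = refl
  len≡length (_ ∷ l) = trans (+-comm (len l) 1) (cong suc (len≡length l))

  -- The value of `caseᵗ` is defined by `with`, so it does not reduce when the scrutinee, such as a
  -- reversed list, is only propositionally a cons.
  case-∷ : ∀ {A B} (e : Tm Val (list A)) {s : Tm Val B} {f} {a as} → ⟦ e ⟧ ≡ a ∷ as →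
           ⟦ caseᵗ e s f ⟧ ≡ ⟦ f a as ⟧
  case-∷ e eq with ⟦ e ⟧
  case-∷ e refl | _ = refl

  insert : V × List V → List (ℕ × List V) → List (ℕ × List V)
  insert (v , a) []             = (len a , v ∷ []) ∷ []
  insert (v , a) ((d , b) ∷ cs) =
    if len a ≡ᵇ d then (len a , v ∷ b) ∷ cs else (len a , v ∷ []) ∷ (d , b) ∷ cs

  group-value : ∀ l → ⟦ group (var l) ⟧ ≡ foldr insert [] l
  group-value []      = refl
  group-value (v ∷ l) rewrite group-value l with foldr insert [] l
  ... | []    = refl
  ... | _ ∷ _ = refl

  classes-value : ∀ l → ⟦ classes (var l) ⟧ ≡ map proj₂ (foldr insert [] l)
  classes-value l = trans (proj₂s ⟦ group (var l) ⟧) (cong (map proj₂) (group-value l))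
    where
    proj₂s : ∀ cs → foldr (λ c r → proj₂ c ∷ r) [] cs ≡ map proj₂ cs
    proj₂s []       = refl
    proj₂s (c ∷ cs) = cong (proj₂ c ∷_) (proj₂s cs)

  -- Grouping by degree

  module _ (adj : V → List V) where

    private
      tag : V → V × List V
      tag v = v , adj v

    Fresh : ℕ → List (ℕ × List V) → Set
    Fresh d []             = Unit
    Fresh d ((d′ , _) ∷ _) = d ≢ d′

    -- The right fold meets the last vertex of the block first. `Fresh` makes that vertex open a new
    -- group, and the equal degrees put the others into it.
    insert-block : ∀ {d cs} u b → (∀ {v} → v ∈ₗ u ∷ b → len (adj v) ≡ d) → Fresh d cs →
                   foldr insert cs (map tag (u ∷ b)) ≡ (d , u ∷ b) ∷ cs
    insert-block {cs = []} u [] deg _ = cong (λ d → (d , u ∷ []) ∷ []) (deg (here refl))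
    insert-block {cs = (d′ , b′) ∷ cs} u [] deg d≢ rewrite deg (here refl) =
      if-false (dec-false (_ ≟ d′) d≢)
    insert-block {d} {cs} u (u′ ∷ b) deg fresh
      rewrite insert-block {d} {cs} u′ b (deg ∘ there) fresh | deg (here refl) =
      if-true (dec-true (d ≟ d) refl)

    firstDegree : List V → ℕ
    firstDegree []      = 0
    firstDegree (v ∷ _) = len (adj v)

    -- The hypotheses isolate what the graph must provide: nonempty blocks on which the degree is
    -- constant, with different degrees on different blocks.
    insert-blocks : ∀ (b : ℕ → List V) is → AllPairs _<_ is →
      (∀ {i} → i ∈ₗ is → 0 < length (b i)) →
      (∀ {i u v} → i ∈ₗ is → u ∈ₗ b i → v ∈ₗ b i → len (adj u) ≡ len (adj v)) →
      (∀ {i j u v} → i ∈ₗ is → j ∈ₗ is → i < j → u ∈ₗ b i → v ∈ₗ b j → len (adj u) ≢ len (adj v)) →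
      foldr insert [] (map tag (concatMap b is)) ≡ map (λ i → firstDegree (b i) , b i) is
    insert-blocks b []       _           _     _    _    = refl
    insert-blocks b (i ∷ is) (i< ∷ inc) inhab same diff with b i in eq | inhab (here refl)
    ... | u ∷ l | _ = begin
        foldr insert [] (map tag (u ∷ l ++ concatMap b is))
          ≡⟨ cong (foldr insert []) (map-++ tag (u ∷ l) (concatMap b is)) ⟩
        foldr insert [] (map tag (u ∷ l) ++ map tag (concatMap b is))
          ≡⟨ foldr-++ insert [] (map tag (u ∷ l)) _ ⟩
        foldr insert (foldr insert [] (map tag (concatMap b is))) (map tag (u ∷ l))
          ≡⟨ cong (λ cs → foldr insert cs (map tag (u ∷ l)))
               (insert-blocks b is inc (inhab ∘ there) (same ∘ there) (λ i∈ j∈ → diff (there i∈) (there j∈))) ⟩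
        foldr insert (map (λ i → firstDegree (b i) , b i) is) (map tag (u ∷ l))
          ≡⟨ insert-block u l (λ v∈ → same (here refl) (∈bi v∈) (∈bi (here refl))) (fresh is i< (λ j∈ → inhab (there j∈))
               (λ j∈ i<j → diff (here refl) (there j∈) i<j (∈bi (here refl)))) ⟩
        (len (adj u) , u ∷ l) ∷ map (λ i → firstDegree (b i) , b i) is ∎
      where
      open ≡-Reasoning
      ∈bi : ∀ {v} → v ∈ₗ u ∷ l → v ∈ₗ b i
      ∈bi = subst (_ ∈ₗ_) (sym eq)
      fresh : ∀ {d} js → All (i <_) js → (∀ {j} → j ∈ₗ js → 0 < length (b j)) →
              (∀ {j v} → j ∈ₗ js → i < j → v ∈ₗ b j → d ≢ len (adj v)) →
              Fresh d (map (λ i → firstDegree (b i) , b i) js)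
      fresh []       _          _   _   = _
      fresh (j ∷ js) (i<j ∷ _) inh new with b j in eqj | inh (here refl)
      ... | w ∷ _ | _ = new (here refl) i<j (subst (w ∈ₗ_) (sym eqj) (here refl))

  State : Set
  State = List (List V) × ℕ × ℕ × List ℕ

  -- The clauses follow the two case distinctions on the remaining Y-classes. A single remaining
  -- class marks class k, to which the formula of sum[k] applies.
  sumsStep : State → List V → State
  sumsStep ([] , r) X = [] , r
  sumsStep (Y ∷ [] , a , b , acc) X =
    [] , a + len X , b ∸ len Y , (if len X ≡ᵇ 1 then a + len X + len Y else a + len X) ∷ acc
  sumsStep (Y ∷ Y′ ∷ Ys , a , b , acc) X =
    Y′ ∷ Ys , a + len X , b ∸ len Y , (a + len X + (b ∸ len Y) + 1) ∷ acc

  sums-value : ∀ n₂ X₁ Xs Y₁ Ys → ⟦ sums n₂ (X₁ ∷ Xs) (Y₁ ∷ Ys) ⟧ ≡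
    proj₂ (proj₂ (proj₂ (foldl sumsStep
      (Y₁ ∷ Ys , 0 , n₂ , (if len Y₁ ≡ᵇ 1 then n₂ + len X₁ else n₂) ∷ []) (X₁ ∷ Xs))))
  sums-value n₂ X₁ Xs Y₁ Ys = cong (proj₂ ∘ proj₂ ∘ proj₂)
    (foldl-cong {g = sumsStep}
      (λ { ([] , r) X → refl
         ; (Y ∷ [] , r) X → refl
         ; (Y ∷ _ ∷ _ , r) X → refl })
      (Y₁ ∷ Ys , 0 , n₂ , (if len Y₁ ≡ᵇ 1 then n₂ + len X₁ else n₂) ∷ []) (X₁ ∷ Xs))

  argmax-value : ∀ f m → let i = ⟦ argmax (var (map f (downFrom (suc m)))) ⟧ in
                 i ≤ m × (∀ j → j ≤ m → f j ≤ f i)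
  argmax-value f m = let _ , i≤ , _ , best = loop m in i≤ , best
    where
    step : ℕ → ℕ × ℕ × ℕ → ℕ × ℕ × ℕ
    step t s = proj₁ s + 1 , (if t ≤ᵇ proj₂ (proj₂ s) then proj₂ s else (proj₁ s , t))
    state : ℕ → ℕ × ℕ × ℕ
    state m = foldr step (0 , 0 , 0) (map f (downFrom m))
    Best : ℕ → ℕ × ℕ × ℕ → Set
    Best m (c , i , t) = c ≡ suc m × i ≤ m × t ≡ f i × (∀ j → j ≤ m → f j ≤ f i)
    loop : ∀ m → Best m (state (suc m))
    -- The initial best sum 0 at index 0 is a default. It survives only if `f 0 ≤ 0`, and then it is
    -- the true value.
    loop zero with f 0 ≤? 0
    ... | yes f≤ rewrite dec-true (f 0 ≤? 0) f≤ = refl , z≤n , sym (n≤0⇒n≡0 f≤) , λ { _ z≤n → ≤-refl }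
    ... | no f≰ rewrite dec-false (f 0 ≤? 0) f≰ = refl , z≤n , refl , λ { _ z≤n → ≤-refl }
    -- The state is abstracted to a variable so that the equations of the invariant can be matched
    -- with `refl`.
    loop (suc m) = advance m _ (loop m)
      where
      advance : ∀ m s → Best m s → Best (suc m) (step (f (suc m)) s)
      advance m (_ , i , _) (refl , i≤m , refl , best) with f (suc m) ≤? f i
      ... | yes f≤ rewrite dec-true (f (suc m) ≤? f i) f≤ =
        +-comm (suc m) 1 , m≤n⇒m≤1+n i≤m , refl , λ j j≤ →
          [ (λ j<m → best j (s≤s⁻¹ j<m)) , (λ { refl → f≤ }) ]′ (m≤n⇒m<n∨m≡n j≤)
      ... | no f≰ rewrite dec-false (f (suc m) ≤? f i) f≰ =
        +-comm (suc m) 1 , ≤-refl , refl , λ j j≤ →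
          [ (λ j<m → ≤-trans (best j (s≤s⁻¹ j<m)) (<⇒≤ (≰⇒> f≰))) , (λ { refl → ≤-refl }) ]′ (m≤n⇒m<n∨m≡n j≤)

  append-value : ∀ {A} (l r : List (Val A)) → ⟦ append {A = A} (var l) (var r) ⟧ ≡ l ++ r
  append-value     []      r = refl
  append-value {A} (a ∷ l) r = cong (a ∷_) (append-value {A} l r)

  prepend-value : ∀ {A} (ls : List (List (Val A))) (r : List (Val A)) →
                  ⟦ prepend {A = A} (var ls) (var r) ⟧ ≡ concat (reverse ls) ++ r
  prepend-value     []       r = refl
  prepend-value {A} (l ∷ ls) r = begin
    ⟦ prepend {A = A} (var ls) (append (var l) (var r)) ⟧ ≡⟨ prepend-value {A} ls _ ⟩
    concat (reverse ls) ++ ⟦ append {A = A} (var l) (var r) ⟧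
      ≡⟨ cong (concat (reverse ls) ++_) (append-value {A} l r) ⟩
    concat (reverse ls) ++ l ++ r                     ≡⟨ ++-assoc (concat (reverse ls)) l r ⟨
    (concat (reverse ls) ++ l) ++ r
      ≡⟨ cong (λ l → (concat (reverse ls) ++ l) ++ r) (++-identityʳ l) ⟨
    (concat (reverse ls) ++ concat (l ∷ [])) ++ r     ≡⟨ cong (_++ r) (concat-++ (reverse ls) (l ∷ [])) ⟩
    concat (reverse ls ++ l ∷ []) ++ r                ≡⟨ cong (λ ls → concat ls ++ r) (unfold-reverse l ls) ⟨
    concat (reverse (l ∷ ls)) ++ r                    ∎
    where open ≡-Reasoning

  -- `r` is the prefix in the reversed order in which `split` returns it. The outermost step of the
  -- iteration is the last one, and it moves the head of `r`; hence the induction with that head put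
  -- back on `l`.
  split-value : ∀ {A} (r l : List (Val A)) → ⟦ split (lit (length r)) (var (r ʳ++ l)) ⟧ ≡ (r , l)
  split-value []      l = refl
  split-value {A} (a ∷ r) l rewrite split-value {A} r (a ∷ l) = refl

  build-first : ∀ k X₁ Xs Y₁ Y₂ Ys → ⟦ build 0 k (X₁ ∷ Xs) (Y₁ ∷ Y₂ ∷ Ys) ⟧ ≡
    (if len Y₁ ≡ᵇ 1 then X₁ ++ concat (reverse Ys) ++ Y₁ ++ Y₂ else concat (reverse (Y₁ ∷ Y₂ ∷ Ys)))
  build-first k X₁ Xs Y₁ Y₂ Ys = cong₂ (λ a b → if len Y₁ ≡ᵇ 1 then a else b)
    (trans (append-value {vert} X₁ _) (cong (X₁ ++_) (trans (prepend-value {vert} Ys _)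
      (cong (concat (reverse Ys) ++_) (append-value {vert} Y₁ _)))))
    (trans (prepend-value {vert} (Y₁ ∷ Y₂ ∷ Ys) []) (++-identityʳ _))

  -- The successor form lets the test for i* = 0 compute away.
  build-last : ∀ k {Xs Ys Xₖ Xₖ₋₁ Xr Yₖ Yr} → reverse Xs ≡ Xₖ ∷ Xₖ₋₁ ∷ Xr → reverse Ys ≡ Yₖ ∷ Yr →
    ⟦ build (suc k) (suc k) Xs Ys ⟧ ≡
    (if len Xₖ ≡ᵇ 1 then concat (reverse Xr) ++ Yₖ ++ Xₖ ++ Xₖ₋₁ else concat Xs)
  build-last k {Xs} {Ys} {Xₖ} {Xₖ₋₁} {Xr} {Yₖ} {Yr} eqX eqY = trans
    (if-true (dec-true (suc k ≟ suc k) refl))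
    (trans (case-∷ (reverseᵗ (var Xs)) eqX)
      (cong₂ (λ a b → if len Xₖ ≡ᵇ 1 then a else b)
        (trans (case-∷ (reverseᵗ (var Ys)) eqY)
          (trans (prepend-value {vert} Xr _) (cong (concat (reverse Xr) ++_)
            (trans (append-value {vert} Yₖ _) (cong (Yₖ ++_) (append-value {vert} Xₖ _))))))
        (trans (prepend-value {vert} (reverse Xs) []) (trans (++-identityʳ _)
          (cong concat (reverse-involutive Xs))))))

  build-inner : ∀ i k Xs₁ Xᵢ x Xᵢ₊₁ Xs₂ Ys₁ Ys₂ → suc i ≢ k → length Xs₁ ≡ i → length Ys₁ ≡ suc i →
    ⟦ build (suc i) k (Xs₁ ʳ++ Xᵢ ∷ (x ∷ Xᵢ₊₁) ∷ Xs₂) (Ys₁ ʳ++ Ys₂) ⟧ ≡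
    concat (reverse Xs₁) ++ concat (reverse Ys₂) ++ x ∷ Xᵢ
  build-inner i k Xs₁ Xᵢ x Xᵢ₊₁ Xs₂ Ys₁ Ys₂ i≢k refl eqY
    rewrite dec-false (suc i ≟ k) i≢k
          | split-value {list vert} Xs₁ (Xᵢ ∷ (x ∷ Xᵢ₊₁) ∷ Xs₂) =
    trans (prepend-value {vert} Xs₁ _) (cong (concat (reverse Xs₁) ++_)
      (trans (cong (λ s → ⟦ prepend (var (proj₂ s)) (var x ∷ᵗ var Xᵢ) ⟧)
               (subst (λ m → ⟦ split (lit m) (var (Ys₁ ʳ++ Ys₂)) ⟧ ≡ (Ys₁ , Ys₂)) eqY (split-value {list vert} Ys₁ Ys₂)))
             (prepend-value {vert} Ys₂ (x ∷ Xᵢ))))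

-- The result of the program is an output of the algorithm

module Correctness (B : BipartiteGraph) (O : ChainOrdering B) (T : TwinClasses B)
                   (noIsolated : BipartiteGraph.NoIsolated B) (2≤k : 2 ≤ TwinClasses.k T)
                   (A : AdjacencyLists B) where

  open BipartiteGraph B renaming (sym to N-sym)
  open ChainOrdering O
  open TwinClasses T
  open AdjacencyLists A
  open Algorithm B O T
  open ChainGraph B O T noIsolated 2≤k
  open Run B O A
  open Semantics Vertex
  open Program {Val}
  open ProgramValue Vertex

  Xs Ys : List (List Vertex)
  Xs = map bX (range 1 k)
  Ys = map bY (range 1 k)

  len-adj : ∀ v → len (adj v) ≡ ∣ N v ∣
  len-adj v = trans (len≡length (adj v)) (enumerates-length (enumAdj v))

  -- Neighbourhoods of different classes are strictly nested, hence of different size, so the degree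
  -- recognises open twins.
  classes-X : ⟦ classes (var (map (λ v → v , adj v) xs)) ⟧ ≡ Xs
  classes-X = trans (classes-value (map (λ v → v , adj v) xs)) (trans (cong (map proj₂) groups) (sym (map-∘ (range 1 k))))
    where
    groups : foldr insert [] (map (λ v → v , adj v) xs) ≡ map (λ i → firstDegree adj (bX i) , bX i) (range 1 k)
    groups = trans (cong (foldr insert [] ∘ map (λ v → v , adj v)) (sym upX-all))
      (insert-blocks adj bX (range 1 k) (range-increasing 1 k)
        (λ i∈ → let 1≤i , i≤k = ∈-range⁻ i∈ in ∈-length (∈-listed⁺ (proj₂ (rep-level 1≤i i≤k))))
        (λ {i} {u} {v} i∈ u∈ v∈ → trans (len-adj u) (trans
          (cong ∣_∣ (trans (proj₂ (Xᶜ⁻ {i} (∈-listed⁻ u∈))) (sym (proj₂ (Xᶜ⁻ {i} (∈-listed⁻ v∈)))))) (sym (len-adj v))))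
        λ {i} {j} {u} {v} i∈ j∈ i<j u∈ v∈ eq → <⇒≢ (p⊂q⇒∣p∣<∣q∣ (strict i j (proj₁ (∈-range⁻ i∈)) i<j (proj₂ (∈-range⁻ j∈))))
          (trans (cong ∣_∣ (sym (proj₂ (Xᶜ⁻ {i} (∈-listed⁻ u∈)))))
            (trans (sym (len-adj u)) (trans eq (trans (len-adj v) (cong ∣_∣ (proj₂ (Xᶜ⁻ {j} (∈-listed⁻ v∈)))))))))

  -- Degrees also separate the classes of Y: for i < j the vertex `rep i` is adjacent to Y_i and not
  -- to Y_j, so the neighbourhood shrinks strictly.
  classes-Y : ⟦ classes (var (map (λ v → v , adj v) ys)) ⟧ ≡ Ys
  classes-Y = trans (classes-value (map (λ v → v , adj v) ys)) (trans (cong (map proj₂) groups) (sym (map-∘ (range 1 k))))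
    where
    groups : foldr insert [] (map (λ v → v , adj v) ys) ≡ map (λ i → firstDegree adj (bY i) , bY i) (range 1 k)
    groups = trans (cong (foldr insert [] ∘ map (λ v → v , adj v)) (sym upY-all))
      (insert-blocks adj bY (range 1 k) (range-increasing 1 k)
        (λ i∈ → let 1≤i , i≤k = ∈-range⁻ i∈ in ∈-length (∈-listed⁺ (proj₂ (proj₂ (Yᶜ-nonempty 1≤i i≤k)))))
        (λ {i} {u} {v} i∈ u∈ v∈ →
          let Lu = ∈-range⁻ i∈ , ∈-listed⁻ u∈ ; Lv = ∈-range⁻ i∈ , ∈-listed⁻ v∈ in
          trans (len-adj u) (trans
            (cong ∣_∣ (⊆-antisym (N-anti-Y Lv Lu ≤-refl) (N-anti-Y Lu Lv ≤-refl))) (sym (len-adj v))))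
        λ {i} {j} {u} {v} i∈ j∈ i<j u∈ v∈ eq →
          let Lu = ∈-range⁻ i∈ , ∈-listed⁻ u∈
              Lv = ∈-range⁻ j∈ , ∈-listed⁻ v∈
              R  = rep-level (proj₁ (∈-range⁻ i∈)) (proj₂ (∈-range⁻ i∈))
          in <⇒≢ (p⊂q⇒∣p∣<∣q∣ (N-anti-Y Lu Lv (<⇒≤ i<j) , rep i , N-sym (adjacent⁺ R Lu ≤-refl) ,
                    λ rep∈ → <⇒≱ i<j (adjacent⁻ R Lv (N-sym rep∈))))
                 (trans (sym (len-adj v)) (trans (sym eq) (len-adj u))))

  len-bX : ∀ i → len (bX i) ≡ ∣ Xᶜ i ∣
  len-bX i = trans (len≡length (bX i)) (length-listed (Xᶜ i))

  len-bY : ∀ i → len (bY i) ≡ ∣ Yᶜ i ∣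
  len-bY i = trans (len≡length (bY i)) (length-listed (Yᶜ i))

  -- The displayed state is the loop invariant after `c` classes, with `m` classes to come.
  sums-loop : ∀ m c → c + m ≡ k →
    proj₂ (proj₂ (proj₂ (foldl sumsStep
      (map bY (seg (suc c) m) , sizeX 1 c , n₂ ∸ sizeY 1 c , map total (downFrom (suc c)))
      (map bX (seg (suc c) m)))))
    ≡ map total (downFrom (suc k))
  sums-loop zero c eq = cong (map total ∘ downFrom ∘ suc) (trans (sym (+-identityʳ c)) eq)
  sums-loop (suc m) c eq = trans
    (cong (λ s → proj₂ (proj₂ (proj₂ (foldl sumsStep s (map bX (seg (2 + c) m)))))) (step m eq))
    (sums-loop m (suc c) (trans (sym (+-suc c m)) eq))
    where
    open ≡-Reasoning
    a≡ : sizeX 1 c + len (bX (suc c)) ≡ sizeX 1 (suc c)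
    a≡ = trans (cong (sizeX 1 c +_) (len-bX (suc c))) (sym (sizeX-∷ʳ c))
    b≡ : n₂ ∸ sizeY 1 c ∸ len (bY (suc c)) ≡ n₂ ∸ sizeY 1 (suc c)
    b≡ = trans (∸-+-assoc n₂ (sizeY 1 c) _)
      (cong (n₂ ∸_) (trans (cong (sizeY 1 c +_) (len-bY (suc c))) (sym (sizeY-∷ʳ c))))
    last : suc c ≡ k → (if len (bX (suc c)) ≡ᵇ 1 then sizeX 1 c + len (bX (suc c)) + len (bY (suc c))
                                                  else sizeX 1 c + len (bX (suc c))) ≡ total (suc c)
    last eq = begin
      (if len (bX (suc c)) ≡ᵇ 1 then sizeX 1 c + len (bX (suc c)) + len (bY (suc c)) else sizeX 1 c + len (bX (suc c)))
        ≡⟨ cong₂ (λ a y → if len (bX (suc c)) ≡ᵇ 1 then a + y else a) a≡ (len-bY (suc c)) ⟩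
      (if len (bX (suc c)) ≡ᵇ 1 then sizeX 1 (suc c) + ∣ Yᶜ (suc c) ∣ else sizeX 1 (suc c))
        ≡⟨ cong (λ l → if l ≡ᵇ 1 then sizeX 1 (suc c) + ∣ Yᶜ (suc c) ∣ else sizeX 1 (suc c)) (len-bX (suc c)) ⟩
      (if ∣ Xᶜ (suc c) ∣ ≡ᵇ 1 then sizeX 1 (suc c) + ∣ Yᶜ (suc c) ∣ else sizeX 1 (suc c))
        ≡⟨ cong (λ j → if ∣ Xᶜ j ∣ ≡ᵇ 1 then sizeX 1 j + ∣ Yᶜ j ∣ else sizeX 1 j) eq ⟩
      (if ∣ Xᶜ k ∣ ≡ᵇ 1 then sizeX 1 k + ∣ Yᶜ k ∣ else sizeX 1 k)
        ≡⟨ cong (λ a → if ∣ Xᶜ k ∣ ≡ᵇ 1 then a + ∣ Yᶜ k ∣ else a) sizeX-all ⟩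
      (if ∣ Xᶜ k ∣ ≡ᵇ 1 then n₁ + ∣ Yᶜ k ∣ else n₁)
        ≡⟨ total-k eq ⟨
      total (suc c) ∎
    step : ∀ m → c + suc m ≡ k →
      sumsStep (map bY (seg (suc c) (suc m)) , sizeX 1 c , n₂ ∸ sizeY 1 c , map total (downFrom (suc c))) (bX (suc c))
      ≡ (map bY (seg (2 + c) m) , sizeX 1 (suc c) , n₂ ∸ sizeY 1 (suc c) , map total (downFrom (2 + c)))
    step zero eq = cong₂ (λ r t → [] , r , t)
      a≡ (cong₂ (λ b t → b , t ∷ map total (downFrom (suc c))) b≡ (last (trans (+-comm 1 c) eq)))
    -- Another class remains, so `suc c < k` and the formula for inner totals applies.
    step (suc m) eq = cong₂ (λ a r → map bY (seg (2 + c) (suc m)) , a , r)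
      a≡ (cong₂ (λ b t → b , t ∷ map total (downFrom (suc c))) b≡
        (trans (cong₂ (λ a b → a + b + 1) a≡ b≡) (sym (total-inner
          (subst (suc (suc c) ≤_) (trans (cong suc (sym (+-suc c m))) (trans (sym (+-suc c (suc m))) eq)) (s≤s (s≤s (m≤m+n c m))))))))

  Xs-∷ : Xs ≡ bX 1 ∷ map bX (range 2 k)
  Xs-∷ = cong (map bX) (range-∷ 1≤k)

  Ys-∷ : Ys ≡ bY 1 ∷ bY 2 ∷ map bY (range 3 k)
  Ys-∷ = cong (map bY) (trans (range-∷ 1≤k) (cong (1 ∷_) (range-∷ 2≤k)))

  sums-total : ⟦ sums n₂ Xs Ys ⟧ ≡ map total (downFrom (suc k))
  sums-total = begin
    ⟦ sums n₂ Xs Ys ⟧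
      ≡⟨ cong₂ (λ Xs Ys → ⟦ sums n₂ Xs Ys ⟧) Xs-∷ Ys-∷ ⟩
    ⟦ sums n₂ (bX 1 ∷ map bX (range 2 k)) (bY 1 ∷ bY 2 ∷ map bY (range 3 k)) ⟧
      ≡⟨ sums-value n₂ (bX 1) (map bX (range 2 k)) (bY 1) (bY 2 ∷ map bY (range 3 k)) ⟩
    fourth (foldl sumsStep (bY 1 ∷ bY 2 ∷ map bY (range 3 k) , 0 , n₂ ,
      (if len (bY 1) ≡ᵇ 1 then n₂ + len (bX 1) else n₂) ∷ []) (bX 1 ∷ map bX (range 2 k)))
      ≡⟨ cong₂ (λ l m → fourth (foldl sumsStep (bY 1 ∷ bY 2 ∷ map bY (range 3 k) , 0 , n₂ ,
           (if l ≡ᵇ 1 then n₂ + m else n₂) ∷ []) (bX 1 ∷ map bX (range 2 k)))) (len-bY 1) (len-bX 1) ⟩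
    fourth (foldl sumsStep (bY 1 ∷ bY 2 ∷ map bY (range 3 k) , 0 , n₂ , total 0 ∷ []) (bX 1 ∷ map bX (range 2 k)))
      ≡⟨ cong₂ (λ Xs Ys → fourth (foldl sumsStep (Ys , 0 , n₂ , total 0 ∷ []) Xs)) Xs-seg Ys-seg ⟩
    fourth (foldl sumsStep (map bY (seg 1 k) , 0 , n₂ , total 0 ∷ []) (map bX (seg 1 k)))
      ≡⟨ sums-loop k 0 refl ⟩
    map total (downFrom (suc k)) ∎
    where
    open ≡-Reasoning
    fourth : State → List ℕ
    fourth (_ , _ , _ , acc) = acc
    Xs-seg : bX 1 ∷ map bX (range 2 k) ≡ map bX (seg 1 k)
    Xs-seg = trans (sym Xs-∷) (cong (map bX) (range≡seg 1 k))
    Ys-seg : bY 1 ∷ bY 2 ∷ map bY (range 3 k) ≡ map bY (seg 1 k)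
    Ys-seg = trans (sym Ys-∷) (cong (map bY) (range≡seg 1 k))

  best : ℕ
  best = ⟦ argmax (sums n₂ Xs Ys) ⟧

  best-isBest : IsBest best
  best-isBest = subst IsBest (cong (λ l → ⟦ argmax (var l) ⟧) (sym sums-total)) (argmax-value total k)

  result≡ : result ≡ ⟦ build best k Xs Ys ⟧
  result≡ = begin
    result
      ≡⟨ cong₂ (λ Xs Ys → ⟦ build ⟦ argmax (sums ℓ Xs Ys) ⟧ (len Xs) Xs Ys ⟧) classes-X classes-Y ⟩
    ⟦ build ⟦ argmax (sums ℓ Xs Ys) ⟧ (len Xs) Xs Ys ⟧
      ≡⟨ cong₂ (λ ℓ m → ⟦ build ⟦ argmax (sums ℓ Xs Ys) ⟧ m Xs Ys ⟧) ℓ≡ len-Xs ⟩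
    ⟦ build best k Xs Ys ⟧ ∎
    where
    open ≡-Reasoning
    ℓ : ℕ
    ℓ = len (map (λ v → v , adj v) ys)
    ℓ≡ : ℓ ≡ n₂
    ℓ≡ = trans (len≡length (map (λ v → v , adj v) ys)) (trans (length-map _ ys) length-ys)
    len-Xs : len Xs ≡ k
    len-Xs = trans (len≡length Xs) (trans (length-map bX (range 1 k))
      (trans (length-map (1 +_) (upTo k)) (length-upTo k)))

  concat-reverse : ∀ (f : ℕ → List Vertex) l → concat (reverse (map f l)) ≡ concatMap f (reverse l)
  concat-reverse f l = cong concat (sym (reverse-map f l))

  returns-first : Returns 0 ⟦ build 0 k Xs Ys ⟧
  returns-first = subst (Returns 0) (sym value) ret
    where
    S : List Vertex
    S = bX 1 ++ downY k 3 ++ bY 1 ++ bY 2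
    value : ⟦ build 0 k Xs Ys ⟧ ≡ (if ∣ Yᶜ 1 ∣ ≡ᵇ 1 then S else downY k 1)
    value = trans (cong₂ (λ Xs Ys → ⟦ build 0 k Xs Ys ⟧) Xs-∷ Ys-∷)
      (trans (build-first k (bX 1) (map bX (range 2 k)) (bY 1) (bY 2) (map bY (range 3 k)))
      (trans (cong (λ l → if l ≡ᵇ 1 then bX 1 ++ concat (reverse (map bY (range 3 k))) ++ bY 1 ++ bY 2
                                    else concat (reverse (bY 1 ∷ bY 2 ∷ map bY (range 3 k)))) (len-bY 1))
        (cong₂ (λ s t → if ∣ Yᶜ 1 ∣ ≡ᵇ 1 then bX 1 ++ s ++ bY 1 ++ bY 2 else t)
          (concat-reverse bY (range 3 k))
          (trans (cong (concat ∘ reverse) (sym Ys-∷)) (concat-reverse bY (range 1 k))))))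
    ret : Returns 0 (if ∣ Yᶜ 1 ∣ ≡ᵇ 1 then S else downY k 1)
    ret with ∣ Yᶜ 1 ∣ ≟ 1
    -- Y_1 is nonempty, so a size other than 1 exceeds 1, as case (i) demands.
    ... | no neq = subst (Returns 0) (sym (if-false (dec-false (∣ Yᶜ 1 ∣ ≟ 1) neq)))
      (i- (≤∧≢⇒< (subst (1 ≤_) (length-listed (Yᶜ 1))
        (∈-length (∈-listed⁺ (proj₂ (proj₂ (Yᶜ-nonempty ≤-refl 1≤k)))))) (neq ∘ sym)))
    ... | yes eq = subst (Returns 0) (sym (if-true (dec-true (∣ Yᶜ 1 ∣ ≟ 1) eq))) ret′
      where
      ret′ : Returns 0 S
      -- The program has one branch for both forms of case (ii): at k = 2 the middle block is empty.
      ret′ with m≤n⇒m<n∨m≡n 2≤k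
      ... | inj₁ 3≤k = ii-≥3 eq 3≤k
      ... | inj₂ 2≡k = subst (Returns 0)
        (cong (λ l → bX 1 ++ concatMap bY (reverse l) ++ bY 1 ++ bY 2) (sym (range-empty (≤-reflexive (cong suc (sym 2≡k))))))
        (ii-2 eq (sym 2≡k))

  returns-last : Returns k ⟦ build k k Xs Ys ⟧
  returns-last = subst (Returns k) (sym value) ret
    where
    m = k ∸ 2
    k≡ : 2 + m ≡ k
    k≡ = m+[n∸m]≡n 2≤k
    k-1≡ : suc m ≡ k ∸ 1
    k-1≡ = sym (+-∸-assoc 1 2≤k)
    reverse-range : ∀ b → reverse (range 1 (suc b)) ≡ suc b ∷ reverse (range 1 b)
    reverse-range b = trans (cong reverse (range-∷ʳ {1} {b} (s≤s z≤n))) (reverse-++ (range 1 b) (suc b ∷ []))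
    reverse-Xs : reverse Xs ≡ bX (2 + m) ∷ bX (suc m) ∷ map bX (reverse (range 1 m))
    reverse-Xs = trans (sym (reverse-map bX (range 1 k))) (cong (map bX)
      (trans (cong (reverse ∘ range 1) (sym k≡)) (trans (reverse-range (suc m)) (cong (2 + m ∷_) (reverse-range m)))))
    reverse-Ys : reverse Ys ≡ bY (2 + m) ∷ map bY (reverse (range 1 (suc m)))
    reverse-Ys = trans (sym (reverse-map bY (range 1 k))) (cong (map bY)
      (trans (cong (reverse ∘ range 1) (sym k≡)) (reverse-range (suc m))))
    S : List Vertex
    S = upX 1 m ++ bY k ++ bX k ++ bX (k ∸ 1)
    value : ⟦ build k k Xs Ys ⟧ ≡ (if ∣ Xᶜ k ∣ ≡ᵇ 1 then S else upX 1 k)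
    value = begin
      ⟦ build k k Xs Ys ⟧
        ≡⟨ cong (λ k → ⟦ build k k Xs Ys ⟧) k≡ ⟨
      ⟦ build (2 + m) (2 + m) Xs Ys ⟧
        ≡⟨ build-last (suc m) reverse-Xs reverse-Ys ⟩
      (if len (bX (2 + m)) ≡ᵇ 1
        then concat (reverse (map bX (reverse (range 1 m)))) ++ bY (2 + m) ++ bX (2 + m) ++ bX (suc m) else upX 1 k)
        ≡⟨ cong₂ (λ l s → if l ≡ᵇ 1 then s ++ bY (2 + m) ++ bX (2 + m) ++ bX (suc m) else upX 1 k) (len-bX (2 + m))
             (trans (concat-reverse bX (reverse (range 1 m))) (cong (concatMap bX) (reverse-involutive (range 1 m)))) ⟩
      (if ∣ Xᶜ (2 + m) ∣ ≡ᵇ 1 then upX 1 m ++ bY (2 + m) ++ bX (2 + m) ++ bX (suc m) else upX 1 k)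
        ≡⟨ cong₂ (λ i j → if ∣ Xᶜ i ∣ ≡ᵇ 1 then upX 1 m ++ bY i ++ bX i ++ bX j else upX 1 k) k≡ k-1≡ ⟩
      (if ∣ Xᶜ k ∣ ≡ᵇ 1 then S else upX 1 k) ∎
      where open ≡-Reasoning
    ret : Returns k (if ∣ Xᶜ k ∣ ≡ᵇ 1 then S else upX 1 k)
    ret with ∣ Xᶜ k ∣ ≟ 1
    ... | no neq = subst (Returns k) (sym (if-false (dec-false (∣ Xᶜ k ∣ ≟ 1) neq)))
      (iii- (≤∧≢⇒< (subst (1 ≤_) (length-listed (Xᶜ k))
        (∈-length (∈-listed⁺ (proj₂ (rep-level 1≤k ≤-refl))))) (neq ∘ sym)))
    ... | yes eq = subst (Returns k) (sym (if-true (dec-true (∣ Xᶜ k ∣ ≟ 1) eq))) ret′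
      where
      ret′ : Returns k S
      ret′ with m≤n⇒m<n∨m≡n 2≤k
      ... | inj₁ 3≤k = iv-≥3 eq 3≤k
      ... | inj₂ 2≡k = subst (Returns k)
        (cong₂ (λ b (i , j) → upX 1 b ++ bY i ++ bX i ++ bX j)
          (cong (_∸ 2) 2≡k) (cong₂ _,_ 2≡k (cong (_∸ 1) 2≡k)))
        (iv-2 eq (sym 2≡k))

  -- The program chooses for x the first listed vertex of the class above i*. That class contains
  -- its representative, so the empty branch cannot occur.
  returns-inner : ∀ i → suc i < k → Returns (suc i) ⟦ build (suc i) k Xs Ys ⟧
  returns-inner i i<k with bX (2 + i) in eq | ∈-listed⁺ (proj₂ (rep-level (s≤s z≤n) i<k))
  ... | []    | ()
  ... | x ∷ l | _ = subst (Returns (suc i)) (sym value) (ret i i<k x∈)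
    where
    x∈ : x ∈ Xᶜ (2 + i)
    x∈ = ∈-listed⁻ (subst (x ∈ₗ_) (sym eq) (here refl))
    ret : ∀ i → suc i < k → x ∈ Xᶜ (2 + i) → Returns (suc i) (upX 1 i ++ downY k (2 + i) ++ x ∷ bX (suc i))
    ret zero    i<k x∈ = v-1 (∸-monoˡ-≤ 1 2≤k) x∈
    ret (suc i) i<k x∈ = v->1 (s≤s (s≤s z≤n)) (∸-monoˡ-≤ 1 i<k) x∈
    Xs≡ : Xs ≡ reverse (map bX (range 1 i)) ʳ++ bX (suc i) ∷ (x ∷ l) ∷ map bX (range (3 + i) k)
    Xs≡ = begin
      map bX (range 1 k)
        ≡⟨ cong (map bX) (range-++ (s≤s z≤n) (<⇒≤ (<⇒≤ i<k))) ⟩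
      map bX (range 1 i ++ range (suc i) k)
        ≡⟨ map-++ bX (range 1 i) _ ⟩
      map bX (range 1 i) ++ map bX (range (suc i) k)
        ≡⟨ cong (λ r → map bX (range 1 i) ++ map bX r) (trans (range-∷ (<⇒≤ i<k)) (cong (suc i ∷_) (range-∷ i<k))) ⟩
      map bX (range 1 i) ++ bX (suc i) ∷ bX (2 + i) ∷ map bX (range (3 + i) k)
        ≡⟨ cong₂ (λ r b → r ++ bX (suc i) ∷ b ∷ map bX (range (3 + i) k)) (sym (reverse-involutive (map bX (range 1 i)))) eq ⟩
      reverse (reverse (map bX (range 1 i))) ++ bX (suc i) ∷ (x ∷ l) ∷ map bX (range (3 + i) k)
        ≡⟨ ʳ++-defn (reverse (map bX (range 1 i))) ⟨
      reverse (map bX (range 1 i)) ʳ++ bX (suc i) ∷ (x ∷ l) ∷ map bX (range (3 + i) k) ∎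
      where open ≡-Reasoning
    Ys≡ : Ys ≡ reverse (map bY (range 1 (suc i))) ʳ++ map bY (range (2 + i) k)
    Ys≡ = begin
      map bY (range 1 k)
        ≡⟨ cong (map bY) (range-++ (s≤s z≤n) (<⇒≤ i<k)) ⟩
      map bY (range 1 (suc i) ++ range (2 + i) k)
        ≡⟨ map-++ bY (range 1 (suc i)) _ ⟩
      map bY (range 1 (suc i)) ++ map bY (range (2 + i) k)
        ≡⟨ cong (_++ map bY (range (2 + i) k)) (reverse-involutive (map bY (range 1 (suc i)))) ⟨
      reverse (reverse (map bY (range 1 (suc i)))) ++ map bY (range (2 + i) k)
        ≡⟨ ʳ++-defn (reverse (map bY (range 1 (suc i)))) ⟨
      reverse (map bY (range 1 (suc i))) ʳ++ map bY (range (2 + i) k) ∎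
      where open ≡-Reasoning
    length-blocks : ∀ (f : ℕ → List Vertex) b → length (reverse (map f (range 1 b))) ≡ b
    length-blocks f b = trans (length-reverse (map f (range 1 b))) (trans (length-map f (range 1 b))
      (trans (length-map (1 +_) (upTo b)) (length-upTo b)))
    value : ⟦ build (suc i) k Xs Ys ⟧ ≡ upX 1 i ++ downY k (2 + i) ++ x ∷ bX (suc i)
    value = begin
      ⟦ build (suc i) k Xs Ys ⟧
        ≡⟨ cong₂ (λ Xs Ys → ⟦ build (suc i) k Xs Ys ⟧) Xs≡ Ys≡ ⟩
      ⟦ build (suc i) k (reverse (map bX (range 1 i)) ʳ++ bX (suc i) ∷ (x ∷ l) ∷ map bX (range (3 + i) k))
                        (reverse (map bY (range 1 (suc i))) ʳ++ map bY (range (2 + i) k)) ⟧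
        ≡⟨ build-inner i k (reverse (map bX (range 1 i))) (bX (suc i)) x l (map bX (range (3 + i) k))
             (reverse (map bY (range 1 (suc i)))) (map bY (range (2 + i) k)) (<⇒≢ i<k)
             (length-blocks bX i) (length-blocks bY (suc i)) ⟩
      concat (reverse (reverse (map bX (range 1 i)))) ++ concat (reverse (map bY (range (2 + i) k))) ++ x ∷ bX (suc i)
        ≡⟨ cong₂ (λ a b → concat a ++ b ++ x ∷ bX (suc i)) (reverse-involutive (map bX (range 1 i)))
             (concat-reverse bY (range (2 + i) k)) ⟩
      upX 1 i ++ downY k (2 + i) ++ x ∷ bX (suc i) ∎
      where open ≡-Reasoning

  returns-build : ∀ i → i ≤ k → Returns i ⟦ build i k Xs Ys ⟧
  returns-build zero    _   = returns-first
  returns-build (suc i) i≤k with m≤n⇒m<n∨m≡n i≤k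
  ... | inj₁ i<k = returns-inner i i<k
  ... | inj₂ i≡k = subst (λ j → Returns j ⟦ build j k Xs Ys ⟧) (sym i≡k) returns-last

  result-output : Output result
  result-output = best , best-isBest , subst (Returns best) (sym result≡) (returns-build best (proj₁ best-isBest))

-- Running time

module Cost (V : Set) where
  open Semantics V
  open Program {Val}
  open ProgramValue V

  -- Indexing the bound by the term makes the combinators below syntax-directed,
  -- so that Agda infers the constants.
  record Takes (s c : ℕ) {A : Ty} (e : Tm Val A) : Set where
    constructor takes
    field bound : time e ≤ c * suc s
  open Takes

  module _ {s : ℕ} where

    -- The unit charged by a construct is absorbed by one more multiple of `suc s`, which is
    -- positive even at size 0.
    ≤-suc : ∀ {t} c → t ≤ c * suc s → suc t ≤ suc c * suc s
    ≤-suc _ t≤ = +-mono-≤ (s≤s z≤n) t≤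

    ≤-+ : ∀ {t t′} c c′ → t ≤ c * suc s → t′ ≤ c′ * suc s → t + t′ ≤ (c + c′) * suc s
    ≤-+ c c′ t≤ t′≤ = ≤-trans (+-mono-≤ t≤ t′≤) (≤-reflexive (sym (*-distribʳ-+ (suc s) c c′)))

    ≤-if : ∀ b {t t′} c c′ → t ≤ c * suc s → t′ ≤ c′ * suc s → (if b then t else t′) ≤ (c + c′) * suc s
    ≤-if true  c c′ t≤ _  = ≤-trans t≤ (*-monoˡ-≤ (suc s) (m≤m+n c c′))
    ≤-if false c c′ _ t′≤ = ≤-trans t′≤ (*-monoˡ-≤ (suc s) (m≤n+m c′ c))

    private
      binary : ∀ {c c′ A B} {d : Tm Val A} {e : Tm Val B} → Takes s c d → Takes s c′ e →
               1 + time d + time e ≤ suc (c + c′) * suc s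
      binary {c} {c′} (takes p) (takes q) = ≤-suc (c + c′) (≤-+ c c′ p q)

    varᶜ : ∀ {A} {a : Val A} → Takes s 1 (var a)
    varᶜ = takes (s≤s z≤n)

    litᶜ : ∀ {m} → Takes s 1 (lit m)
    litᶜ = takes (s≤s z≤n)

    []ᶜ : ∀ {A} → Takes s 1 ([]ᵗ {A = A})
    []ᶜ = takes (s≤s z≤n)

    letᶜ : ∀ {A B c c′} {e : Tm Val A} {f : Val A → Tm Val B} →
           Takes s c e → Takes s c′ (f ⟦ e ⟧) → Takes s (suc (c + c′)) (letᵗ e f)
    letᶜ p q = takes (binary p q)

    infixl 6 _+ᶜ_ _∸ᶜ_
    infixr 5 _∷ᶜ_
    infixr 4 _,ᶜ_

    _+ᶜ_ : ∀ {c c′ d e} → Takes s c d → Takes s c′ e → Takes s (suc (c + c′)) (d +ᵗ e)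
    p +ᶜ q = takes (binary p q)

    _∸ᶜ_ : ∀ {c c′ d e} → Takes s c d → Takes s c′ e → Takes s (suc (c + c′)) (d ∸ᵗ e)
    p ∸ᶜ q = takes (binary p q)

    _,ᶜ_ : ∀ {A B c c′} {d : Tm Val A} {e : Tm Val B} →
           Takes s c d → Takes s c′ e → Takes s (suc (c + c′)) (d ,ᵗ e)
    p ,ᶜ q = takes (binary p q)

    _∷ᶜ_ : ∀ {A c c′} {d : Tm Val A} {e : Tm Val (list A)} →
           Takes s c d → Takes s c′ e → Takes s (suc (c + c′)) (d ∷ᵗ e)
    p ∷ᶜ q = takes (binary p q)

    fstᶜ : ∀ {A B c} {e : Tm Val (A ⊗ B)} → Takes s c e → Takes s (suc c) (fst e)
    fstᶜ {c = c} (takes p) = takes (≤-suc c p)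

    sndᶜ : ∀ {A B c} {e : Tm Val (A ⊗ B)} → Takes s c e → Takes s (suc c) (snd e)
    sndᶜ {c = c} (takes p) = takes (≤-suc c p)

    if-eqᶜ : ∀ {A c c′ a b d e} {t u : Tm Val A} → Takes s c d → Takes s c′ e → Takes s a t → Takes s b u →
             Takes s (suc (c + c′) + (a + b)) (if-eq d e t u)
    if-eqᶜ {c = c} {c′} {a} {b} {d} {e} p q (takes r) (takes r′) =
      takes (≤-+ (suc (c + c′)) (a + b) (binary p q) (≤-if (⟦ d ⟧ ≡ᵇ ⟦ e ⟧) a b r r′))

    if-leᶜ : ∀ {A c c′ a b d e} {t u : Tm Val A} → Takes s c d → Takes s c′ e → Takes s a t → Takes s b u →
             Takes s (suc (c + c′) + (a + b)) (if-le d e t u)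
    if-leᶜ {c = c} {c′} {a} {b} {d} {e} p q (takes r) (takes r′) =
      takes (≤-+ (suc (c + c′)) (a + b) (binary p q) (≤-if (⟦ d ⟧ ≤ᵇ ⟦ e ⟧) a b r r′))

    -- The branch receives the equation of the scrutinee, through which sizes of `h` and `l` can be
    -- bounded.
    caseᶜ : ∀ {A B c a b} {e : Tm Val (list A)} {t : Tm Val B} {f} → Takes s c e → Takes s a t →
            (∀ h l → ⟦ e ⟧ ≡ h ∷ l → Takes s b (f h l)) → Takes s (suc c + (a + b)) (caseᵗ e t f)
    caseᶜ {c = c} {a} {b} {e} {t} {f} (takes p) (takes q) r = takes (split-on r)
      where
      split-on : (∀ h l → ⟦ e ⟧ ≡ h ∷ l → Takes s b (f h l)) → time (caseᵗ e t f) ≤ (suc c + (a + b)) * suc s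
      split-on r with ⟦ e ⟧ | r
      ... | []    | _ = ≤-+ (suc c) (a + b) (≤-suc c p) (≤-trans q (*-monoˡ-≤ (suc s) (m≤m+n a b)))
      ... | h ∷ l | r = ≤-+ (suc c) (a + b) (≤-suc c p) (≤-trans (bound (r h l refl)) (*-monoˡ-≤ (suc s) (m≤n+m b a)))

  -- The additional unit per element pays for the iteration, so one quantity bounds both the length
  -- and the total size.
  ∑ : ∀ {A : Set} → (A → ℕ) → List A → ℕ
  ∑ size l = sum (map (λ a → suc (size a)) l)

  private
    one-step : ∀ d w t {c C} → c ≤ d * suc w → C ≤ suc d * t → suc c + C ≤ suc d * (suc w + t)
    one-step d w t {c} {C} c≤ C≤ = begin
      suc c + C                   ≤⟨ +-mono-≤ (≤-suc d c≤) C≤ ⟩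
      suc d * suc w + suc d * t   ≡⟨ *-distribˡ-+ (suc d) (suc w) t ⟨
      suc d * (suc w + t)         ∎
      where open ≤-Reasoning

  foldrCost-bound : ∀ {A B : Set} {step : A → B → B} {cost : A → B → ℕ} {b} (size : A → ℕ) d l →
    (∀ a acc → cost a acc ≤ d * suc (size a)) → foldrCost step cost b l ≤ suc d * ∑ size l
  foldrCost-bound size d []      _ = z≤n
  foldrCost-bound size d (a ∷ l) p = one-step d (size a) (∑ size l) (p a _) (foldrCost-bound size d l p)

  -- Φ is the potential of the accumulator; δ is the part of it released by a step.
  foldlCost-bound : ∀ {A B : Set} {step : B → A → B} {cost : B → A → ℕ} (size : A → ℕ) (Φ δ : B → ℕ) d b l →
    (∀ a acc → cost acc a ≤ d * suc (size a + δ acc)) → (∀ a acc → δ acc + Φ (step acc a) ≤ Φ acc) →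
    foldlCost step cost b l ≤ suc d * (∑ size l + Φ b)
  foldlCost-bound size Φ δ d b [] _ _ = z≤n
  foldlCost-bound {step = step} {cost} size Φ δ d b (a ∷ l) p q = begin
    suc (cost b a) + foldlCost step cost (step b a) l
      ≤⟨ one-step d (size a + δ b) (∑ size l + Φ (step b a)) (p a b) (foldlCost-bound size Φ δ d (step b a) l p q) ⟩
    suc d * (suc (size a + δ b) + (∑ size l + Φ (step b a)))
      ≡⟨ cong (suc d *_) (arith (size a) (δ b) (∑ size l) (Φ (step b a))) ⟩
    suc d * (suc (size a) + ∑ size l + (δ b + Φ (step b a)))
      ≤⟨ *-monoʳ-≤ (suc d) (+-monoʳ-≤ (suc (size a) + ∑ size l) (q a b)) ⟩
    suc d * (suc (size a) + ∑ size l + Φ b) ∎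
    where
    open ≤-Reasoning
    arith : ∀ w x y z → suc (w + x) + (y + z) ≡ suc w + y + (x + z)
    arith = solve-∀

  repeatCost-bound : ∀ {B : Set} {step : B → B} {cost : B → ℕ} {b} d m →
    (∀ acc → cost acc ≤ d * 1) → repeatCost step cost b m ≤ suc d * m
  repeatCost-bound d zero    _ = z≤n
  repeatCost-bound {step = step} {cost} {b} d (suc m) p =
    one-step d 0 m (p _) (repeatCost-bound {step = step} {cost} {b} d m p)

  module _ {s : ℕ} where

    private
      loop : ∀ {c c′ A B C t} d {e : Tm Val A} {b : Tm Val B} → Takes s c e → Takes s c′ b →
             C ≤ suc d * t → t ≤ suc s → 1 + time e + time b + C ≤ (suc (c + c′) + suc d) * suc s
      loop {c} {c′} d (takes p) (takes q) C≤ t≤ =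
        ≤-+ (suc (c + c′)) (suc d) (≤-suc (c + c′) (≤-+ c c′ p q)) (≤-trans C≤ (*-monoʳ-≤ (suc d) t≤))

    foldʳᶜ : ∀ {A B c c′ d} {e : Tm Val (list A)} {b : Tm Val B} {f} (size : Val A → ℕ) →
      Takes s c e → Takes s c′ b → (∀ a acc → Takes (size a) d (f a acc)) → ∑ size ⟦ e ⟧ ≤ suc s →
      Takes s (suc (c + c′) + suc d) (foldʳ e b f)
    foldʳᶜ {d = d} {e} size p q r ≤s =
      takes (loop d p q (foldrCost-bound size d ⟦ e ⟧ λ a acc → bound (r a acc)) ≤s)

    foldˡ-potential : ∀ {A B c c′ d} {e : Tm Val (list A)} {b : Tm Val B} {f} (size : Val A → ℕ) (Φ δ : Val B → ℕ) →
      Takes s c e → Takes s c′ b → (∀ a acc → Takes (size a + δ acc) d (f a acc)) →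
      (∀ a acc → δ acc + Φ ⟦ f a acc ⟧ ≤ Φ acc) → ∑ size ⟦ e ⟧ + Φ ⟦ b ⟧ ≤ suc s →
      Takes s (suc (c + c′) + suc d) (foldˡ e b f)
    foldˡ-potential {d = d} {e} {b} size Φ δ p q r release ≤s =
      takes (loop d p q (foldlCost-bound size Φ δ d ⟦ b ⟧ ⟦ e ⟧ (λ a acc → bound (r a acc)) release) ≤s)

    foldˡᶜ : ∀ {A B c c′ d} {e : Tm Val (list A)} {b : Tm Val B} {f} (size : Val A → ℕ) →
      Takes s c e → Takes s c′ b → (∀ a acc → Takes (size a) d (f a acc)) → ∑ size ⟦ e ⟧ ≤ suc s →
      Takes s (suc (c + c′) + suc d) (foldˡ e b f)
    foldˡᶜ {d = d} {e} {f = f} size p q r ≤s = foldˡ-potential size (λ _ → 0) (λ _ → 0) p q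
      (λ a acc → subst (λ s → Takes s d (f a acc)) (sym (+-identityʳ (size a))) (r a acc))
      (λ _ _ → z≤n) (subst (_≤ suc s) (sym (+-identityʳ (∑ size ⟦ e ⟧))) ≤s)

    repeatᶜ : ∀ {B c c′ d e} {b : Tm Val B} {f} → Takes s c e → Takes s c′ b →
      (∀ acc → Takes 0 d (f acc)) → ⟦ e ⟧ ≤ s → Takes s (suc (c + c′) + suc d) (repeatᵗ e b f)
    repeatᶜ {d = d} {e} {b} {f} p q r ≤s =
      takes (loop d p q (repeatCost-bound {step = λ acc → ⟦ f acc ⟧} {λ acc → time (f acc)} {⟦ b ⟧} d ⟦ e ⟧
        λ acc → bound (r acc)) (m≤n⇒m≤1+n ≤s))

  ∑-const : ∀ {A : Set} (l : List A) → ∑ (λ _ → 0) l ≡ length l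
  ∑-const []      = refl
  ∑-const (_ ∷ l) = cong suc (∑-const l)

  length≤∑ : ∀ {A : Set} (size : A → ℕ) l → length l ≤ ∑ size l
  length≤∑ size []      = z≤n
  length≤∑ size (a ∷ l) = s≤s (≤-trans (length≤∑ size l) (m≤n+m _ (size a)))

  module _ {s : ℕ} where

    -- The numerals in this and the following bounds are the constant of the loop body, here 3, plus
    -- one for the iteration.
    lengthᶜ : ∀ {A c} {e : Tm Val (list A)} → Takes s c e → length ⟦ e ⟧ ≤ s → Takes s (suc (c + 1) + 4) (lengthᵗ e)
    lengthᶜ {e = e} p ≤s = foldʳᶜ (λ _ → 0) p litᶜ (λ _ _ → varᶜ +ᶜ litᶜ)
      (≤-trans (≤-reflexive (∑-const ⟦ e ⟧)) (m≤n⇒m≤1+n ≤s))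

    appendᶜ : ∀ {A c c′} {d e : Tm Val (list A)} → Takes s c d → Takes s c′ e → length ⟦ d ⟧ ≤ s →
              Takes s (suc (c + c′) + 4) (append d e)
    appendᶜ {d = d} p q ≤s = foldʳᶜ (λ _ → 0) p q (λ _ _ → varᶜ ∷ᶜ varᶜ)
      (≤-trans (≤-reflexive (∑-const ⟦ d ⟧)) (m≤n⇒m≤1+n ≤s))

    reverseᶜ : ∀ {A c} {e : Tm Val (list A)} → Takes s c e → length ⟦ e ⟧ ≤ s → Takes s (suc (c + 1) + 4) (reverseᵗ e)
    reverseᶜ {e = e} p ≤s = foldˡᶜ (λ _ → 0) p []ᶜ (λ _ _ → varᶜ ∷ᶜ varᶜ)
      (≤-trans (≤-reflexive (∑-const ⟦ e ⟧)) (m≤n⇒m≤1+n ≤s))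

  module _ {s : ℕ} where

    -- Each `append` traverses its block and never the accumulated list, so the blocks are paid for
    -- once each.
    prependᶜ : ∀ {A c c′} {d : Tm Val (list (list A))} {e} → Takes s c d → Takes s c′ e → ∑ length ⟦ d ⟧ ≤ s →
               Takes s (suc (c + c′) + 8) (prepend d e)
    prependᶜ p q ≤s = foldˡᶜ length p q (λ _ _ → appendᶜ varᶜ varᶜ ≤-refl) (m≤n⇒m≤1+n ≤s)

    splitᶜ : ∀ {A c c′ m} {e : Tm Val (list A)} → Takes s c m → Takes s c′ e → ⟦ m ⟧ ≤ s →
             Takes s (suc (c + suc (1 + c′)) + 11) (split m e)
    splitᶜ p q ≤s = repeatᶜ p ([]ᶜ ,ᶜ q)
      (λ _ → caseᶜ (sndᶜ varᶜ) varᶜ λ _ _ _ → (varᶜ ∷ᶜ fstᶜ varᶜ) ,ᶜ varᶜ) ≤s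

  ∑-head : ∀ {l : List V} {ls ls′ s} → ls ≡ l ∷ ls′ → ∑ length ls ≤ s → length l ≤ s
  ∑-head {l} refl ≤s = ≤-trans (≤-trans (n≤1+n (length l)) (m≤m+n (suc (length l)) _)) ≤s

  ∑-tail : ∀ {l : List V} {ls ls′ s} → ls ≡ l ∷ ls′ → ∑ length ls ≤ s → ∑ length ls′ ≤ s
  ∑-tail {l} refl ≤s = ≤-trans (m≤n+m _ (suc (length l))) ≤s

  -- Costs of the pieces of the program

  degree : V × List V → ℕ
  degree v = length (proj₂ v)

  -- The factor 2: a vertex counts once for itself and at most once for a block that it opens.
  groups-size : ∀ l → ∑ length (map proj₂ (foldr insert [] l)) ≤ 2 * length l
  groups-size []      = z≤n
  groups-size (v ∷ l) = begin
    ∑ length (map proj₂ (insert v (foldr insert [] l)))  ≤⟨ insert-size v (foldr insert [] l) ⟩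
    2 + ∑ length (map proj₂ (foldr insert [] l))         ≤⟨ +-monoʳ-≤ 2 (groups-size l) ⟩
    2 + 2 * length l                                     ≡⟨ *-suc 2 (length l) ⟨
    2 * suc (length l)                                   ∎
    where
    open ≤-Reasoning
    insert-size : ∀ v cs → ∑ length (map proj₂ (insert v cs)) ≤ 2 + ∑ length (map proj₂ cs)
    insert-size (v , a) [] = ≤-refl
    insert-size (v , a) ((d , b) ∷ cs) with len a ≡ᵇ d
    ... | true  = n≤1+n _
    ... | false = ≤-refl

  classes-size : ∀ {s} l → 2 * length l ≤ s → ∑ length ⟦ classes (var l) ⟧ ≤ s
  classes-size {s} l ≤s = ≤-trans (≤-reflexive (cong (∑ length) (classes-value l))) (≤-trans (groups-size l) ≤s)

  -- The witness is inferred from the derivation, and standing outside the quantifiers it cannot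
  -- depend on the input. A step scans one adjacency list, hence the measure `degree`.
  groupᶜ : ∃[ c ] (∀ {s d} {e : Tm Val (list (vert ⊗ list vert))} → Takes s d e → ∑ degree ⟦ e ⟧ ≤ s →
                   Takes s (suc (d + 1) + c) (group e))
  groupᶜ = _ , λ p ≤s → foldʳᶜ degree p []ᶜ
    (λ _ _ → letᶜ (lengthᶜ (sndᶜ varᶜ) ≤-refl)
      (caseᶜ varᶜ ((varᶜ ,ᶜ (fstᶜ varᶜ ∷ᶜ []ᶜ)) ∷ᶜ []ᶜ) λ _ _ _ →
        if-eqᶜ varᶜ (fstᶜ varᶜ)
          ((varᶜ ,ᶜ (fstᶜ varᶜ ∷ᶜ sndᶜ varᶜ)) ∷ᶜ varᶜ)
          ((varᶜ ,ᶜ (fstᶜ varᶜ ∷ᶜ []ᶜ)) ∷ᶜ varᶜ)))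
    (m≤n⇒m≤1+n ≤s)

  classesᶜ : ∃[ c ] (∀ {s d} {e : Tm Val (list (vert ⊗ list vert))} → Takes s d e →
                     ∑ degree ⟦ e ⟧ ≤ s → 2 * length ⟦ e ⟧ ≤ s → Takes s (suc (suc (d + 1) + c + 1) + 5) (classes e))
  classesᶜ = _ , λ {s} {d} {e} p ≤s 2≤s → foldʳᶜ (λ _ → 0) (proj₂ groupᶜ p ≤s) []ᶜ
    (λ _ _ → sndᶜ varᶜ ∷ᶜ varᶜ)
    (begin
      ∑ (λ _ → 0) ⟦ group (var ⟦ e ⟧) ⟧          ≡⟨ ∑-const ⟦ group (var ⟦ e ⟧) ⟧ ⟩
      length ⟦ group (var ⟦ e ⟧) ⟧               ≡⟨ cong length (group-value ⟦ e ⟧) ⟩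
      length (foldr insert [] ⟦ e ⟧)             ≡⟨ length-map proj₂ (foldr insert [] ⟦ e ⟧) ⟨
      length (map proj₂ (foldr insert [] ⟦ e ⟧)) ≤⟨ length≤∑ length (map proj₂ (foldr insert [] ⟦ e ⟧)) ⟩
      ∑ length (map proj₂ (foldr insert [] ⟦ e ⟧)) ≤⟨ groups-size ⟦ e ⟧ ⟩
      2 * length ⟦ e ⟧                           ≤⟨ 2≤s ⟩
      s                                          ≤⟨ n≤1+n s ⟩
      suc s                                      ∎)
    where open ≤-Reasoning

  -- The potential released by one step of the sums loop. The class Y_i is read from the state and
  -- not from the traversed list, so its length has to be paid from there.
  headSize : List (List V) → ℕ
  headSize []       = 0
  headSize (l ∷ ls) = suc (length l)

  headSize-≥ : ∀ {l ls ls′} m → ls ≡ l ∷ ls′ → length l ≤ m + headSize ls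
  headSize-≥ {l} m refl = ≤-trans (n≤1+n (length l)) (m≤n+m (suc (length l)) m)

  sum₀ᶜ : ∃[ c ] (∀ {s n₂ Xs Ys} → ∑ length Xs ≤ s → ∑ length Ys ≤ s → Takes s c (sum₀ (var n₂) Xs Ys))
  sum₀ᶜ = _ , λ X≤s Y≤s → caseᶜ varᶜ litᶜ λ _ _ Y≡ → caseᶜ varᶜ litᶜ λ _ _ X≡ →
    if-eqᶜ (lengthᶜ varᶜ (∑-head Y≡ Y≤s)) litᶜ (varᶜ +ᶜ lengthᶜ varᶜ (∑-head X≡ X≤s)) varᶜ

  sumsᶜ : ∃[ c ] (∀ {s n₂ Xs Ys} → ∑ length Xs + ∑ length Ys ≤ s → Takes s c (sums n₂ Xs Ys))
  sumsᶜ = _ , λ {s} {n₂} {Xs} {Ys} ≤s → sndᶜ (sndᶜ (sndᶜ (foldˡ-potential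
    length (λ st → ∑ length (proj₁ st)) (λ st → headSize (proj₁ st))
    varᶜ
    (varᶜ ,ᶜ litᶜ ,ᶜ varᶜ ,ᶜ (proj₂ sum₀ᶜ (≤-trans (m≤m+n _ _) ≤s) (≤-trans (m≤n+m _ _) ≤s) ∷ᶜ []ᶜ))
    (λ X st → caseᶜ (fstᶜ varᶜ) varᶜ λ Y rest eq →
      letᶜ (fstᶜ (sndᶜ varᶜ) +ᶜ lengthᶜ varᶜ (m≤m+n _ _))
      (letᶜ (fstᶜ (sndᶜ (sndᶜ varᶜ)) ∸ᶜ lengthᶜ varᶜ (headSize-≥ (length X) eq))
      (letᶜ (caseᶜ varᶜ
              (if-eqᶜ (lengthᶜ varᶜ (m≤m+n _ _)) litᶜ (varᶜ +ᶜ lengthᶜ varᶜ (headSize-≥ (length X) eq)) varᶜ)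
              (λ _ _ _ → varᶜ +ᶜ varᶜ +ᶜ litᶜ))
        (varᶜ ,ᶜ varᶜ ,ᶜ varᶜ ,ᶜ (varᶜ ∷ᶜ sndᶜ (sndᶜ (sndᶜ varᶜ)))))))
    (λ { X ([] , _) → z≤n
       ; X (Y ∷ [] , _) → ≤-refl
       ; X (Y ∷ _ ∷ _ , _) → ≤-refl })
    (m≤n⇒m≤1+n ≤s))))

  sums-length : ∀ n₂ Xs Ys → length ⟦ sums n₂ Xs Ys ⟧ ≤ suc (length Xs)
  sums-length n₂ Xs Ys = foldl-length
    (λ { ([] , _) X → n≤1+n _ ; (Y ∷ [] , _) X → ≤-refl ; (Y ∷ _ ∷ _ , _) X → ≤-refl }) _ Xs
    where
    foldl-length : ∀ {f : State → List V → State} →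
      (∀ st X → length (proj₂ (proj₂ (proj₂ (f st X)))) ≤ suc (length (proj₂ (proj₂ (proj₂ st))))) → ∀ st Xs →
      length (proj₂ (proj₂ (proj₂ (foldl f st Xs)))) ≤ length (proj₂ (proj₂ (proj₂ st))) + length Xs
    foldl-length {f} p st []       = m≤m+n _ 0
    foldl-length {f} p st (X ∷ Xs) = ≤-trans (foldl-length p (f st X) Xs)
      (≤-trans (+-monoˡ-≤ (length Xs) (p st X)) (≤-reflexive (sym (+-suc _ (length Xs)))))

  -- The index becomes the iteration count of `split`, so its numerical value has to be bounded by
  -- the size of the input.
  argmax-≤ : ∀ l → ⟦ argmax (var l) ⟧ ≤ length l
  argmax-≤ l = proj₂ (loop l)
    where
    state : List ℕ → ℕ × ℕ × ℕ
    state = foldr (λ t s → proj₁ s + 1 , (if t ≤ᵇ proj₂ (proj₂ s) then proj₂ s else (proj₁ s , t))) (0 , 0 , 0)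
    loop : ∀ l → proj₁ (state l) ≤ length l × proj₁ (proj₂ (state l)) ≤ length l
    loop []      = z≤n , z≤n
    loop (t ∷ l) with loop l | t ≤ᵇ proj₂ (proj₂ (state l))
    ... | c≤ , i≤ | true  = ≤-trans (≤-reflexive (+-comm _ 1)) (s≤s c≤) , m≤n⇒m≤1+n i≤
    ... | c≤ , i≤ | false = ≤-trans (≤-reflexive (+-comm _ 1)) (s≤s c≤) , m≤n⇒m≤1+n c≤

  argmaxᶜ : ∃[ c ] (∀ {s n₂ Xs Ys} → ∑ length Xs + ∑ length Ys ≤ s → Takes s c (argmax (sums n₂ Xs Ys)))
  argmaxᶜ = _ , λ {s} {n₂} {Xs} {Ys} ≤s → fstᶜ (sndᶜ (foldʳᶜ (λ _ → 0)
    (proj₂ sumsᶜ ≤s) (litᶜ ,ᶜ litᶜ ,ᶜ litᶜ)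
    (λ _ _ → (fstᶜ varᶜ +ᶜ litᶜ) ,ᶜ if-leᶜ varᶜ (sndᶜ (sndᶜ varᶜ)) (sndᶜ varᶜ) (fstᶜ varᶜ ,ᶜ varᶜ))
    (begin
      ∑ (λ _ → 0) ⟦ sums n₂ Xs Ys ⟧ ≡⟨ ∑-const ⟦ sums n₂ Xs Ys ⟧ ⟩
      length ⟦ sums n₂ Xs Ys ⟧      ≤⟨ sums-length n₂ Xs Ys ⟩
      suc (length Xs)               ≤⟨ s≤s (≤-trans (length≤∑ length Xs) (≤-trans (m≤m+n _ (∑ length Ys)) ≤s)) ⟩
      suc s                         ∎)))
    where open ≤-Reasoning

  -- The induction runs on the sum of the two parts, since each step moves an element from one to
  -- the other.
  split-size : ∀ m (l : List (List V)) → let r = ⟦ split (lit m) (var l) ⟧ in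
               ∑ length (proj₁ r) ≤ ∑ length l × ∑ length (proj₂ r) ≤ ∑ length l
  split-size m l = ≤-trans (m≤m+n _ _) (size m) , ≤-trans (m≤n+m _ _) (size m)
    where
    size : ∀ m → let r = ⟦ split (lit m) (var l) ⟧ in ∑ length (proj₁ r) + ∑ length (proj₂ r) ≤ ∑ length l
    size zero    = ≤-refl
    size (suc m) with ⟦ split (lit m) (var l) ⟧ | size m
    ... | r , []      | ≤∑ = ≤∑
    ... | r , (h ∷ t) | ≤∑ = ≤-trans (≤-reflexive (arith (length h) (∑ length r) (∑ length t))) ≤∑
      where
      arith : ∀ a b c → suc a + b + c ≡ b + (suc a + c)
      arith = solve-∀

  ∑-reverse : ∀ (ls : List (List V)) → ∑ length (reverse ls) ≡ ∑ length ls
  ∑-reverse ls = sum-↭ (↭-map⁺ (λ l → suc (length l)) (↭-reverse ls))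

  buildᶜ : ∃[ c ] (∀ {s i k Xs Ys} → ∑ length Xs ≤ s → ∑ length Ys ≤ s → i ≤ s → Takes s c (build i k Xs Ys))
  buildᶜ = _ , λ {s} {i} {k} {Xs} {Ys} X≤s Y≤s i≤s →
    let Xr≤s = ≤-trans (≤-reflexive (∑-reverse Xs)) X≤s
        Yr≤s = ≤-trans (≤-reflexive (∑-reverse Ys)) Y≤s
    in
    if-eqᶜ varᶜ litᶜ
      (caseᶜ varᶜ []ᶜ λ _ _ Y≡ →
       if-eqᶜ (lengthᶜ varᶜ (∑-head Y≡ Y≤s)) litᶜ
         (caseᶜ varᶜ []ᶜ λ _ _ X≡ →
          caseᶜ varᶜ []ᶜ λ _ _ Y′≡ →
          appendᶜ varᶜ (prependᶜ varᶜ (appendᶜ varᶜ varᶜ (∑-head Y≡ Y≤s)) (∑-tail Y′≡ (∑-tail Y≡ Y≤s)))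
                  (∑-head X≡ X≤s))
         (prependᶜ varᶜ []ᶜ Y≤s))
    (if-eqᶜ varᶜ varᶜ
      (letᶜ (reverseᶜ varᶜ (≤-trans (length≤∑ length Xs) X≤s))
       (caseᶜ varᶜ []ᶜ λ _ _ X≡ →
        if-eqᶜ (lengthᶜ varᶜ (∑-head X≡ Xr≤s)) litᶜ
          (caseᶜ varᶜ []ᶜ λ _ _ X′≡ →
           caseᶜ (reverseᶜ varᶜ (≤-trans (length≤∑ length Ys) Y≤s)) []ᶜ λ _ _ Y≡ →
           prependᶜ varᶜ (appendᶜ varᶜ (appendᶜ varᶜ varᶜ (∑-head X≡ Xr≤s)) (∑-head Y≡ Yr≤s))
                    (∑-tail X′≡ (∑-tail X≡ Xr≤s)))
          (prependᶜ varᶜ []ᶜ Xr≤s)))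
      (letᶜ (splitᶜ (varᶜ ∸ᶜ litᶜ) varᶜ (≤-trans (m∸n≤m i 1) i≤s))
       (caseᶜ (sndᶜ varᶜ) []ᶜ λ _ _ _ →
        caseᶜ varᶜ []ᶜ λ _ _ _ →
        caseᶜ varᶜ []ᶜ λ _ _ _ →
        prependᶜ (fstᶜ varᶜ)
          (prependᶜ (sndᶜ (splitᶜ varᶜ varᶜ i≤s)) (varᶜ ∷ᶜ varᶜ) (≤-trans (proj₂ (split-size i Ys)) Y≤s))
          (≤-trans (proj₁ (split-size (i ∸ 1) Xs)) X≤s))))

  -- The strict inequality makes room for k + 1 sums, one more than there are classes, in the bound
  -- on i*.
  algorithmᶜ : ∃[ c ] (∀ {s} as bs → ∑ degree as ≤ s → ∑ degree bs ≤ s →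
                       2 * length as + 2 * length bs < s → Takes s c (chainGraphAlgorithm (as , bs)))
  algorithmᶜ = _ , λ {s} as bs as≤s bs≤s <s →
    let Xs = ⟦ classes (var as) ⟧
        Ys = ⟦ classes (var bs) ⟧
        X+Y≤s : ∑ length Xs + ∑ length Ys ≤ s
        X+Y≤s = ≤-trans (+-mono-≤ (classes-size as ≤-refl) (classes-size bs ≤-refl)) (<⇒≤ <s)
        as≤ = ≤-trans (m≤m+n (2 * length as) (2 * length bs)) (<⇒≤ <s)
        bs≤ = ≤-trans (m≤n+m (2 * length bs) (2 * length as)) (<⇒≤ <s)
        i≤s : ⟦ argmax (sums (len bs) Xs Ys) ⟧ ≤ s
        i≤s = begin
          ⟦ argmax (sums (len bs) Xs Ys) ⟧  ≤⟨ argmax-≤ ⟦ sums (len bs) Xs Ys ⟧ ⟩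
          length ⟦ sums (len bs) Xs Ys ⟧    ≤⟨ sums-length (len bs) Xs Ys ⟩
          suc (length Xs)                   ≤⟨ s≤s (length≤∑ length Xs) ⟩
          suc (∑ length Xs)                 ≤⟨ s≤s (classes-size as (m≤m+n _ _)) ⟩
          suc (2 * length as + 2 * length bs) ≤⟨ <s ⟩
          s                                 ∎
    in
    letᶜ (proj₂ classesᶜ (fstᶜ varᶜ) as≤s as≤)
    (letᶜ (proj₂ classesᶜ (sndᶜ varᶜ) bs≤s bs≤)
    (letᶜ (lengthᶜ (sndᶜ varᶜ) (≤-trans (length≤∑ degree bs) bs≤s))
    (letᶜ (lengthᶜ varᶜ (≤-trans (length≤∑ length Xs) (classes-size as as≤)))
    (letᶜ (proj₂ argmaxᶜ X+Y≤s)
    (proj₂ buildᶜ (classes-size as as≤) (classes-size bs bs≤) i≤s)))))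
    where open ≤-Reasoning

-- Size of the input in terms of vertices and edges

sum-suc : ∀ {A : Set} (f : A → ℕ) l → sum (map (λ a → suc (f a)) l) ≡ length l + sum (map f l)
sum-suc f []      = refl
sum-suc f (a ∷ l) = cong suc (trans (cong (f a +_) (sum-suc f l)) (arith (f a) (length l) _))
  where
  arith : ∀ a b c → a + (b + c) ≡ b + (a + c)
  arith = solve-∀

module InputSize (B : BipartiteGraph) (O : ChainOrdering B) (A : AdjacencyLists B) where

  open BipartiteGraph B renaming (sym to N-sym)
  open ChainOrdering O
  open AdjacencyLists A
  open Cost Vertex using (∑; degree)

  ∈-E : ∀ {u v} → u ∈ X → v ∈ N u → (u , v) ∈ₗ E
  ∈-E {u} {v} u∈ v∈ = ∈-filter⁺ (λ e → (proj₁ e ∈? X) ×-dec (proj₂ e ∈? N (proj₁ e)))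
    (∈-cartesianProduct⁺ (∈-allFin u) (∈-allFin v)) (u∈ , v∈)

  ys⇒X : ∀ {u v} → v ∈ₗ ys → u ∈ N v → u ∈ X
  ys⇒X v∈ u∈ with bipartite u∈
  ... | inj₂ (_ , u∈X) = u∈X
  ... | inj₁ (v∈X , _) = contradiction
    (subst (_ ∈_) disjoint (x∈p∩q⁺ (v∈X , enumerates⁻ enumY v∈))) ∉⊥

  -- Seen from one side, distinct adjacency entries are distinct edges. `pair` puts the X-end first,
  -- as `E` does, so for the Y-side it swaps.
  degrees-≤ : ∀ (pair : Vertex → Vertex → Vertex × Vertex) →
    (∀ {u v u′ v′} → pair u v ≡ pair u′ v′ → u ≡ u′ × v ≡ v′) →
    ∀ l → Unique l → (∀ {u v} → u ∈ₗ l → v ∈ N u → pair u v ∈ₗ E) → sum (map (length ∘ adj) l) ≤ ∣E∣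
  degrees-≤ pair inj l uniq sub = begin
    sum (map (length ∘ adj) l)   ≡⟨ cong sum (map-cong (λ v → sym (length-map (pair v) (adj v))) l) ⟩
    sum (map (length ∘ edges) l) ≡⟨ length-concatMap edges l ⟨
    length (concatMap edges l)   ≤⟨ unique-⊆⇒length≤
      (unique-concatMap edges l uniq (λ v → Unique.map⁺ (proj₂ ∘ inj) (proj₁ (enumAdj v)))
        λ {u} {v} _ _ e∈ e∈′ →
          let _ , _ , eq  = ∈-map⁻ (pair u) e∈
              _ , _ , eq′ = ∈-map⁻ (pair v) e∈′
          in proj₁ (inj (trans (sym eq) eq′)))
      (λ e∈ → let u , u∈ , e∈edges = ∈-concatMap⁻′ edges l e∈
                  v , v∈ , eq = ∈-map⁻ (pair u) e∈edges
              in subst (_∈ₗ E) (sym eq) (sub u∈ (enumerates⁻ (enumAdj u) v∈))) ⟩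
    ∣E∣                          ∎
    where
    open ≤-Reasoning
    edges : Vertex → List (Vertex × Vertex)
    edges v = map (pair v) (adj v)

  side-size : ∀ l → sum (map (length ∘ adj) l) ≤ ∣E∣ → ∑ degree (map (λ v → v , adj v) l) ≤ length l + ∣E∣
  side-size l ≤E = begin
    ∑ degree (map (λ v → v , adj v) l)     ≡⟨ cong sum (map-∘ l) ⟨
    sum (map (λ v → suc (length (adj v))) l) ≡⟨ sum-suc (length ∘ adj) l ⟩
    length l + sum (map (length ∘ adj) l)  ≤⟨ +-monoʳ-≤ (length l) ≤E ⟩
    length l + ∣E∣                         ∎
    where open ≤-Reasoning

  xs-size : ∑ degree (map (λ v → v , adj v) xs) ≤ length xs + ∣E∣
  xs-size = side-size xs (degrees-≤ _,_ (λ { refl → refl , refl }) xs (proj₁ enumX)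
    λ u∈ v∈ → ∈-E (enumerates⁻ enumX u∈) v∈)

  ys-size : ∑ degree (map (λ v → v , adj v) ys) ≤ length ys + ∣E∣
  ys-size = side-size ys (degrees-≤ (λ v u → u , v) (λ { refl → refl , refl }) ys (proj₁ enumY)
    λ v∈ u∈ → ∈-E (ys⇒X v∈ u∈) (N-sym u∈))

  sides-≤ : length xs + length ys ≤ n
  sides-≤ = begin
    length xs + length ys ≡⟨ length-++ xs ⟨
    length (xs ++ ys)     ≤⟨ unique-⊆⇒length≤ (Unique.++⁺ (proj₁ enumX) (proj₁ enumY)
                               λ (x∈ , y∈) → ∉⊥ (subst (_ ∈_) disjoint
                                 (x∈p∩q⁺ (enumerates⁻ enumX x∈ , enumerates⁻ enumY y∈)))) (λ {v} _ → ∈-allFin v) ⟩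
    length (allFin n)     ≡⟨ length-tabulate id ⟩
    n                     ∎
    where open ≤-Reasoning

theorem4 : ∃[ c ] (∀ (B : BipartiteGraph) (O : ChainOrdering B) (T : TwinClasses B) →
    let open BipartiteGraph B in
    NoIsolated → 2 ≤ TwinClasses.k T →
    (∀ (S : List Vertex) → Algorithm.Output B O T S → IsGrundyDominatingSequence S)
    × (∀ (A : AdjacencyLists B) →
    Algorithm.Output B O T (Run.result B O A)
    × Run.runningTime B O A ≤ c * (n + ∣E∣)))
-- The 4 covers the passage from `suc s` to n + |E|: twice the number of vertices, |E|, and an
-- additive 2 that is at most 2 n.
theorem4 = c * 4 , λ B O T noIsolated 2≤k →
    Constructions.output-grundy B O T noIsolated 2≤k
  , λ A → Correctness.result-output B O T noIsolated 2≤k A , linear B O T A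
  where
  -- The constant does not depend on the type of vertices.
  c : ℕ
  c = proj₁ (Cost.algorithmᶜ (Fin 0))
  linear : ∀ B O (T : TwinClasses B) A →
    Run.runningTime B O A ≤ c * 4 * (BipartiteGraph.n B + BipartiteGraph.∣E∣ B)
  linear B O T A = begin
    time (chainGraphAlgorithm (as , bs)) ≤⟨ Takes.bound (proj₂ algorithmᶜ as bs as≤ bs≤ <s) ⟩
    c * suc s                            ≤⟨ *-monoʳ-≤ c suc-s≤ ⟩
    c * (4 * (n + ∣E∣))                  ≡⟨ *-assoc c 4 (n + ∣E∣) ⟨
    c * 4 * (n + ∣E∣)                    ∎
    where
    open ≤-Reasoning
    open BipartiteGraph B using (n; ∣E∣; Vertex)
    open ChainOrdering O
    open AdjacencyLists A
    open Cost Vertex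
    open Semantics Vertex
    open Program {Val}
    open InputSize B O A
    as bs : List (Vertex × List Vertex)
    as = map (λ v → v , adj v) xs
    bs = map (λ v → v , adj v) ys
    s : ℕ
    -- Vertices count twice because of `groups-size`; the outer `suc` provides the strict
    -- inequality.
    s = suc (2 * length xs + 2 * length ys + ∣E∣)
    <s : 2 * length as + 2 * length bs < s
    <s = s≤s (≤-trans (≤-reflexive (cong₂ (λ a b → 2 * a + 2 * b) (length-map _ xs) (length-map _ ys))) (m≤m+n _ ∣E∣))
    as≤ : ∑ degree as ≤ s
    as≤ = ≤-trans xs-size (m≤n⇒m≤1+n (+-monoˡ-≤ ∣E∣ (≤-trans (m≤m+n (length xs) _) (m≤m+n _ (2 * length ys)))))
    bs≤ : ∑ degree bs ≤ s
    bs≤ = ≤-trans ys-size (m≤n⇒m≤1+n (+-monoˡ-≤ ∣E∣ (≤-trans (m≤m+n (length ys) _) (m≤n+m _ (2 * length xs)))))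
    1≤n : ∀ {m} → Fin m → 1 ≤ m
    1≤n zero    = s≤s z≤n
    1≤n (suc _) = s≤s z≤n
    suc-s≤ : suc s ≤ 4 * (n + ∣E∣)
    suc-s≤ = begin
      2 + (2 * length xs + 2 * length ys + ∣E∣) ≡⟨ arith (length xs) (length ys) ∣E∣ ⟩
      2 * 1 + (2 * (length xs + length ys) + ∣E∣)
        -- `rep 1` is a vertex, so n is at least 1.
        ≤⟨ +-mono-≤ (*-monoʳ-≤ 2 (1≤n (TwinClasses.rep T 1))) (+-monoˡ-≤ ∣E∣ (*-monoʳ-≤ 2 sides-≤)) ⟩
      2 * n + (2 * n + ∣E∣)                     ≤⟨ m≤m+n _ (3 * ∣E∣) ⟩
      2 * n + (2 * n + ∣E∣) + 3 * ∣E∣           ≡⟨ arith′ n ∣E∣ ⟩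
      4 * (n + ∣E∣)                             ∎
      where
      arith : ∀ a b e → 2 + (2 * a + 2 * b + e) ≡ 2 * 1 + (2 * (a + b) + e)
      arith = solve-∀
      arith′ : ∀ n e → 2 * n + (2 * n + e) + 3 * e ≡ 4 * (n + e)
      arith′ = solve-∀
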